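{- Let $G^s:H$ be the graph resulting from a safe split-and-glue of a safe base graph $G$ and a safe ear $H$. If $G^s:H$ is independent, then $G^s:H$ has some implied nonedge.
   Context: All graphs are finite and simple. Rank, independence and circuits refer to the 3-dimensional generic rigidity matroid $\mathcal{R}_3$; $\mathrm{rank}(G)$ is the rank of $E(G)$, $G$ is independent if $\mathrm{rank}(G)=|E(G)|$. A nonedge $f$ of $G$ is implied if $G\cup f$ contains a circuit containing $f$. For a set $F$ of vertex pairs, $G_F=G\cup F$ is $G$ with the pairs of $F$ having both endpoints in $V(G)$ added as edges; $G_F[X]$ is its induced subgraph on $X$. 2-thin covers: a 2-thin cover of $G$ is a collection $\mathcal X=\{X_1,\dots,X_k\}$ of subsets (clusters) of $V(G)$ with $|X_i|\ge 2$, $|X_i\cap X_j|\le 2$ and $X_i\not\subset X_j$ for $i\ne j$, such that both endpoints of each edge lie in some cluster. Its shared set $S(\mathcal X)$ is the set of pairs $\{u,v\}$ equal to $X_i\cap X_j$ for some $i\ne j$; $\mathcal X$ is independent if the graph formed by the pairs of $S(\mathcal X)$ is independent. $d(\mathcal X,e)$ is the number of clusters containing both endpoints of $e$. For a set $K$ of pairs, $IE_K(G,\mathcal X)=\sum_i\mathrm{rank}(G_{S(\mathcal X)\cup K}[X_i])-\sum_{e\in S(\mathcal X)\cup K}(d(\mathcal X,e)-1)$, and $IE(G,\mathcal X)=IE_\emptyset(G,\mathcal X)$. Nonedge-split of a nonedge $(a,b)$: add new vertices $a_1,a_2$ whose neighbourhoods partition $N(a)$, new vertices $b_1,b_2$ whose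 neighbourhoods partition $N(b)$, delete $a,b$; result $G^s$. A safe nonedge-split on $(G,\mathcal X)$ ($\mathcal X$ a 2-thin cover of $G$) is a nonedge-split of a nonedge $(a,b)$ with $\{a,b\}\in S(\mathcal X)$ such that, with $X_i'=(X_i\setminus\{a,b\})\cup W_i$ where $W_i$ is the set of vertices of $\{a_1,a_2,b_1,b_2\}$ adjacent in $G^s$ to some vertex of $X_i$: (S1) whenever $X_i$ contains both endpoints of some pair of $S(\mathcal X)$ that is a nonedge of $G$, neither $\{a_1,a_2\}$ nor $\{b_1,b_2\}$ is a subset of $X_i'$; (S2) if $X_i\cap X_j=\{a,u\}$ with $u\ne b$ and $(a,u)$ a nonedge of $G$, then $X_i'\cap\{a_1,a_2\}=X_j'\cap\{a_1,a_2\}$, and symmetrically with $a,a_1,a_2$ replaced by $b,b_1,b_2$. The safe split cover $\mathcal X^s$ of $G^s$ consists of those $X_i'$ of size greater than two containing neither $\{a_1,a_2\}$ nor $\{b_1,b_2\}$, together with the endpoint pairs $\{x,y\}$ of the edges of $G^s$ not contained in any of these sets. A key gluing pair of $G^s$ is a pair of distinct vertices of $\{a_1,a_2,b_1,b_2\}$ contained in some cluster of $\mathcal X^s$; the gluing vertices of $G^s$ are a chosen subset of $\{a_1,a_2,b_1,b_2\}$ containing all endpoints of key gluing pairs. A safe base graph is an independent graph $G$ with an independent 2-thin cover $\mathcal X$ such that $\mathrm{rank}(G)=IE(G,\mathcal X)$ and $S(\mathcal X)$ contains a nonedge $(a,b)$ of $G$ that can be split by a safe nonedge-split on $(G,\mathcal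 X)$. A safe ear is a graph $H$ with an independent 2-thin cover $\mathcal X^H$ (safe ear cover) and a set of gluing vertices such that, calling a key gluing pair of $H$ any pair of distinct gluing vertices contained in a common cluster of $\mathcal X^H$ and $K_H$ the set of these: (E1) each cluster of $\mathcal X^H$ contains at most two gluing vertices; (E2) $S(\mathcal X^H)\cup F$ is independent, where $F$ is the set of all pairs of distinct gluing vertices; (E3) $\mathrm{rank}(H)=IE_{K_H}(H,\mathcal X^H)-1$. A safe split-and-glue of a safe base graph $G$ (with $\mathcal X$, $(a,b)$) and a vertex-disjoint safe ear $H$: perform a safe nonedge-split on $(G,\mathcal X)$ yielding $G^s$, then form $G^s:H$ by bijectively identifying the gluing vertices of $G^s$ with the gluing vertices of $H$ so that the key gluing pairs of $G^s$ correspond bijectively to the key gluing pairs of $H$. -}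

module Defs where

open import Level using (0ℓ)
open import Data.Nat as ℕ using (ℕ; _≤_; _⊓_; _⊔_; _≟_)
open import Data.Nat.ListAction using (sum)
open import Data.Fin using (Fin)
open import Data.Bool using (Bool; true; false; if_then_else_)
open import Data.Product using (Σ; ∃; ∃-syntax; _×_; _,_; proj₁; proj₂)
open import Data.Product.Properties using (≡-dec)
open import Data.Sum using (_⊎_; inj₁; inj₂)
open import Data.List using (List; []; _∷_; _++_; length; map; filter; foldr; concatMap; lookup; deduplicate; removeAt)
open import Data.List.Relation.Unary.All using (All)
open import Data.List.Relation.Unary.Any using (any?)
open import Data.List.Relation.Unary.AllPairs using (AllPairs)
open import Data.List.Relation.Unary.Unique.Propositional using (Unique)
open import Data.List.Relation.Binary.Pointwise using (Pointwise)
open import Data.List.Relation.Binary.Subset.Propositional using (_⊆_)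
open import Data.List.Membership.Propositional using (_∈_; _∉_)
open import Data.List.Membership.DecPropositional _≟_ using (_∈?_)
open import Data.Rational as ℚ using (ℚ; 0ℚ)
open import Data.Integer as ℤ using (ℤ; +_)
open import Relation.Nullary using (¬_; Dec; yes; no)
open import Relation.Nullary.Decidable using (_×-dec_)
open import Relation.Binary.PropositionalEquality using (_≡_; _≢_)

-- Basic conventions: vertices are natural numbers, a (vertex) pair is an
-- ordered pair of naturals read as an unordered pair {u,v}.

Vtx : Set
Vtx = ℕ

Pair : Set
Pair = Vtx × Vtx

_⇔_ : Set → Set → Set
A ⇔ B = (A → B) × (B → A)

SamePair : Pair → Pair → Set
SamePair (u , v) (x , y) = (u ≡ x × v ≡ y) ⊎ (u ≡ y × v ≡ x)

_∈ᵖ_ : Pair → List Pair → Set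
(u , v) ∈ᵖ L = ((u , v) ∈ L) ⊎ ((v , u) ∈ L)

UniquePairs : List Pair → Set
UniquePairs = AllPairs (λ e f → ¬ SamePair e f)

norm : Pair → Pair
norm (u , v) = (u ⊓ v , u ⊔ v)

_≟ᵖ_ : (e f : Pair) → Dec (e ≡ f)
_≟ᵖ_ = ≡-dec _≟_ _≟_

dedupNorm : List Pair → List Pair
dedupNorm L = deduplicate _≟ᵖ_ (map norm L)

pairsOf : {A : Set} → List A → List (A × A)
pairsOf []       = []
pairsOf (x ∷ xs) = map (x ,_) xs ++ pairsOf xs

record Graph : Set where
  field
    V          : List Vtx
    E          : List Pair
    V-unique   : Unique V
    E-vertices : ∀ {u v} → (u , v) ∈ E → (u ∈ V) × (v ∈ V)
    E-loopless : ∀ {u v} → (u , v) ∈ E → u ≢ v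
    E-simple   : UniquePairs E
open Graph public

Adj : Graph → Vtx → Vtx → Set
Adj G u v = (u , v) ∈ᵖ E G

Nonedge : Graph → Vtx → Vtx → Set
Nonedge G u v = (u ∈ V G) × (v ∈ V G) × (u ≢ v) × ¬ Adj G u v

-- The 3-dimensional generic rigidity matroid R_3.
-- A set of pairs is independent iff the corresponding rows of the
-- rigidity matrix are linearly independent for SOME placement of the
-- vertices in ℚ³ (equivalently: for a generic placement in ℝ³).

Placement : Set
Placement = Vtx → Fin 3 → ℚ

rowEntry : Placement → Pair → Vtx → Fin 3 → ℚ
rowEntry p (u , v) w i with w ≟ u | w ≟ v
... | yes _ | _     = p u i ℚ.- p v i
... | no _  | yes _ = p v i ℚ.- p u i
... | no _  | no _  = 0ℚ

sumℚ : List ℚ → ℚ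
sumℚ = foldr ℚ._+_ 0ℚ

linComb : Placement → List (ℚ × Pair) → Vtx → Fin 3 → ℚ
linComb p cs w i = sumℚ (map (λ ce → proj₁ ce ℚ.* rowEntry p (proj₂ ce) w i) cs)

zipL : {A B : Set} → List A → List B → List (A × B)
zipL []       _        = []
zipL _        []       = []
zipL (x ∷ xs) (y ∷ ys) = (x , y) ∷ zipL xs ys

RowsIndependent : Placement → List Pair → Set
RowsIndependent p L =
  ∀ (cs : List ℚ) → length cs ≡ length L →
  (∀ w i → linComb p (zipL cs L) w i ≡ 0ℚ) → All (_≡ 0ℚ) cs

Indep : List Pair → Set
Indep L = ∃[ p ] RowsIndependent p L

HasRank : List Pair → ℕ → Set
HasRank L r =
  (∃[ M ] (M ⊆ L) × Indep M × length M ≡ r) ×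
  (∀ M → M ⊆ L → Indep M → length M ≤ r)

Circuit : List Pair → Set
Circuit C = UniquePairs C × ¬ Indep C × (∀ k → Indep (removeAt C k))

ImpliedNonedge : Graph → Vtx → Vtx → Set
ImpliedNonedge G u v =
  Nonedge G u v × ∃[ C ] (C ⊆ ((u , v) ∷ E G)) × ((u , v) ∈ C) × Circuit C

Cover : Set
Cover = List (List Vtx)

inter : List Vtx → List Vtx → List Vtx
inter X Y = filter (_∈? Y) X

cl : (𝒳 : Cover) → Fin (length 𝒳) → List Vtx
cl = lookup

record TwoThinCover (G : Graph) (𝒳 : Cover) : Set where
  field
    cl-unique  : All Unique 𝒳
    cl-sub     : All (_⊆ V G) 𝒳
    cl-size    : All (λ X → 2 ≤ length X) 𝒳
    thin       : ∀ i j → i ≢ j → length (inter (cl 𝒳 i) (cl 𝒳 j)) ≤ 2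
    incompar   : ∀ i j → i ≢ j → ¬ (cl 𝒳 i ⊆ cl 𝒳 j)
    covers     : ∀ {u v} → (u , v) ∈ E G → ∃[ X ] (X ∈ 𝒳) × (u ∈ X) × (v ∈ X)

pairOf2 : List Vtx → List Pair
pairOf2 (u ∷ v ∷ []) = norm (u , v) ∷ []
pairOf2 _            = []

shared : Cover → List Pair
shared 𝒳 = dedupNorm (concatMap (λ XY → pairOf2 (inter (proj₁ XY) (proj₂ XY))) (pairsOf 𝒳))

dCov : Cover → Pair → ℕ
dCov 𝒳 (u , v) = length (filter (λ X → (u ∈? X) ×-dec (v ∈? X)) 𝒳)

inducedOn : List Vtx → List Pair → List Pair
inducedOn X L = filter (λ e → (proj₁ e ∈? X) ×-dec (proj₂ e ∈? X)) L

sumℤ : List ℤ → ℤ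
sumℤ = foldr ℤ._+_ (+ 0)

HasIE : Graph → Cover → List Pair → ℤ → Set
HasIE G 𝒳 K z =
  ∃[ rs ] Pointwise (λ X r → HasRank (inducedOn X (E G ++ SK)) r) 𝒳 rs ×
          (z ≡ (+ sum rs) ℤ.- sumℤ (map (λ e → (+ dCov 𝒳 e) ℤ.- (+ 1)) SK))
  where SK = dedupNorm (shared 𝒳 ++ K)

IndependentCover : Cover → Set
IndependentCover 𝒳 = Indep (shared 𝒳)

-- Safe base graph (without the clause on splittability, which in the
-- theorem is witnessed by the given safe split)

record SafeBase (G : Graph) (𝒳 : Cover) (a b : Vtx) : Set where
  field
    indepG   : Indep (E G)
    cover    : TwoThinCover G 𝒳
    indepCov : IndependentCover 𝒳
    rankIE   : ∃[ r ] HasRank (E G) r × HasIE G 𝒳 [] (+ r)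
    ab-nonedge : Nonedge G a b
    ab-shared  : norm (a , b) ∈ shared 𝒳

record NonedgeSplit (G : Graph) (a b a₁ a₂ b₁ b₂ : Vtx) (Gs : Graph) : Set where
  field
    new-unique : Unique (a₁ ∷ a₂ ∷ b₁ ∷ b₂ ∷ [])
    new-fresh  : All (_∉ V G) (a₁ ∷ a₂ ∷ b₁ ∷ b₂ ∷ [])
    vertices   : ∀ w → (w ∈ V Gs) ⇔
                   (((w ∈ V G) × w ≢ a × w ≢ b) ⊎ (w ∈ (a₁ ∷ a₂ ∷ b₁ ∷ b₂ ∷ [])))
    old-edges  : ∀ u v → u ∈ V Gs → v ∈ V Gs →
                   u ∉ (a₁ ∷ a₂ ∷ b₁ ∷ b₂ ∷ []) → v ∉ (a₁ ∷ a₂ ∷ b₁ ∷ b₂ ∷ []) →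
                   Adj Gs u v ⇔ Adj G u v
    a₁-sub     : ∀ x → Adj Gs a₁ x → Adj G a x
    a₂-sub     : ∀ x → Adj Gs a₂ x → Adj G a x
    b₁-sub     : ∀ x → Adj Gs b₁ x → Adj G b x
    b₂-sub     : ∀ x → Adj Gs b₂ x → Adj G b x
    a-part     : ∀ x → Adj G a x →
                   (Adj Gs a₁ x × ¬ Adj Gs a₂ x) ⊎ (Adj Gs a₂ x × ¬ Adj Gs a₁ x)
    b-part     : ∀ x → Adj G b x →
                   (Adj Gs b₁ x × ¬ Adj Gs b₂ x) ⊎ (Adj Gs b₂ x × ¬ Adj Gs b₁ x)

SplitCl : Graph → Vtx → Vtx → Vtx → Vtx → Vtx → Vtx → List Vtx → Vtx → Set
SplitCl Gs a b a₁ a₂ b₁ b₂ X w =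
  ((w ∈ X) × w ≢ a × w ≢ b) ⊎
  ((w ∈ (a₁ ∷ a₂ ∷ b₁ ∷ b₂ ∷ [])) × ∃[ x ] (x ∈ X) × x ≢ a × x ≢ b × Adj Gs w x)

record SafeSplit (G : Graph) (𝒳 : Cover) (a b a₁ a₂ b₁ b₂ : Vtx) (Gs : Graph) : Set where
  X' : Fin (length 𝒳) → Vtx → Set
  X' i = SplitCl Gs a b a₁ a₂ b₁ b₂ (cl 𝒳 i)
  field
    split : NonedgeSplit G a b a₁ a₂ b₁ b₂ Gs
    S1 : ∀ i → (∃[ u ] ∃[ v ] ((u , v) ∈ shared 𝒳) × (u ∈ cl 𝒳 i) × (v ∈ cl 𝒳 i) × ¬ Adj G u v) →
           ¬ (X' i a₁ × X' i a₂) × ¬ (X' i b₁ × X' i b₂)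
    S2a : ∀ i j u → i ≢ j → u ≢ a → u ≢ b → ¬ Adj G a u →
           (∀ w → ((w ∈ cl 𝒳 i) × (w ∈ cl 𝒳 j)) ⇔ (w ≡ a ⊎ w ≡ u)) →
           (X' i a₁ ⇔ X' j a₁) × (X' i a₂ ⇔ X' j a₂)
    S2b : ∀ i j u → i ≢ j → u ≢ b → u ≢ a → ¬ Adj G b u →
           (∀ w → ((w ∈ cl 𝒳 i) × (w ∈ cl 𝒳 j)) ⇔ (w ≡ b ⊎ w ≡ u)) →
           (X' i b₁ ⇔ X' j b₁) × (X' i b₂ ⇔ X' j b₂)

KeptCl : Graph → (𝒳 : Cover) → Vtx → Vtx → Vtx → Vtx → Vtx → Vtx → Fin (length 𝒳) → Set
KeptCl Gs 𝒳 a b a₁ a₂ b₁ b₂ i =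
  (∃[ x ] ∃[ y ] ∃[ z ] P x × P y × P z × x ≢ y × x ≢ z × y ≢ z) ×
  ¬ (P a₁ × P a₂) × ¬ (P b₁ × P b₂)
  where P = SplitCl Gs a b a₁ a₂ b₁ b₂ (cl 𝒳 i)

SplitCoverCl : Graph → Cover → Vtx → Vtx → Vtx → Vtx → Vtx → Vtx → (Vtx → Set) → Set
SplitCoverCl Gs 𝒳 a b a₁ a₂ b₁ b₂ C =
  (∃[ i ] KeptCl Gs 𝒳 a b a₁ a₂ b₁ b₂ i × (∀ w → C w ⇔ P i w)) ⊎
  (∃[ x ] ∃[ y ] Adj Gs x y × (∀ w → C w ⇔ (w ≡ x ⊎ w ≡ y)) ×
      ¬ (∃[ i ] KeptCl Gs 𝒳 a b a₁ a₂ b₁ b₂ i × P i x × P i y))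
  where P = λ i → SplitCl Gs a b a₁ a₂ b₁ b₂ (cl 𝒳 i)

KeyPairGs : Graph → Cover → Vtx → Vtx → Vtx → Vtx → Vtx → Vtx → Vtx → Vtx → Set₁
KeyPairGs Gs 𝒳 a b a₁ a₂ b₁ b₂ w₁ w₂ =
  (w₁ ∈ (a₁ ∷ a₂ ∷ b₁ ∷ b₂ ∷ [])) × (w₂ ∈ (a₁ ∷ a₂ ∷ b₁ ∷ b₂ ∷ [])) × w₁ ≢ w₂ ×
  ∃[ C ] SplitCoverCl Gs 𝒳 a b a₁ a₂ b₁ b₂ C × C w₁ × C w₂

KeyPairH : Cover → List Vtx → Vtx → Vtx → Set
KeyPairH 𝒳 gl h₁ h₂ =
  (h₁ ∈ gl) × (h₂ ∈ gl) × h₁ ≢ h₂ × ∃[ X ] (X ∈ 𝒳) × (h₁ ∈ X) × (h₂ ∈ X)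

keyPairsH : Cover → List Vtx → List Pair
keyPairsH 𝒳 gl =
  dedupNorm (filter (λ e → any? (λ X → (proj₁ e ∈? X) ×-dec (proj₂ e ∈? X)) 𝒳) (pairsOf gl))

record SafeEar (H : Graph) (𝒳 : Cover) (gl : List Vtx) : Set where
  field
    cover    : TwoThinCover H 𝒳
    indepCov : IndependentCover 𝒳
    gl-unique : Unique gl
    gl-sub    : gl ⊆ V H
    E1 : All (λ X → length (filter (_∈? gl) X) ≤ 2) 𝒳
    E2 : Indep (dedupNorm (shared 𝒳 ++ pairsOf gl))
    E3 : ∃[ r ] HasRank (E H) r × HasIE H 𝒳 (keyPairsH 𝒳 gl) (+ (ℕ.suc r))

-- Gluing: glue is a list of pairs (s , h) identifying the gluing vertex s
-- of G^s with the gluing vertex h of H.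

Ren : List Pair → Vtx → Vtx → Set
Ren glue h u = ((u , h) ∈ glue) ⊎ ((h ∉ map proj₂ glue) × u ≡ h)

record Glued (Gs H : Graph) (glue : List Pair) (J : Graph) : Set where
  field
    vertices : ∀ w → (w ∈ V J) ⇔ ((w ∈ V Gs) ⊎ ((w ∈ V H) × (w ∉ map proj₂ glue)))
    edges    : ∀ u v → Adj J u v ⇔
                 (Adj Gs u v ⊎ ∃[ h₁ ] ∃[ h₂ ] Adj H h₁ h₂ × Ren glue h₁ u × Ren glue h₂ v)

{-# OPTIONS --safe #-}
module Submission where

-- Equality rank(G) = IE(G, 𝒳) says that the shared set S together with one basis extension per
-- cluster spans G with exactly |E(G)| pairs. After the split every cluster is relabelled by replacing
-- a and b by one of their copies, and by (S2) every shared pair but {a,b} keeps a single image. The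
-- images of {a,b} are key gluing pairs, which the ear already provides. So the glued graph together
-- with the ear's pairs S ∪ K is spanned by (|E(G)| - 1) + (rank(H) + 1) ≤ |E(J)| pairs, and an
-- independent J spans all of S ∪ K. Some pair of S ∪ K is a nonedge of H, since otherwise IE counts
-- every edge of H once and (E3) fails; this pair is implied in J.
--
-- When a or b is isolated in a cluster, the image of {a,b} is not a key pair. Then a and b are kept as
-- extra vertices of degree three attached to J, which affects neither independence nor spanning.
--
-- All of this is linear algebra over ℚ at one placement that is good for finitely many independent
-- sets at once; such a placement is found on lines, where an independent set has few bad parameters.

open import Defs
open import Data.Nat as ℕ using (ℕ; zero; suc; z≤n; s≤s; _≤_; _<_)
import Data.Nat.Properties as ℕₚ
import Data.Nat.Coprimality as Coprimality
import Data.Nat.Tactic.RingSolver as ℕ-Solver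
open import Data.Nat.ListAction using (sum)
open import Data.Fin using (Fin; zero; suc; punchIn; punchOut)
import Data.Fin.Properties as Finₚ
open import Data.Integer as ℤ using (ℤ)
import Data.Integer.Properties as ℤₚ
import Data.Integer.Tactic.RingSolver as ℤ-Solver
open import Data.Rational as ℚ using (ℚ; 0ℚ; 1ℚ)
import Data.Rational.Properties as ℚₚ
open import Data.Rational.Solver using (module +-*-Solver)
open import Data.Product using (∃-syntax; _×_; _,_; proj₁; proj₂; swap)
open import Data.Product.Properties using (≡-dec)
open import Data.Sum using (_⊎_; inj₁; inj₂)
open import Data.Empty using (⊥; ⊥-elim)
open import Data.List using (List; []; _∷_; _++_; lookup; filter; length; map; tabulate; upTo; concat; concatMap;
  cartesianProduct; allFin; removeAt)
import Data.List.Properties as Listₚ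
open import Data.List.Relation.Unary.All as All using (All; []; _∷_)
import Data.List.Relation.Unary.All.Properties as Allₚ
open import Data.List.Relation.Unary.Any as Any using (Any; here; there; any?)
import Data.List.Relation.Unary.Any.Properties as Anyₚ
open import Data.List.Relation.Unary.AllPairs as AllPairs using (AllPairs; []; _∷_)
import Data.List.Relation.Unary.AllPairs.Properties as AllPairsₚ
open import Data.List.Relation.Unary.Unique.Propositional using (Unique)
import Data.List.Relation.Unary.Unique.Propositional.Properties as Uniqueₚ
open import Data.List.Relation.Unary.Unique.DecPropositional.Properties _≟ᵖ_ using (deduplicate-!)
open import Data.List.Relation.Binary.Pointwise using (Pointwise; []; _∷_)
open import Data.List.Relation.Binary.Subset.Propositional using (_⊆_)
open import Data.List.Membership.Propositional using (_∈_; _∉_; find; lose)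
open import Data.List.Membership.DecPropositional ℕ._≟_ using (_∈?_)
open import Data.List.Membership.DecPropositional _≟ᵖ_ using () renaming (_∈?_ to _∈ᵖ?_)
open import Data.List.Membership.Propositional.Properties
open import Algebra.Bundles using (CommutativeRing)
import Algebra.Properties.Semiring.Sum
open import Function using (_∘_)
open import Function.Definitions using (Injective)
open import Relation.Nullary using (¬_; Dec; yes; no; contradiction; ¬?)
open import Relation.Nullary.Decidable as Dec using (_×-dec_; _⊎-dec_)
open import Relation.Unary using (Decidable)
open import Relation.Binary.PropositionalEquality

-- Suppose a nonedge `f` of the ear, taken from S ∪ K, could be added to `J` without losing
-- independence. Then `E J`, `f` and the six edges of the two stars at `a` and `b` are `|E J| + 7`
-- independent rows, yet all of them lie in the span of the list `W`, whose length is at most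
-- `|E J| + 6`. This is the whole contradiction. The one unit that decides it balances exactly: (E3)
-- allows the ear one pair more than rank(H), and {a,b}, which gets no image of its own, pays it
-- back. The obstacle is that independence means independence at some placement, while each cluster
-- has its own relabelling and its own basis. So a cluster basis stays on the vertices of `G` and is
-- tested at `p ∘ relabel X`, with `p` a placement of the glued vertices. In this form the bases of
-- all clusters, the ear, the stars and `J` with `f` are conditions on a single `p`. Bases are
-- chosen greedily, which requires independence to be decidable although it quantifies over all
-- placements; hence the finite grid.

module _ where

  private variable
    X : Set
    m n : ℕ

  open import Data.Rational using (_+_; _*_; _-_; -_)
  open Algebra.Properties.Semiring.Sum (CommutativeRing.semiring ℚₚ.+-*-commutativeRing)
    using (*-distribˡ-sum; *-distribʳ-sum; ∑-comm; sum-cong-≗) renaming (sum to ∑)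
  open ≡-Reasoning
  open +-*-Solver using (solve; _:+_; _:*_; _:-_; :-_; _:=_; con)

  -- Linear algebra over ℚ

  inverse : ∀ {x} → x ≢ 0ℚ → ∃[ y ] y * x ≡ 1ℚ
  inverse {x} x≢0 = (ℚ.1/ x) {{nz}} , ℚₚ.*-inverseˡ x {{nz}}
    where nz = ℚ.≢-nonZero x≢0

  x*y≡0⇒y≡0 : ∀ {x y} → x ≢ 0ℚ → x * y ≡ 0ℚ → y ≡ 0ℚ
  x*y≡0⇒y≡0 {x} {y} x≢0 xy≡0 with inverse x≢0
  ... | z , zx≡1 = begin
    y            ≡⟨ sym (ℚₚ.*-identityˡ y) ⟩
    1ℚ * y       ≡⟨ cong (_* y) (sym zx≡1) ⟩
    z * x * y    ≡⟨ ℚₚ.*-assoc z x y ⟩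
    z * (x * y)  ≡⟨ cong (z *_) xy≡0 ⟩
    z * 0ℚ       ≡⟨ ℚₚ.*-zeroʳ z ⟩
    0ℚ           ∎

  x-y≡0⇒x≡y : ∀ {x y} → x - y ≡ 0ℚ → x ≡ y
  x-y≡0⇒x≡y {x} {y} eq = begin
    x            ≡⟨ solve 2 (λ x y → x := (x :- y) :+ y) refl x y ⟩
    (x - y) + y  ≡⟨ cong (_+ y) eq ⟩
    0ℚ + y       ≡⟨ ℚₚ.+-identityˡ y ⟩
    y            ∎

  comb : (Fin n → ℚ) → (Fin n → X → ℚ) → X → ℚ
  comb c A x = ∑ (λ j → c j * A j x)

  Ind : (Fin n → X → ℚ) → Set
  Ind A = ∀ c → (∀ x → comb c A x ≡ 0ℚ) → ∀ j → c j ≡ 0ℚ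

  -- Dependence with explicit coefficients. Constructively `¬ Ind` supplies none, and both the span
  -- argument and the eigenvector argument compute with them.
  Rel : (Fin n → X → ℚ) → Set
  Rel A = ∃[ c ] (∀ x → comb c A x ≡ 0ℚ) × ∃[ j ] c j ≢ 0ℚ

  InSpan : (Fin n → X → ℚ) → (X → ℚ) → Set
  InSpan A v = ∃[ c ] (∀ x → v x ≡ comb c A x)

  comb-cong : ∀ {c d u v : Fin n → ℚ} → (∀ j → c j ≡ d j) → (∀ j → u j ≡ v j) →
    ∑ (λ j → c j * u j) ≡ ∑ (λ j → d j * v j)
  comb-cong eq₁ eq₂ = sum-cong-≗ (λ j → cong₂ _*_ (eq₁ j) (eq₂ j))

  comb-scale : ∀ k (c : Fin n → ℚ) (A : Fin n → X → ℚ) x →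
    comb (λ j → k * c j) A x ≡ k * comb c A x
  comb-scale k c A x = trans (sum-cong-≗ (λ j → ℚₚ.*-assoc k (c j) (A j x)))
    (sym (*-distribˡ-sum k (λ j → c j * A j x)))

  comb-zero : (c : Fin n → ℚ) (A : Fin n → X → ℚ) (x : X) → (∀ j → c j ≡ 0ℚ) → comb c A x ≡ 0ℚ
  comb-zero {zero}  c A x eq = refl
  comb-zero {suc n} c A x eq = cong₂ _+_
    (trans (cong (_* A zero x) (eq zero)) (ℚₚ.*-zeroˡ (A zero x)))
    (comb-zero (c ∘ suc) (A ∘ suc) x (eq ∘ suc))

  comb-zeroʳ : (c : Fin n → ℚ) (A : Fin n → X → ℚ) (x : X) → (∀ j → A j x ≡ 0ℚ) → comb c A x ≡ 0ℚ
  comb-zeroʳ {zero}  c A x eq = refl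
  comb-zeroʳ {suc n} c A x eq = cong₂ _+_
    (trans (cong (c zero *_) (eq zero)) (ℚₚ.*-zeroʳ (c zero)))
    (comb-zeroʳ (c ∘ suc) (A ∘ suc) x (eq ∘ suc))

  comb-linear : ∀ (c : Fin n → ℚ) (A B : Fin n → X → ℚ) (s t : ℚ) x →
    comb c (λ j x → s * A j x + t * B j x) x ≡ s * comb c A x + t * comb c B x
  comb-linear {zero} c A B s t x = sym (trans (cong₂ _+_ (ℚₚ.*-zeroʳ s) (ℚₚ.*-zeroʳ t)) refl)
  comb-linear {suc n} c A B s t x = begin
    c zero * (s * A zero x + t * B zero x) + comb (c ∘ suc) (λ j x → s * A (suc j) x + t * B (suc j) x) x
      ≡⟨ cong (c zero * (s * A zero x + t * B zero x) +_) (comb-linear (c ∘ suc) (A ∘ suc) (B ∘ suc) s t x) ⟩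
    c zero * (s * A zero x + t * B zero x) + (s * p + t * q)
      ≡⟨ solve 7 (λ c s a t b p q → c :* (s :* a :+ t :* b) :+ (s :* p :+ t :* q)
                                 := s :* (c :* a :+ p) :+ t :* (c :* b :+ q)) refl
           (c zero) s (A zero x) t (B zero x) p q ⟩
    s * (c zero * A zero x + p) + t * (c zero * B zero x + q) ∎
    where
      p = comb (c ∘ suc) (A ∘ suc) x
      q = comb (c ∘ suc) (B ∘ suc) x

  -- Associativity of the matrix product `d C A`, by exchanging two finite sums. Every change of
  -- spanning set goes through it.
  comb-assoc : (d : Fin m → ℚ) (C : Fin m → Fin n → ℚ) (A : Fin n → X → ℚ) (x : X) →
    comb (comb d C) A x ≡ comb d (λ r → comb (C r) A) x
  comb-assoc d C A x = begin
    ∑ (λ j → ∑ (λ r → d r * C r j) * A j x)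
      ≡⟨ sum-cong-≗ (λ j → *-distribʳ-sum (A j x) (λ r → d r * C r j)) ⟩
    ∑ (λ j → ∑ (λ r → d r * C r j * A j x))
      ≡⟨ ∑-comm (λ j r → d r * C r j * A j x) ⟩
    ∑ (λ r → ∑ (λ j → d r * C r j * A j x))
      ≡⟨ sum-cong-≗ (λ r → comb-scale (d r) (C r) A x) ⟩
    ∑ (λ r → d r * comb (C r) A x) ∎

  δ : Fin n → Fin n → ℚ
  δ zero    zero    = 1ℚ
  δ zero    (suc j) = 0ℚ
  δ (suc i) zero    = 0ℚ
  δ (suc i) (suc j) = δ i j

  δ-refl : (i : Fin n) → δ i i ≡ 1ℚ
  δ-refl zero    = refl
  δ-refl (suc i) = δ-refl i

  δ-≢ : {i j : Fin n} → i ≢ j → δ i j ≡ 0ℚ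
  δ-≢ {i = zero}  {zero}  i≢j = contradiction refl i≢j
  δ-≢ {i = zero}  {suc j} i≢j = refl
  δ-≢ {i = suc i} {zero}  i≢j = refl
  δ-≢ {i = suc i} {suc j} i≢j = δ-≢ (i≢j ∘ cong suc)

  δ-injective : {φ : Fin m → Fin n} → Injective _≡_ _≡_ φ → ∀ i j → δ (φ i) (φ j) ≡ δ i j
  δ-injective {φ = φ} inj i j with i Finₚ.≟ j
  ... | yes refl = trans (δ-refl (φ i)) (sym (δ-refl i))
  ... | no i≢j   = trans (δ-≢ (i≢j ∘ inj)) (sym (δ-≢ i≢j))

  comb-δ : ∀ i (A : Fin n → X → ℚ) x → comb (δ i) A x ≡ A i x
  comb-δ zero A x = begin
    1ℚ * A zero x + comb (λ _ → 0ℚ) (A ∘ suc) x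
      ≡⟨ cong₂ _+_ (ℚₚ.*-identityˡ (A zero x)) (comb-zero (λ _ → 0ℚ) (A ∘ suc) x (λ _ → refl)) ⟩
    A zero x + 0ℚ ≡⟨ ℚₚ.+-identityʳ (A zero x) ⟩
    A zero x ∎
  comb-δ (suc i) A x = trans (cong₂ _+_ (ℚₚ.*-zeroˡ (A zero x)) (comb-δ i (A ∘ suc) x)) (ℚₚ.+-identityˡ _)

  comb-δʳ : ∀ (c : Fin n → ℚ) j → comb c δ j ≡ c j
  comb-δʳ c zero = begin
    c zero * 1ℚ + comb (c ∘ suc) (λ i → δ (suc i)) zero
      ≡⟨ cong₂ _+_ (ℚₚ.*-identityʳ (c zero)) (comb-zeroʳ (c ∘ suc) (λ i → δ (suc i)) zero (λ _ → refl)) ⟩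
    c zero + 0ℚ ≡⟨ ℚₚ.+-identityʳ (c zero) ⟩
    c zero ∎
  comb-δʳ c (suc j) = trans (cong₂ _+_ (ℚₚ.*-zeroʳ (c zero)) (comb-δʳ (c ∘ suc) j)) (ℚₚ.+-identityˡ _)

  -- Coefficients on `B` are pushed forward along `φ` to coefficients on `A`. Injectivity keeps them
  -- from being added together, so `c j` can be read back at `φ j`.
  Ind-injection : {A : Fin n → X → ℚ} {B : Fin m → X → ℚ} (φ : Fin m → Fin n) →
    Injective _≡_ _≡_ φ → (∀ j x → B j x ≡ A (φ j) x) → Ind A → Ind B
  Ind-injection {A = A} {B} φ inj eq ind c rel j = begin
    c j                       ≡⟨ sym (comb-δʳ c j) ⟩
    comb c δ j                ≡⟨ comb-cong {c = c} (λ _ → refl)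
                                   (λ i → sym (δ-injective inj i j)) ⟩
    comb c (δ ∘ φ) (φ j)      ≡⟨ ind (comb c (δ ∘ φ)) vanishes (φ j) ⟩
    0ℚ                        ∎
    where
      vanishes : ∀ x → comb (comb c (δ ∘ φ)) A x ≡ 0ℚ
      vanishes x = trans (comb-assoc c (δ ∘ φ) A x)
        (trans (comb-cong {c = c} (λ _ → refl) (λ i → trans (comb-δ (φ i) A x) (sym (eq i x)))) (rel x))

  InSpan-member : (A : Fin n → X → ℚ) (j : Fin n) {v : X → ℚ} → (∀ x → v x ≡ A j x) → InSpan A v
  InSpan-member A j eq = δ j , λ x → trans (eq x) (sym (comb-δ j A x))

  InSpan-trans : {A : Fin n → X → ℚ} {B : Fin m → X → ℚ} {v : X → ℚ} →
    InSpan A v → (∀ j → InSpan B (A j)) → InSpan B v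
  InSpan-trans {A = A} {B} (c , eq) h = comb c (proj₁ ∘ h) , λ x →
    trans (eq x) (trans (comb-cong {c = c} (λ _ → refl) (λ j → proj₂ (h j) x)) (sym (comb-assoc c (proj₁ ∘ h) B x)))

  -- The coefficient of the first row cannot vanish, for the rest would be a relation among
  -- independent rows; divide by it.
  Rel⇒InSpan : (A : Fin (suc n) → X → ℚ) → Rel A → Ind (A ∘ suc) → InSpan (A ∘ suc) (A zero)
  Rel⇒InSpan {n = n} {X = X} A (c , rel , j , cj≢0) ind = (λ i → - (y * c (suc i))) , span
    where
      c₀≢0 : c zero ≢ 0ℚ
      c₀≢0 eq = cj≢0 (all-zero j)
        where
          tail-zero : ∀ i → c (suc i) ≡ 0ℚ
          tail-zero = ind (c ∘ suc) (λ x → trans (sym (ℚₚ.+-identityˡ _))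
            (trans (cong (_+ comb (c ∘ suc) (A ∘ suc) x)
              (sym (trans (cong (_* A zero x) eq) (ℚₚ.*-zeroˡ (A zero x))))) (rel x)))
          all-zero : ∀ i → c i ≡ 0ℚ
          all-zero zero    = eq
          all-zero (suc i) = tail-zero i
      y = proj₁ (inverse c₀≢0)
      span : ∀ x → A zero x ≡ comb (λ i → - (y * c (suc i))) (A ∘ suc) x
      span x = begin
        a                                  ≡⟨ sym (ℚₚ.*-identityˡ a) ⟩
        1ℚ * a                             ≡⟨ cong (_* a) (sym (proj₂ (inverse c₀≢0))) ⟩
        y * c zero * a                     ≡⟨ solve 4 (λ y c a s → y :* c :* a := y :* (c :* a :+ s) :+
            (:- y) :* s) refl y (c zero) a s ⟩
        y * (c zero * a + s) + (- y) * s   ≡⟨ cong (λ z → y * z + (- y) * s) (rel x) ⟩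
        y * 0ℚ + (- y) * s                 ≡⟨ trans (cong (_+ (- y) * s) (ℚₚ.*-zeroʳ y)) (ℚₚ.+-identityˡ _) ⟩
        (- y) * s                          ≡⟨ sym (comb-scale (- y) (c ∘ suc) (A ∘ suc) x) ⟩
        comb (λ i → (- y) * c (suc i)) (A ∘ suc) x
          ≡⟨ comb-cong {v = λ i → A (suc i) x} (λ i → sym (ℚₚ.neg-distribˡ-* y (c (suc i)))) (λ _ → refl) ⟩
        comb (λ i → - (y * c (suc i))) (A ∘ suc) x ∎
        where
          a = A zero x
          s = comb (c ∘ suc) (A ∘ suc) x

  -- One step of fraction-free Gaussian elimination: the column `x₀` is cleared with the pivot
  -- `A zero x₀`.
  eliminate : (Fin (suc n) → X → ℚ) → X → Fin n → X → ℚ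
  eliminate A x₀ j x = A zero x₀ * A (suc j) x + (- A zero x) * A (suc j) x₀

  comb-eliminate : (c : Fin n → ℚ) (A : Fin (suc n) → X → ℚ) (x₀ x : X) →
    comb c (eliminate A x₀) x ≡ A zero x₀ * comb c (A ∘ suc) x + (- A zero x) * comb c (A ∘ suc) x₀
  comb-eliminate {n = n} c A x₀ x =
    comb-linear c (A ∘ suc) (λ j _ → A (suc j) x₀) (A zero x₀) (- A zero x) x

  -- Coefficients on the original rows that produce the combination `c` of the eliminated rows; the
  -- first one collects the multiples of the pivot row.
  uneliminate : (c : Fin n → ℚ) (A : Fin (suc n) → X → ℚ) (x₀ : X) → Fin (suc n) → ℚ
  uneliminate c A x₀ zero    = - comb c (A ∘ suc) x₀
  uneliminate c A x₀ (suc j) = A zero x₀ * c j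

  comb-uneliminate : (c : Fin n → ℚ) (A : Fin (suc n) → X → ℚ) (x₀ x : X) →
    comb (uneliminate c A x₀) A x ≡ comb c (eliminate A x₀) x
  comb-uneliminate c A x₀ x = begin
    (- s₀) * A zero x + comb (λ j → A zero x₀ * c j) (A ∘ suc) x
      ≡⟨ cong ((- s₀) * A zero x +_) (comb-scale (A zero x₀) c (A ∘ suc) x) ⟩
    (- s₀) * A zero x + A zero x₀ * s
      ≡⟨ solve 4 (λ s₀ a k s → (:- s₀) :* a :+ k :* s := k :* s :+ (:- a) :* s₀) refl s₀ (A zero x) (A zero x₀) s ⟩
    A zero x₀ * s + (- A zero x) * s₀ ≡⟨ sym (comb-eliminate c A x₀ x) ⟩
    comb c (eliminate A x₀) x ∎
    where
      s₀ = comb c (A ∘ suc) x₀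
      s = comb c (A ∘ suc) x

  Ind-eliminate : (A : Fin (suc n) → X → ℚ) (x₀ : X) → A zero x₀ ≢ 0ℚ → Ind A → Ind (eliminate A x₀)
  Ind-eliminate A x₀ k≢0 ind c rel j = x*y≡0⇒y≡0 k≢0
    (ind (uneliminate c A x₀) (λ x → trans (comb-uneliminate c A x₀ x) (rel x)) (suc j))

  Ind-uneliminate : (A : Fin (suc n) → X → ℚ) (x₀ : X) → A zero x₀ ≢ 0ℚ → Ind (eliminate A x₀) → Ind A
  Ind-uneliminate A x₀ k≢0 ind c rel = all-zero
    where
      s : _ → ℚ
      s = comb (c ∘ suc) (A ∘ suc)
      tail-zero : ∀ j → c (suc j) ≡ 0ℚ
      tail-zero = ind (c ∘ suc) λ x → begin
        comb (c ∘ suc) (eliminate A x₀) x            ≡⟨ comb-eliminate (c ∘ suc) A x₀ x ⟩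
        A zero x₀ * s x + (- A zero x) * s x₀
          ≡⟨ solve 5 (λ c k a s s₀ → k :* s :+ (:- a) :* s₀
                      := k :* (c :* a :+ s) :+ (:- a) :* (c :* k :+ s₀)) refl (c zero) (A zero x₀) (A zero x)
                          (s x) (s x₀) ⟩
        A zero x₀ * comb c A x + (- A zero x) * comb c A x₀
          ≡⟨ cong₂ (λ y z → A zero x₀ * y + (- A zero x) * z) (rel x) (rel x₀) ⟩
        A zero x₀ * 0ℚ + (- A zero x) * 0ℚ
          ≡⟨ cong₂ _+_ (ℚₚ.*-zeroʳ (A zero x₀)) (ℚₚ.*-zeroʳ (- A zero x)) ⟩
        0ℚ ∎
      all-zero : ∀ j → c j ≡ 0ℚ
      all-zero (suc j) = tail-zero j
      all-zero zero = x*y≡0⇒y≡0 k≢0 (begin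
        A zero x₀ * c zero            ≡⟨ ℚₚ.*-comm (A zero x₀) (c zero) ⟩
        c zero * A zero x₀            ≡⟨ sym (ℚₚ.+-identityʳ _) ⟩
        c zero * A zero x₀ + 0ℚ       ≡⟨ cong (c zero * A zero x₀ +_) (sym (comb-zero (c ∘ suc)
            (A ∘ suc) x₀ tail-zero)) ⟩
        comb c A x₀                   ≡⟨ rel x₀ ⟩
        0ℚ                            ∎)

  Rel-uneliminate : (A : Fin (suc n) → X → ℚ) (x₀ : X) → A zero x₀ ≢ 0ℚ → Rel (eliminate A x₀) → Rel A
  Rel-uneliminate A x₀ k≢0 (c , rel , j , cj≢0) =
    uneliminate c A x₀ , (λ x → trans (comb-uneliminate c A x₀ x) (rel x)) ,
    suc j , λ eq → cj≢0 (x*y≡0⇒y≡0 k≢0 eq)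

  Rel-zeroRow : (A : Fin (suc n) → X → ℚ) → (∀ x → A zero x ≡ 0ℚ) → Rel A
  Rel-zeroRow A eq = δ zero , (λ x → trans (comb-δ zero A x) (eq x)) , zero , λ ()

  Rel⇒¬Ind : {A : Fin n → X → ℚ} → Rel A → ¬ Ind A
  Rel⇒¬Ind (c , rel , j , cj≢0) ind = cj≢0 (ind c rel j)

  -- Rows of the rigidity matrix have infinitely many coordinates; a finite support makes the search
  -- for a pivot finite.
  SupportedIn : List X → (X → ℚ) → Set
  SupportedIn xs v = ∀ x → x ∉ xs → v x ≡ 0ℚ

  zero? : (xs : List X) (v : X → ℚ) → SupportedIn xs v → (∀ x → v x ≡ 0ℚ) ⊎ ∃[ x ] v x ≢ 0ℚ
  zero? {X = X} xs v supp with go xs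
    where
      go : (xs : List X) → All (λ x → v x ≡ 0ℚ) xs ⊎ ∃[ x ] v x ≢ 0ℚ
      go [] = inj₁ []
      go (x ∷ xs) with v x ℚₚ.≟ 0ℚ | go xs
      ... | no ≢0 | _        = inj₂ (x , ≢0)
      ... | yes _ | inj₂ r   = inj₂ r
      ... | yes e | inj₁ all = inj₁ (e ∷ all)
  ... | inj₂ r   = inj₂ r
  ... | inj₁ all = inj₁ vanishes
    where
      vanishes : ∀ x → v x ≡ 0ℚ
      vanishes x with v x ℚₚ.≟ 0ℚ
      ... | yes e = e
      -- No equality test on `X` is required: a nonzero value already shows that `x` lies outside
      -- `xs`.
      ... | no ≢0 = supp x (≢0 ∘ All.lookup all)

  -- Gaussian elimination: a zero row is itself a relation, and a nonzero entry is a pivot that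
  -- leaves one row fewer with the same support.
  Ind⊎Rel : (xs : List X) (A : Fin n → X → ℚ) → (∀ j → SupportedIn xs (A j)) → Ind A ⊎ Rel A
  Ind⊎Rel {n = zero}  xs A supp = inj₁ (λ c rel ())
  Ind⊎Rel {n = suc n} xs A supp with zero? xs (A zero) (supp zero)
  ... | inj₁ eq = inj₂ (Rel-zeroRow A eq)
  ... | inj₂ (x₀ , ≢0) with Ind⊎Rel xs (eliminate A x₀) supp′
    where
      supp′ : ∀ j → SupportedIn xs (eliminate A x₀ j)
      supp′ j x x∉xs = trans
        (cong₂ (λ y z → A zero x₀ * y + (- z) * A (suc j) x₀) (supp (suc j) x x∉xs) (supp zero x x∉xs))
        (cong₂ _+_ (ℚₚ.*-zeroʳ (A zero x₀)) (ℚₚ.*-zeroˡ (A (suc j) x₀)))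
  ...   | inj₁ ind = inj₁ (Ind-uneliminate A x₀ ≢0 ind)
  ...   | inj₂ rel = inj₂ (Rel-uneliminate A x₀ ≢0 rel)

  Ind⇒≤ : (A : Fin n → Fin m → ℚ) → Ind A → n ℕ.≤ m
  Ind⇒≤ {n = zero}  A ind = z≤n
  Ind⇒≤ {n = suc n} {m = m} A ind with Finₚ.any? (λ x → Relation.Nullary.¬? (A zero x ℚₚ.≟ 0ℚ))
  ... | no none = ⊥-elim (Rel⇒¬Ind {A = A} (Rel-zeroRow A zeroRow) ind)
    where
      zeroRow : ∀ x → A zero x ≡ 0ℚ
      zeroRow x with A zero x ℚₚ.≟ 0ℚ
      ... | yes e = e
      ... | no ≢0 = ⊥-elim (none (x , ≢0))
  Ind⇒≤ {n = suc n} {m = suc m} A ind | yes (x₀ , ≢0) =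
    -- After elimination the pivot column is identically zero, so deleting it loses no condition on
    -- the coefficients.
    s≤s (Ind⇒≤ (λ j y → eliminate A x₀ j (punchIn x₀ y)) restricted)
    where
      restricted : Ind (λ j y → eliminate A x₀ j (punchIn x₀ y))
      restricted c rel = Ind-eliminate A x₀ ≢0 ind c full
        where
          full : ∀ x → comb c (eliminate A x₀) x ≡ 0ℚ
          full x with x₀ Finₚ.≟ x
          ... | yes refl = trans (comb-eliminate c A x₀ x₀)
            (solve 2 (λ k s → k :* s :+ (:- k) :* s := con 0ℚ) refl (A zero x₀) (comb c (A ∘ suc) x₀))
          ... | no x₀≢x  = trans (cong (comb c (eliminate A x₀)) (sym (Finₚ.punchIn-punchOut x₀≢x)))
            (rel (punchOut x₀≢x))

  -- Steinitz: the rows of coefficients that express `A` in `B` are independent, since a relation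
  -- among them becomes a relation of `A`.
  Ind-InSpan⇒≤ : {A : Fin n → X → ℚ} {B : Fin m → X → ℚ} → Ind A → (∀ j → InSpan B (A j)) → n ℕ.≤ m
  Ind-InSpan⇒≤ {A = A} {B} ind span = Ind⇒≤ (proj₁ ∘ span) λ c rel → ind c λ x → begin
    comb c A x                        ≡⟨ comb-cong {c = c} (λ _ → refl) (λ j → proj₂ (span j) x) ⟩
    comb c (λ j → comb (proj₁ (span j)) B) x ≡⟨ sym (comb-assoc c (proj₁ ∘ span) B x) ⟩
    comb (comb c (proj₁ ∘ span)) B x  ≡⟨ comb-zero (comb c (proj₁ ∘ span)) B x rel ⟩
    0ℚ                                ∎

  -- If A has independent rows, then c (t A + B) = 0 makes c an eigenvector of the map c ↦ c B read in
  -- the row basis of A; eigenvectors for distinct eigenvalues are independent.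
  pencil-eigenvectors : {A B : Fin n → X → ℚ} → Ind A →
    (t : Fin m → ℚ) → Injective _≡_ _≡_ t → (C : Fin m → Fin n → ℚ) → (∀ r → ∃[ j ] C r j ≢ 0ℚ) →
    (∀ r x → t r * comb (C r) A x + comb (C r) B x ≡ 0ℚ) → Ind C
  pencil-eigenvectors {m = suc m} {A} {B} indA t inj C nz bad d rel = all-zero
    where
      -- Multiplied by `A`, this combination equals minus `comb d C` times `B`, hence zero;
      -- independence of `A` then cancels `A`.
      shifted : ∀ j → comb (λ r → d r * t r) C j ≡ 0ℚ
      shifted = indA _ λ x → begin
        comb (comb (λ r → d r * t r) C) A x    ≡⟨ comb-assoc (λ r → d r * t r) C A x ⟩
        ∑ (λ r → d r * t r * comb (C r) A x) ≡⟨ sum-cong-≗ (λ r → step x r) ⟩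
        ∑ (λ r → (- 1ℚ) * d r * comb (C r) B x)
          ≡⟨ comb-scale (- 1ℚ) d (λ r → comb (C r) B) x ⟩
        (- 1ℚ) * comb d (λ r → comb (C r) B) x ≡⟨ cong ((- 1ℚ) *_) (sym (comb-assoc d C B x)) ⟩
        (- 1ℚ) * comb (comb d C) B x           ≡⟨ cong ((- 1ℚ) *_) (comb-zero (comb d C) B x rel) ⟩
        (- 1ℚ) * 0ℚ                            ≡⟨ refl ⟩
        0ℚ                                     ∎
        where
          step : ∀ x r → d r * t r * comb (C r) A x ≡ (- 1ℚ) * d r * comb (C r) B x
          step x r = begin
            d r * t r * y           ≡⟨ solve 4 (λ d t y z → d :* t :* y := d :* (t :* y :+ z) :+
                (:- con 1ℚ) :* d :* z)
                                         refl (d r) (t r) y z ⟩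
            d r * (t r * y + z) + (- 1ℚ) * d r * z ≡⟨ cong (λ u → d r * u + (- 1ℚ) * d r * z) (bad r x) ⟩
            d r * 0ℚ + (- 1ℚ) * d r * z ≡⟨ trans (cong (_+ (- 1ℚ) * d r * z) (ℚₚ.*-zeroʳ (d r)))
                (ℚₚ.+-identityˡ _) ⟩
            (- 1ℚ) * d r * z        ∎
            where
              y = comb (C r) A x
              z = comb (C r) B x
      -- Subtracting `t zero` times the given relation from the shifted one removes the first
      -- eigenvector, so the induction hypothesis applies to the others.
      differences : ∀ j → comb (λ r → d (suc r) * (t (suc r) - t zero)) (C ∘ suc) j ≡ 0ℚ
      differences j = begin
        comb (λ r → d (suc r) * (t (suc r) - t zero)) (C ∘ suc) j
          ≡⟨ sym (ℚₚ.+-identityˡ _) ⟩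
        0ℚ + comb (λ r → d (suc r) * (t (suc r) - t zero)) (C ∘ suc) j
          ≡⟨ cong (_+ comb (λ r → d (suc r) * (t (suc r) - t zero)) (C ∘ suc) j)
               (solve 3 (λ d t c → con 0ℚ := d :* (t :- t) :* c) refl (d zero) (t zero) (C zero j)) ⟩
        ∑ (λ r → d r * (t r - t zero) * C r j)
          ≡⟨ sum-cong-≗ (λ r → solve 4 (λ d t t₀ c → d :* (t :- t₀) :* c := c :* (con 1ℚ :* (d :* t) :+
              (:- t₀) :* d))
               refl (d r) (t r) (t zero) (C r j)) ⟩
        comb {X = Fin 1} (λ r → C r j) (λ r _ → 1ℚ * (d r * t r) + (- t zero) * d r) zero
          ≡⟨ comb-linear {X = Fin 1} (λ r → C r j) (λ r _ → d r * t r) (λ r _ → d r) 1ℚ (- t zero) zero ⟩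
        1ℚ * ∑ (λ r → C r j * (d r * t r)) + (- t zero) * ∑ (λ r → C r j * d r)
          ≡⟨ cong₂ (λ y z → 1ℚ * y + (- t zero) * z)
               (trans (sum-cong-≗ (λ r → ℚₚ.*-comm (C r j) (d r * t r))) (shifted j))
               (trans (sum-cong-≗ (λ r → ℚₚ.*-comm (C r j) (d r))) (rel j)) ⟩
        1ℚ * 0ℚ + (- t zero) * 0ℚ ≡⟨ trans (ℚₚ.+-identityˡ _) (ℚₚ.*-zeroʳ (- t zero)) ⟩
        0ℚ ∎
      tail-zero : ∀ r → d (suc r) ≡ 0ℚ
      tail-zero r = x*y≡0⇒y≡0 (λ eq → distinct (inj (x-y≡0⇒x≡y eq))) (trans (ℚₚ.*-comm _ (d (suc r)))
        (pencil-eigenvectors {A = A} {B} indA (t ∘ suc) (Finₚ.suc-injective ∘ inj) (C ∘ suc) (nz ∘ suc) (bad ∘ suc)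
          (λ r → d (suc r) * (t (suc r) - t zero)) differences r))
        where
          distinct : suc r ≢ zero
          distinct ()
      all-zero : ∀ r → d r ≡ 0ℚ
      all-zero (suc r) = tail-zero r
      all-zero zero with nz zero
      ... | j , ≢0 = x*y≡0⇒y≡0 ≢0 (begin
        C zero j * d zero      ≡⟨ ℚₚ.*-comm (C zero j) (d zero) ⟩
        d zero * C zero j      ≡⟨ sym (ℚₚ.+-identityʳ _) ⟩
        d zero * C zero j + 0ℚ ≡⟨ cong (d zero * C zero j +_) (sym (comb-zero (d ∘ suc) (C ∘ suc) j tail-zero)) ⟩
        comb d C j             ≡⟨ rel j ⟩
        0ℚ                     ∎)

  -- Placements in general position

  AllPairs-lookup : {A : Set} {R : A → A → Set} → (∀ {x y} → R x y → R y x) → {xs : List A} →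
    AllPairs (λ x y → ¬ R x y) xs → ∀ i j → R (lookup xs i) (lookup xs j) → i ≡ j
  AllPairs-lookup sym-R (h ∷ hs) zero    zero    r = refl
  AllPairs-lookup sym-R (h ∷ hs) zero    (suc j) r = ⊥-elim (All.lookup h (∈-lookup j) r)
  AllPairs-lookup sym-R (h ∷ hs) (suc i) zero    r = ⊥-elim (All.lookup h (∈-lookup i) (sym-R r))
  AllPairs-lookup sym-R (h ∷ hs) (suc i) (suc j) r = cong suc (AllPairs-lookup sym-R hs i j r)

  Unique-lookup : {A : Set} {xs : List A} → Unique xs → Injective _≡_ _≡_ (lookup xs)
  Unique-lookup u {i} {j} = AllPairs-lookup sym u i j

  length-filter-∁ : {A : Set} {P : A → Set} (P? : Decidable P) (xs : List A) →
    length xs ≡ length (filter P? xs) ℕ.+ length (filter (¬? ∘ P?) xs)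
  length-filter-∁ P? [] = refl
  length-filter-∁ P? (x ∷ xs) with P? x
  ... | yes _ = cong suc (length-filter-∁ P? xs)
  ... | no  _ = trans (cong suc (length-filter-∁ P? xs)) (sym (ℕₚ.+-suc (length (filter P? xs)) _))

  -- Built directly in lowest terms, so that distinctness can be read off the numerators.
  natural : ℕ → ℚ
  natural k = ℚ.mkℚ (ℤ.+ k) 0 (Coprimality.sym (Coprimality.1-coprimeTo k))

  naturals : ℕ → List ℚ
  naturals k = map natural (upTo k)

  naturals-unique : ∀ k → Unique (naturals k)
  naturals-unique k = Uniqueₚ.map⁺ (λ eq → ℤₚ.+-injective (cong ℚ.ℚ.numerator eq)) (Uniqueₚ.upTo⁺ k)

  naturals-length : ∀ k → length (naturals k) ≡ k
  naturals-length k = trans (Listₚ.length-map natural (upTo k)) (Listₚ.length-upTo k)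

  line : Placement → Placement → ℚ → Placement
  line p q t v i = (1ℚ - t) * p v i + t * q v i

  -- Besides rows of the rigidity matrix this covers the edge vectors at a vertex, whose general
  -- position is what a 0-extension needs.
  record Family : Set₁ where
    field
      size      : ℕ
      Coord     : Set
      vectors   : Placement → Fin size → Coord → ℚ
      coords    : List Coord
      supported : ∀ p j → SupportedIn coords (vectors p j)
      affine    : ∀ p q t j x → vectors (line p q t) j x ≡ (1ℚ - t) * vectors p j x + t * vectors q j x
      vectors-cong : ∀ {p q} → (∀ v i → p v i ≡ q v i) → ∀ j x → vectors p j x ≡ vectors q j x

    Good : Placement → Set
    Good p = Ind (vectors p)

    good⊎bad : ∀ p → Good p ⊎ Rel (vectors p)
    good⊎bad p = Ind⊎Rel coords (vectors p) (supported p)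

    good? : Decidable Good
    good? p with good⊎bad p
    ... | inj₁ good = yes good
    ... | inj₂ rel  = no (Rel⇒¬Ind {A = vectors p} rel)

    ¬Good⇒Rel : ∀ {p} → ¬ Good p → Rel (vectors p)
    ¬Good⇒Rel {p} ¬good with good⊎bad p
    ... | inj₁ good = ⊥-elim (¬good good)
    ... | inj₂ rel  = rel

    Good-resp : ∀ {p q} → (∀ v i → p v i ≡ q v i) → Good p → Good q
    Good-resp eq = Ind-injection (λ j → j) (λ e → e) (λ j x → sym (vectors-cong eq j x))

    -- Around the good parameter `t₀` the vectors are `A + (t - t₀) B` with `A` independent. A
    -- relation at a bad `t` is an eigenvector with eigenvalue determined by `1 / (t - t₀)`.
    -- Distinct bad parameters thus give independent eigenvectors in a space of dimension `size`.
    -- This replaces the count of roots of a determinant.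
    bad-parameters-≤ : ∀ p q t₀ → Good (line p q t₀) → (ts : List ℚ) → Unique ts →
      All (λ t → ¬ Good (line p q t)) ts → length ts ≤ size
    bad-parameters-≤ p q t₀ good ts unique bad = Ind⇒≤ C (pencil-eigenvectors good μ μ-injective C nonzero pencil)
      where
        t : Fin (length ts) → ℚ
        t = lookup ts
        rel : ∀ r → Rel (vectors (line p q (t r)))
        rel r = ¬Good⇒Rel (All.lookup bad (∈-lookup r))
        C : Fin (length ts) → Fin size → ℚ
        C r = proj₁ (rel r)
        nonzero : ∀ r → ∃[ j ] C r j ≢ 0ℚ
        nonzero r = proj₂ (proj₂ (rel r))
        t≢t₀ : ∀ r → t r - t₀ ≢ 0ℚ
        t≢t₀ r eq = All.lookup bad (∈-lookup r) (subst (λ s → Good (line p q s)) (sym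
            (x-y≡0⇒x≡y {t r} {t₀} eq)) good)
        μ : Fin (length ts) → ℚ
        μ r = proj₁ (inverse (t≢t₀ r))
        μ-inverse : ∀ r → μ r * (t r - t₀) ≡ 1ℚ
        μ-inverse r = proj₂ (inverse (t≢t₀ r))
        μ-injective : Injective _≡_ _≡_ μ
        μ-injective {r} {s} eq = Unique-lookup unique (begin
          t r                       ≡⟨ sym (ℚₚ.*-identityʳ (t r)) ⟩
          t r * 1ℚ                  ≡⟨ cong (t r *_) (sym (μ-inverse s)) ⟩
          t r * (μ s * (t s - t₀))  ≡⟨ solve 4 (λ t s t₀ m → t :* (m :* (s :- t₀)) := m :* (t :- t₀) :*
              (s :- t₀) :+ t₀ :* (m :* (s :- t₀)))
                                         refl (t r) (t s) t₀ (μ s) ⟩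
          μ s * (t r - t₀) * (t s - t₀) + t₀ * (μ s * (t s - t₀))
            ≡⟨ cong₂ (λ y z → y * (t s - t₀) + t₀ * z) (trans (cong (_* (t r - t₀)) (sym eq)) (μ-inverse r))
                (μ-inverse s) ⟩
          1ℚ * (t s - t₀) + t₀ * 1ℚ ≡⟨ solve 2 (λ s t₀ → con 1ℚ :* (s :- t₀) :+ t₀ :* con 1ℚ := s) refl (t s) t₀ ⟩
          t s                       ∎)
        A B : Fin size → Coord → ℚ
        A = vectors (line p q t₀)
        -- The direction `q - p` of the pencil, in the shape that `comb-linear` expects.
        B j x = (- 1ℚ) * vectors p j x + 1ℚ * vectors q j x
        pencil : ∀ r x → μ r * comb (C r) A x + comb (C r) B x ≡ 0ℚ
        pencil r x = begin
          μ r * comb (C r) A x + comb (C r) B x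
            ≡⟨ cong (λ z → μ r * comb (C r) A x + z) (trans (sym (ℚₚ.*-identityˡ _)) (cong (_* comb (C r) B x)
                (sym (μ-inverse r)))) ⟩
          μ r * comb (C r) A x + μ r * (t r - t₀) * comb (C r) B x
            ≡⟨ solve 4 (λ m a s b → m :* a :+ m :* s :* b := m :* (con 1ℚ :* a :+ s :* b)) refl (μ r) (comb
                (C r) A x) (t r - t₀) (comb (C r) B x) ⟩
          μ r * (1ℚ * comb (C r) A x + (t r - t₀) * comb (C r) B x)
            ≡⟨ cong (μ r *_) (sym (comb-linear (C r) A B 1ℚ (t r - t₀) x)) ⟩
          μ r * comb (C r) (λ j x → 1ℚ * A j x + (t r - t₀) * B j x) x
            ≡⟨ cong (μ r *_) (comb-cong {c = C r} (λ _ → refl) (λ j → on-line j)) ⟩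
          μ r * comb (C r) (vectors (line p q (t r))) x
            ≡⟨ cong (μ r *_) (proj₁ (proj₂ (rel r)) x) ⟩
          μ r * 0ℚ ≡⟨ ℚₚ.*-zeroʳ (μ r) ⟩
          0ℚ ∎
          where
            on-line : ∀ j → 1ℚ * A j x + (t r - t₀) * B j x ≡ vectors (line p q (t r)) j x
            on-line j = begin
              1ℚ * A j x + (t r - t₀) * B j x
                ≡⟨ cong (λ z → 1ℚ * z + (t r - t₀) * B j x) (affine p q t₀ j x) ⟩
              1ℚ * ((1ℚ - t₀) * vectors p j x + t₀ * vectors q j x) + (t r - t₀) * B j x
                ≡⟨ solve 4 (λ s t₀ y z → con 1ℚ :* ((con 1ℚ :- t₀) :* y :+ t₀ :* z) :+ (s :- t₀) :*
                    ((:- con 1ℚ) :* y :+ con 1ℚ :* z)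
                            := (con 1ℚ :- s) :* y :+ s :* z) refl (t r) t₀ (vectors p j x) (vectors q j x) ⟩
              (1ℚ - t r) * vectors p j x + t r * vectors q j x ≡⟨ sym (affine p q (t r) j x) ⟩
              vectors (line p q (t r)) j x ∎

  module _ where

    open Family

    good-parameters : ∀ F p q t₀ → Good F (line p q t₀) → (ts : List ℚ) → Unique ts →
      length ts ≤ size F ℕ.+ length (filter (good? F ∘ line p q) ts)
    good-parameters F p q t₀ good ts unique = ℕₚ.≤-trans (ℕₚ.≤-reflexive (length-filter-∁ (good? F ∘ line p q) ts))
      (ℕₚ.≤-trans (ℕₚ.≤-reflexive (ℕₚ.+-comm (length (filter (good? F ∘ line p q) ts)) _))
        (ℕₚ.+-monoˡ-≤ _ (bad-parameters-≤ F p q t₀ good _ (Uniqueₚ.filter⁺ (¬? ∘ good? F ∘ line p q) unique)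
          (Allₚ.all-filter (¬? ∘ good? F ∘ line p q) ts))))

    totalSize : List Family → ℕ
    totalSize []       = 0
    totalSize (F ∷ Fs) = size F ℕ.+ totalSize Fs

    -- Each family spoils at most `size` of the candidates, whatever its own good parameter is, so a
    -- list longer than the total size retains a common one.
    common-good-parameter : ∀ p q (Fs : List Family) → All (λ F → ∃[ t₀ ] Good F (line p q t₀)) Fs →
      (ts : List ℚ) → Unique ts → totalSize Fs < length ts → ∃[ t ] (t ∈ ts) × All (λ F → Good F (line p q t)) Fs
    common-good-parameter p q [] [] (t ∷ ts) unique _ = t , here refl , []
    common-good-parameter p q (F ∷ Fs) ((t₀ , good) ∷ goods) ts unique lt = t , proj₁ t∈ , proj₂ t∈ ∷ proj₂
        (proj₂ rest)
      where
        F-good? : Decidable (λ t → Good F (line p q t))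
        F-good? t = good? F (line p q t)
        rest : ∃[ t ] (t ∈ filter F-good? ts) × All (λ G → Good G (line p q t)) Fs
        rest = common-good-parameter p q Fs goods (filter F-good? ts) (Uniqueₚ.filter⁺ F-good? unique)
          (ℕₚ.+-cancelˡ-< (size F) _ _ (ℕₚ.<-≤-trans lt (good-parameters F p q t₀ good ts unique)))
        t : ℚ
        t = proj₁ rest
        t∈ : (t ∈ ts) × Good F (line p q t)
        t∈ = ∈-filter⁻ F-good? {xs = ts} (proj₁ (proj₂ rest))

    abstract
      -- Induction along a line: `t = 0` is good for the first family and `t = 1` for all the
      -- others, so some parameter is good for all of them.
      common-good-placement : (Fs : List Family) → All (λ F → ∃[ p ] Good F p) Fs → ∃[ p ] All (λ F → Good F p) Fs
      common-good-placement [] [] = (λ _ _ → 0ℚ) , []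
      common-good-placement (F ∷ Fs) ((p , good) ∷ goods) = merge (common-good-placement Fs goods)
        where
          merge : ∃[ q ] All (λ G → Good G q) Fs → ∃[ q ] All (λ G → Good G q) (F ∷ Fs)
          merge (q , all) = line p q (proj₁ common) , proj₂ (proj₂ common)
            where
              at-0 : ∀ v i → p v i ≡ line p q 0ℚ v i
              at-0 v i = solve 2 (λ y z → y := (con 1ℚ :- con 0ℚ) :* y :+ con 0ℚ :* z) refl (p v i) (q v i)
              at-1 : ∀ v i → q v i ≡ line p q 1ℚ v i
              at-1 v i = solve 2 (λ y z → z := (con 1ℚ :- con 1ℚ) :* y :+ con 1ℚ :* z) refl (p v i) (q v i)
              goodSomewhere : All (λ G → ∃[ t₀ ] Good G (line p q t₀)) (F ∷ Fs)
              goodSomewhere = (0ℚ , Good-resp F {p} at-0 good) ∷ All.map (λ {G} g → 1ℚ , Good-resp G {q} at-1 g) all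
              k : ℕ
              -- One candidate more than all the families together can spoil.
              k = suc (totalSize (F ∷ Fs))
              common : ∃[ t ] (t ∈ naturals k) × All (λ G → Good G (line p q t)) (F ∷ Fs)
              common = common-good-parameter p q (F ∷ Fs) goodSomewhere (naturals k) (naturals-unique k)
                         (ℕₚ.≤-reflexive (sym (naturals-length k)))

  -- The rigidity matroid

  Coordinate : Set
  Coordinate = Vtx × Fin 3

  _≟ᶜ_ : (x y : Coordinate) → Dec (x ≡ y)
  _≟ᶜ_ = ≡-dec ℕ._≟_ Finₚ._≟_

  row : Placement → Pair → Coordinate → ℚ
  row p e (w , i) = rowEntry p e w i

  rows : Placement → (L : List Pair) → Fin (length L) → Coordinate → ℚ
  rows p L j = row p (lookup L j)

  row-endpoint₁ : ∀ p u v i → row p (u , v) (u , i) ≡ p u i - p v i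
  row-endpoint₁ p u v i with u ℕ.≟ u
  ... | yes _ = refl
  ... | no u≢u = contradiction refl u≢u

  row-endpoint₂ : ∀ p u v i → row p (u , v) (v , i) ≡ p v i - p u i
  row-endpoint₂ p u v i with v ℕ.≟ u | v ℕ.≟ v
  ... | yes refl | _      = refl
  ... | no _     | yes _  = refl
  ... | no _     | no v≢v = contradiction refl v≢v

  row-off : ∀ p u v w i → w ≢ u → w ≢ v → row p (u , v) (w , i) ≡ 0ℚ
  row-off p u v w i w≢u w≢v with w ℕ.≟ u | w ℕ.≟ v
  ... | yes eq | _      = contradiction eq w≢u
  ... | no _   | yes eq = contradiction eq w≢v
  ... | no _   | no _   = refl

  row-cases : ∀ {P : Pair → Coordinate → Set} →
    (∀ u v i → P (u , v) (u , i)) → (∀ u v i → P (u , v) (v , i)) →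
    (∀ u v w i → w ≢ u → w ≢ v → P (u , v) (w , i)) → ∀ e x → P e x
  row-cases at-u at-v off (u , v) (w , i) with w ℕ.≟ u | w ℕ.≟ v
  ... | yes refl | _        = at-u u v i
  ... | no _     | yes refl = at-v u v i
  ... | no w≢u   | no w≢v   = off u v w i w≢u w≢v

  SamePair-sym : ∀ {e f} → SamePair e f → SamePair f e
  SamePair-sym (inj₁ (refl , refl)) = inj₁ (refl , refl)
  SamePair-sym (inj₂ (refl , refl)) = inj₂ (refl , refl)

  SamePair-trans : ∀ {e f g} → SamePair e f → SamePair f g → SamePair e g
  SamePair-trans (inj₁ (refl , refl)) s = s
  SamePair-trans (inj₂ (refl , refl)) (inj₁ (refl , refl)) = inj₂ (refl , refl)
  SamePair-trans (inj₂ (refl , refl)) (inj₂ (refl , refl)) = inj₁ (refl , refl)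

  row-swap : ∀ p u v x → row p (u , v) x ≡ row p (v , u) x
  row-swap p u v = row-cases {λ { (u , v) x → row p (u , v) x ≡ row p (v , u) x }}
    (λ u v i → trans (row-endpoint₁ p u v i) (sym (row-endpoint₂ p v u i)))
    (λ u v i → trans (row-endpoint₂ p u v i) (sym (row-endpoint₁ p v u i)))
    (λ u v w i w≢u w≢v → trans (row-off p u v w i w≢u w≢v) (sym (row-off p v u w i w≢v w≢u)))
    (u , v)

  row-SamePair : ∀ p {e f} → SamePair e f → ∀ x → row p e x ≡ row p f x
  row-SamePair p (inj₁ (refl , refl)) x = refl
  row-SamePair p {u , v} (inj₂ (refl , refl)) x = row-swap p u v x

  row-cong : ∀ {p q} u v → (∀ i → p u i ≡ q u i) → (∀ i → p v i ≡ q v i) → ∀ x → row p (u , v) x ≡ row q (u , v) x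
  row-cong {p} {q} u v eq₁ eq₂ x = row-cases
    {λ { (u , v) x → (∀ i → p u i ≡ q u i) → (∀ i → p v i ≡ q v i) → row p (u , v) x ≡ row q (u , v) x }}
    (λ u v i eq₁ eq₂ → trans (row-endpoint₁ p u v i) (trans (cong₂ _-_ (eq₁ i) (eq₂ i)) (sym
        (row-endpoint₁ q u v i))))
    (λ u v i eq₁ eq₂ → trans (row-endpoint₂ p u v i) (trans (cong₂ _-_ (eq₂ i) (eq₁ i)) (sym
        (row-endpoint₂ q u v i))))
    (λ u v w i w≢u w≢v _ _ → trans (row-off p u v w i w≢u w≢v) (sym (row-off q u v w i w≢u w≢v)))
    (u , v) x eq₁ eq₂

  row-line : ∀ p q t e x → row (line p q t) e x ≡ (1ℚ - t) * row p e x + t * row q e x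
  row-line p q t = row-cases
    (λ u v i → trans (row-endpoint₁ _ u v i) (trans (affine (p u i) (p v i) (q u i) (q v i))
      (sym (cong₂ combine (row-endpoint₁ p u v i) (row-endpoint₁ q u v i)))))
    (λ u v i → trans (row-endpoint₂ _ u v i) (trans (affine (p v i) (p u i) (q v i) (q u i))
      (sym (cong₂ combine (row-endpoint₂ p u v i) (row-endpoint₂ q u v i)))))
    (λ u v w i w≢u w≢v → trans (row-off _ u v w i w≢u w≢v) (trans
      (solve 1 (λ t → con 0ℚ := (con 1ℚ :- t) :* con 0ℚ :+ t :* con 0ℚ) refl t)
      (sym (cong₂ combine (row-off p u v w i w≢u w≢v) (row-off q u v w i w≢u w≢v)))))
    where
      combine : ℚ → ℚ → ℚ
      combine y z = (1ℚ - t) * y + t * z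
      affine : ∀ a b c d → combine a c - combine b d ≡ combine (a - b) (c - d)
      affine a b c d = solve 5 (λ t a b c d →
        ((con 1ℚ :- t) :* a :+ t :* c) :- ((con 1ℚ :- t) :* b :+ t :* d)
          := (con 1ℚ :- t) :* (a :- b) :+ t :* (c :- d)) refl t a b c d

  endpoints : List Pair → List Vtx
  endpoints = concatMap (λ e → proj₁ e ∷ proj₂ e ∷ [])

  ∈-endpoints₁ : ∀ {e L} → e ∈ L → proj₁ e ∈ endpoints L
  ∈-endpoints₁ e∈ = ∈-concatMap⁺ _ (Any.map (λ { refl → here refl }) e∈)

  ∈-endpoints₂ : ∀ {e L} → e ∈ L → proj₂ e ∈ endpoints L
  ∈-endpoints₂ e∈ = ∈-concatMap⁺ _ (Any.map (λ { refl → there (here refl) }) e∈)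

  coordinates : List Pair → List Coordinate
  coordinates L = cartesianProduct (endpoints L) (allFin 3)

  ∈-coordinates : ∀ {w L} i → w ∈ endpoints L → (w , i) ∈ coordinates L
  ∈-coordinates i w∈ = ∈-cartesianProduct⁺ w∈ (∈-allFin i)

  rows-supported : ∀ p L j → SupportedIn (coordinates L) (rows p L j)
  rows-supported p L j (w , i) x∉ = row-off p _ _ w i
    (λ { refl → x∉ (∈-coordinates {L = L} i (∈-endpoints₁ (∈-lookup {xs = L} j))) })
    (λ { refl → x∉ (∈-coordinates {L = L} i (∈-endpoints₂ (∈-lookup {xs = L} j))) })

  -- `ρ` pulls a placement back to the vertices of `L`. This makes families on different vertex sets
  -- conditions on the same `p`.
  rowsFamily : (Vtx → Vtx) → List Pair → Family
  rowsFamily ρ L = record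
    { size      = length L
    ; Coord     = Coordinate
    ; vectors   = λ p → rows (p ∘ ρ) L
    ; coords    = coordinates L
    ; supported = λ p → rows-supported (p ∘ ρ) L
    ; affine    = λ p q t j x → row-line (p ∘ ρ) (q ∘ ρ) t (lookup L j) x
    ; vectors-cong = λ eq j x → row-cong _ _ (λ i → eq (ρ (proj₁ (lookup L j))) i) (λ i → eq (ρ (proj₂
        (lookup L j))) i) x
    }

  linComb-tabulate : ∀ p L (c : Fin (length L) → ℚ) w i →
    linComb p (zipL (tabulate c) L) w i ≡ comb c (rows p L) (w , i)
  linComb-tabulate p []      c w i = refl
  linComb-tabulate p (e ∷ L) c w i = cong (c zero * rowEntry p e w i +_) (linComb-tabulate p L (c ∘ suc) w i)

  asTabulate : (cs : List ℚ) → length cs ≡ n → ∃[ c ] cs ≡ tabulate {n = n} c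
  asTabulate cs refl = lookup cs , sym (Listₚ.tabulate-lookup cs)

  RowsIndependent⇒Ind : ∀ p L → RowsIndependent p L → Ind (rows p L)
  RowsIndependent⇒Ind p L ind c rel = Allₚ.tabulate⁻ (ind (tabulate c) (Listₚ.length-tabulate c)
    (λ w i → trans (linComb-tabulate p L c w i) (rel (w , i))))

  Ind⇒RowsIndependent : ∀ p L → Ind (rows p L) → RowsIndependent p L
  Ind⇒RowsIndependent p L ind cs len rel = go (asTabulate cs len)
    where
      go : ∃[ c ] cs ≡ tabulate {n = length L} c → All (_≡ 0ℚ) cs
      go (c , eq) = subst (All (_≡ 0ℚ)) (sym eq) (Allₚ.tabulate⁺ (ind c (λ { (w , i) →
        trans (sym (linComb-tabulate p L c w i)) (subst (λ cs → linComb p (zipL cs L) w i ≡ 0ℚ) eq (rel w i)) })))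

  -- Equal rows at distinct positions satisfy the relation `δ i - δ j`, which is assembled as
  -- `comb d C` so that `comb-assoc` evaluates it.
  Ind-distinct : {A : Fin n → X → ℚ} → Ind A → ∀ i j → (∀ x → A i x ≡ A j x) → i ≡ j
  Ind-distinct {n = n} {A = A} ind i j eq with i Finₚ.≟ j
  ... | yes i≡j = i≡j
  ... | no i≢j  = contradiction (trans (sym coefficient) (ind c vanishes i)) ℚₚ.1≢0
    where
      C : Fin 2 → Fin n → ℚ
      C zero       = δ i
      C (suc zero) = δ j
      d : Fin 2 → ℚ
      d zero       = 1ℚ
      d (suc zero) = - 1ℚ
      c : Fin n → ℚ
      c = comb d C
      vanishes : ∀ x → comb c A x ≡ 0ℚ
      vanishes x = begin
        comb (comb d C) A x                ≡⟨ comb-assoc d C A x ⟩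
        1ℚ * comb (δ i) A x + ((- 1ℚ) * comb (δ j) A x + 0ℚ)
          ≡⟨ cong₂ (λ y z → 1ℚ * y + ((- 1ℚ) * z + 0ℚ)) (trans (comb-δ i A x) (eq x)) (comb-δ j A x) ⟩
        1ℚ * A j x + ((- 1ℚ) * A j x + 0ℚ) ≡⟨ solve 1 (λ y → con 1ℚ :* y :+
            ((:- con 1ℚ) :* y :+ con 0ℚ) := con 0ℚ) refl (A j x) ⟩
        0ℚ                                 ∎
      coefficient : c i ≡ 1ℚ
      coefficient = trans (cong₂ (λ y z → 1ℚ * y + ((- 1ℚ) * z + 0ℚ)) (δ-refl i) (δ-≢ (i≢j ∘ sym)))
        (solve 1 (λ y → con 1ℚ :* y :+ ((:- con 1ℚ) :* con 0ℚ :+ con 0ℚ) := y) refl 1ℚ)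

  AllPairs-tabulate : {A : Set} {R : A → A → Set} (xs : List A) →
    (∀ i j → R (lookup xs i) (lookup xs j) → i ≡ j) → AllPairs (λ x y → ¬ R x y) xs
  AllPairs-tabulate []       h = []
  AllPairs-tabulate {R = R} (x ∷ xs) h = All.tabulate (λ y∈ r → head≢tail y∈ r) ∷ AllPairs-tabulate xs
      (λ i j r → Finₚ.suc-injective (h (suc i) (suc j) r))
    where
      head≢tail : ∀ {y} → y ∈ xs → R x y → ⊥
      head≢tail y∈ r with h zero (suc (Any.index y∈)) (subst (R x) (Anyₚ.lookup-index y∈) r)
      ... | ()

  Ind⇒UniquePairs : ∀ p L → Ind (rows p L) → UniquePairs L
  Ind⇒UniquePairs p L ind = AllPairs-tabulate L (λ i j same → Ind-distinct {A = rows p L} ind i j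
      (row-SamePair p same))

  -- Lists stand for sets of pairs. That an independent list repeats no pair, in either order, is
  -- what turns an inclusion of bases into an inequality of lengths.
  Indep⇒UniquePairs : ∀ {L} → Indep L → UniquePairs L
  Indep⇒UniquePairs {L} (p , ind) = Ind⇒UniquePairs p L (RowsIndependent⇒Ind p L ind)

  ∈ᵖ-lookup : ∀ {e L} → e ∈ᵖ L → ∃[ j ] SamePair e (lookup L j)
  ∈ᵖ-lookup {e} {L} (inj₁ e∈) = Any.index e∈ , subst (SamePair e) (Anyₚ.lookup-index e∈) (inj₁ (refl , refl))
  ∈ᵖ-lookup {e} {L} (inj₂ e∈) = Any.index e∈ , subst (SamePair e) (Anyₚ.lookup-index e∈) (inj₂ (refl , refl))

  module _ {M L : List Pair} (unique : UniquePairs M) (sub : ∀ {e} → e ∈ M → e ∈ᵖ L) where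

    position : Fin (length M) → Fin (length L)
    position j = proj₁ (∈ᵖ-lookup {L = L} (sub (∈-lookup {xs = M} j)))

    position-same : ∀ j → SamePair (lookup M j) (lookup L (position j))
    position-same j = proj₂ (∈ᵖ-lookup {L = L} (sub (∈-lookup {xs = M} j)))

    position-injective : Injective _≡_ _≡_ position
    position-injective {i} {j} eq = AllPairs-lookup SamePair-sym unique i j
      (SamePair-trans (position-same i) (subst (λ k → SamePair (lookup L k) (lookup M j)) (sym eq)
          (SamePair-sym (position-same j))))

    UniquePairs-length-≤ : length M ≤ length L
    UniquePairs-length-≤ = Finₚ.injective⇒≤ position-injective

    Ind-⊆ᵖ : ∀ p → Ind (rows p L) → Ind (rows p M)
    Ind-⊆ᵖ p = Ind-injection position position-injective (λ j → row-SamePair p (position-same j))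

    Indep-⊆ᵖ : Indep L → Indep M
    Indep-⊆ᵖ (p , ind) = p , Ind⇒RowsIndependent p M (Ind-⊆ᵖ p (RowsIndependent⇒Ind p L ind))

  UniquePairs-∷⁻ : ∀ {e f L} → UniquePairs (e ∷ f ∷ L) → UniquePairs (e ∷ L)
  UniquePairs-∷⁻ ((_ ∷ e≁) ∷ (_ ∷ u)) = e≁ ∷ u

  Indep-∷⁻ : ∀ {e f L} → Indep (e ∷ f ∷ L) → Indep (e ∷ L)
  Indep-∷⁻ {e} {f} {L} indep = Indep-⊆ᵖ {e ∷ L} {e ∷ f ∷ L} (UniquePairs-∷⁻
      (Indep⇒UniquePairs {e ∷ f ∷ L} indep)) sub indep
    where
      sub : ∀ {g} → g ∈ e ∷ L → g ∈ᵖ (e ∷ f ∷ L)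
      sub (here refl) = inj₁ (here refl)
      sub (there g∈)  = inj₁ (there (there g∈))

  _[_≔_] : Placement → Coordinate → ℚ → Placement
  (p [ x ≔ t ]) v i with (v , i) ≟ᶜ x
  ... | yes _ = t
  ... | no _  = p v i

  [≔]-off : ∀ p x v i t → (v , i) ≢ x → (p [ x ≔ t ]) v i ≡ p v i
  [≔]-off p x v i t ≢ with (v , i) ≟ᶜ x
  ... | yes eq = contradiction eq ≢
  ... | no _   = refl

  [≔]-line : ∀ p x t v i → (p [ x ≔ t ]) v i ≡ line (p [ x ≔ 0ℚ ]) (p [ x ≔ 1ℚ ]) t v i
  [≔]-line p x t v i with (v , i) ≟ᶜ x
  ... | yes _ = solve 1 (λ t → t := (con 1ℚ :- t) :* con 0ℚ :+ t :* con 1ℚ) refl t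
  ... | no _  = solve 2 (λ t y → y := (con 1ℚ :- t) :* y :+ t :* y) refl t (p v i)

  [≔]-unchanged : ∀ p x v i → p v i ≡ (p [ x ≔ p (proj₁ x) (proj₂ x) ]) v i
  [≔]-unchanged p x v i with (v , i) ≟ᶜ x
  ... | yes refl = refl
  ... | no _     = refl

  [≔]-agree : ∀ {xs} q p x t → (∀ v i → (v , i) ∉ x ∷ xs → q v i ≡ p v i) →
    ∀ v i → (v , i) ∉ xs → (q [ x ≔ t ]) v i ≡ (p [ x ≔ t ]) v i
  [≔]-agree q p x t eq v i x∉ with (v , i) ≟ᶜ x
  ... | yes _     = refl
  ... | no v,i≢x  = eq v i λ { (here v,i≡x) → v,i≢x v,i≡x ; (there x∈) → x∉ x∈ }

  -- Independence at some placement is decided on a finite grid: along each coordinate axis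
  -- at most length L parameters are bad.
  module _ (L : List Pair) where

    private
      F : Family
      F = rowsFamily (λ v → v) L
      open Family F

      T : List ℚ
      T = naturals (suc (length L))

    -- The coordinates in `xs` are still free; the search fixes them one at a time.
    GoodOff : List Coordinate → Placement → Set
    GoodOff xs p = ∃[ q ] (∀ v i → (v , i) ∉ xs → q v i ≡ p v i) × Good q

    GoodOff-[≔] : ∀ x xs p t → GoodOff xs (p [ x ≔ t ]) → GoodOff (x ∷ xs) p
    GoodOff-[≔] x xs p t (q , eq , good) = q , (λ v i x∉ → trans (eq v i (x∉ ∘ there))
      ([≔]-off p x v i t (λ { refl → x∉ (here refl) }))) , good

    -- Changing the single coordinate `x` of a good `q` moves it along a line that contains `q`, so
    -- one of the `length L + 1` grid values is good as well. The coordinates left in `xs` keep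
    -- their values from `q`.
    GoodOff-grid : ∀ x xs p → GoodOff (x ∷ xs) p → Any (λ t → GoodOff xs (p [ x ≔ t ])) T
    GoodOff-grid x xs p (q , eq , good) = lose (proj₁ (proj₂ common))
      (q [ x ≔ t ] , [≔]-agree q p x t eq , Good-resp {line q₀ q₁ t} {q [ x ≔ t ]} (λ v i → sym
          ([≔]-line q x t v i)) (All.head (proj₂ (proj₂ common))))
      where
        t₀ : ℚ
        t₀ = q (proj₁ x) (proj₂ x)
        q₀ q₁ : Placement
        q₀ = q [ x ≔ 0ℚ ]
        q₁ = q [ x ≔ 1ℚ ]
        on-line : ∀ v i → q v i ≡ line q₀ q₁ t₀ v i
        on-line v i = trans ([≔]-unchanged q x v i) ([≔]-line q x t₀ v i)
        common : ∃[ t ] (t ∈ T) × All (λ G → Family.Good G (line q₀ q₁ t)) (F ∷ [])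
        common = common-good-parameter q₀ q₁ (F ∷ [])
            ((t₀ , Good-resp {q} {line q₀ q₁ t₀} on-line good) ∷ []) T (naturals-unique _)
          (ℕₚ.≤-reflexive (trans (cong suc (ℕₚ.+-identityʳ _)) (sym (naturals-length (suc (length L))))))
        t : ℚ
        t = proj₁ common

    GoodOff? : ∀ xs p → Dec (GoodOff xs p)
    GoodOff? []       p = Dec.map′ (λ good → p , (λ _ _ _ → refl) , good)
      (λ { (q , eq , good) → Good-resp {q} {p} (λ v i → eq v i λ ()) good }) (good? p)
    GoodOff? (x ∷ xs) p = Dec.map′
      (λ any → GoodOff-[≔] x xs p _ (proj₂ (proj₂ (find any)))) (GoodOff-grid x xs p)
      (any? (λ t → GoodOff? xs (p [ x ≔ t ])) T)

    abstract
      Indep? : Dec (Indep L)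
      Indep? = Dec.map′ (λ { (q , _ , good) → q , Ind⇒RowsIndependent q L good }) restrict (GoodOff?
          (coordinates L) (λ _ _ → 0ℚ))
        where
          -- Values outside the coordinates of `L` do not enter its rows, so they may be reset to
          -- the zero from which the search starts.
          restrict : Indep L → GoodOff (coordinates L) (λ _ _ → 0ℚ)
          restrict indep = q , off , Ind-injection {A = rows p L} {B = rows q L} (λ j → j) (λ e → e) same
              (RowsIndependent⇒Ind p L (proj₂ indep))
            where
              p : Placement
              p = proj₁ indep
              q : Placement
              q v i with Any.any? ((v , i) ≟ᶜ_) (coordinates L)
              ... | yes _ = p v i
              ... | no _  = 0ℚ
              off : ∀ v i → (v , i) ∉ coordinates L → q v i ≡ 0ℚ
              off v i x∉ with Any.any? ((v , i) ≟ᶜ_) (coordinates L)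
              ... | yes x∈ = contradiction x∈ x∉
              ... | no _   = refl
              on : ∀ v i → (v , i) ∈ coordinates L → q v i ≡ p v i
              on v i x∈ with Any.any? ((v , i) ≟ᶜ_) (coordinates L)
              ... | yes _ = refl
              ... | no x∉  = contradiction x∈ x∉
              same : ∀ j x → rows q L j x ≡ rows p L j x
              same j = row-cong _ _ (λ i → on _ i (∈-coordinates {L = L} i (∈-endpoints₁ (∈-lookup {xs = L} j))))
                                    (λ i → on _ i (∈-coordinates {L = L} i (∈-endpoints₂ (∈-lookup {xs = L} j))))

  -- Greedy bases and circuits

  Spanning : List Pair → List Pair → List Pair → Set
  Spanning D S L = ∀ {e} → e ∈ L → ¬ Indep (e ∷ D ++ S)

  greedy-extension : (S L : List Pair) → Indep S → ∃[ D ] (D ⊆ L) × Indep (D ++ S) × Spanning D S L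
  greedy-extension S [] indep = [] , (λ ()) , indep , λ ()
  greedy-extension S (e ∷ L) indep with greedy-extension S L indep
  ... | D , D⊆L , indepD , spans with Indep? (e ∷ D ++ S)
  ...   | no ¬indep = D , there ∘ D⊆L , indepD , λ { (here refl) → ¬indep ; (there g∈) → spans g∈ }
  ...   | yes indep′ = e ∷ D , (λ { (here refl) → here refl ; (there g∈) → there (D⊆L g∈) }) , indep′ ,
    -- The accepted pair `e` is now in the basis, so prefixing it again would repeat it; for the
    -- earlier pairs, dropping `e` leads back to the smaller basis.
    λ { (here refl) bad → All.head (AllPairs.head (Indep⇒UniquePairs {e ∷ e ∷ D ++ S} bad)) (inj₁ (refl , refl))
      ; {g} (there g∈) bad → spans g∈ (Indep-∷⁻ {g} {e} {D ++ S} bad) }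

  abstract
    -- The extension starts from `S`, so `D` counts the rank that the cluster contributes beyond its
    -- shared pairs; the maximality in `HasRank` bounds it.
    HasRank-extension : ∀ {L r} S → HasRank L r → S ⊆ L → Indep S →
      ∃[ D ] (D ⊆ L) × Indep (D ++ S) × Spanning D S L × (length D ℕ.+ length S ≤ r)
    HasRank-extension {L} {r} S (_ , max) S⊆L indep with greedy-extension S L indep
    ... | D , D⊆L , indepD , spans = D , D⊆L , indepD , spans ,
      subst (_≤ r) (Listₚ.length-++ D) (max (D ++ S) sub indepD)
      where
        sub : D ++ S ⊆ L
        sub e∈ with ∈-++⁻ D e∈
        ... | inj₁ e∈D = D⊆L e∈D
        ... | inj₂ e∈S = S⊆L e∈S

  removeAt-⊆ : {A : Set} (xs : List A) (k : Fin (length xs)) → removeAt xs k ⊆ xs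
  removeAt-⊆ (x ∷ xs) zero    y∈         = there y∈
  removeAt-⊆ (x ∷ xs) (suc k) (here eq)  = here eq
  removeAt-⊆ (x ∷ xs) (suc k) (there y∈) = there (removeAt-⊆ xs k y∈)

  AllPairs-removeAt : {A : Set} {R : A → A → Set} {xs : List A} (k : Fin (length xs)) →
    AllPairs R xs → AllPairs R (removeAt xs k)
  AllPairs-removeAt zero    (h ∷ hs) = hs
  AllPairs-removeAt {xs = x ∷ xs} (suc k) (h ∷ hs) =
    All.tabulate (All.lookup h ∘ removeAt-⊆ xs k) ∷ AllPairs-removeAt k hs

  -- Pairs of `L` are discarded as long as dependence survives. When none can be discarded the list
  -- is a circuit, and it still contains `e`, whose removal leaves the independent `L`. The length
  -- `k` decreases.
  circuit-through : ∀ k e (L : List Pair) → length L ≡ k → Indep L → UniquePairs (e ∷ L) → ¬ Indep (e ∷ L) →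
    ∃[ C ] (C ⊆ e ∷ L) × (e ∈ C) × Circuit C
  circuit-through k e L len indep unique dep
    with Finₚ.any? (λ j → ¬? (Indep? (e ∷ removeAt L j)))
  ... | no none = e ∷ L , (λ g∈ → g∈) , here refl , unique , dep , removals
    where
      removals : ∀ j → Indep (removeAt (e ∷ L) j)
      removals zero    = indep
      removals (suc j) with Indep? (e ∷ removeAt L j)
      ... | yes i = i
      ... | no ¬i = ⊥-elim (none (j , ¬i))
  circuit-through zero e [] len indep unique dep | yes (() , _)
  circuit-through (suc k) e L len indep unique dep | yes (j , dep′) = widen
    (circuit-through k e (removeAt L j)
      (ℕₚ.suc-injective (trans (sym (Listₚ.length-removeAt′ L j)) len))
      (Indep-⊆ᵖ {removeAt L j} {L} (AllPairs-removeAt j (Indep⇒UniquePairs {L} indep))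
          (inj₁ ∘ removeAt-⊆ L j) indep)
      (AllPairs-removeAt {xs = e ∷ L} (suc j) unique) dep′)
    where
      widen : ∃[ C ] (C ⊆ e ∷ removeAt L j) × (e ∈ C) × Circuit C → ∃[ C ] (C ⊆ e ∷ L) × (e ∈ C) × Circuit C
      widen (C , C⊆ , e∈C , circuit) = C , (removeAt-⊆ (e ∷ L) (suc j) ∘ C⊆) , e∈C , circuit

  dependent⇒implied : ∀ G {u v} → Indep (E G) → Nonedge G u v → ¬ Indep ((u , v) ∷ E G) → ImpliedNonedge G u v
  dependent⇒implied G {u} {v} indep nonedge@(_ , _ , _ , ¬adj) dep =
    nonedge , circuit-through _ (u , v) (E G) refl indep (All.tabulate distinct ∷ E-simple G) dep
    where
      distinct : ∀ {e} → e ∈ E G → ¬ SamePair (u , v) e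
      distinct e∈ (inj₁ (refl , refl)) = ¬adj (inj₁ e∈)
      distinct e∈ (inj₂ (refl , refl)) = ¬adj (inj₂ e∈)

  ∈ᵖ⇒InSpan : ∀ p {e W} → e ∈ᵖ W → InSpan (rows p W) (row p e)
  ∈ᵖ⇒InSpan p {e} {W} e∈ = InSpan-member (rows p W) (proj₁ (∈ᵖ-lookup {e} {W} e∈)) (row-SamePair p (proj₂
      (∈ᵖ-lookup {e} {W} e∈)))

  -- `¬ Indep` excludes every placement, not only one. So spanning in the matroid sense yields an
  -- actual linear expression at each placement where the basis is independent.
  dependent⇒InSpan : ∀ p e B → Ind (rows p B) → ¬ Indep (e ∷ B) → InSpan (rows p B) (row p e)
  dependent⇒InSpan p e B ind dep with Ind⊎Rel (coordinates (e ∷ B)) (rows p (e ∷ B)) (rows-supported p (e ∷ B))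
  ... | inj₁ ind′ = ⊥-elim (dep (p , Ind⇒RowsIndependent p (e ∷ B) ind′))
  ... | inj₂ rel  = Rel⇒InSpan (rows p (e ∷ B)) rel ind

  -- Relabelling of vertices

  mapPair : (Vtx → Vtx) → Pair → Pair
  mapPair ρ (u , v) = ρ u , ρ v

  mapPair-SamePair : ∀ ρ {e f} → SamePair e f → SamePair (mapPair ρ e) (mapPair ρ f)
  mapPair-SamePair ρ (inj₁ (refl , refl)) = inj₁ (refl , refl)
  mapPair-SamePair ρ (inj₂ (refl , refl)) = inj₂ (refl , refl)

  -- Injectivity of `ρ`, asked only at the endpoints in question and given by a left inverse that
  -- can be computed with.
  Retracts : (Vtx → Vtx) → (Vtx → Vtx) → Pair → Set
  Retracts ρ lam (u , v) = (lam (ρ u) ≡ u) × (lam (ρ v) ≡ v)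

  module Relabelling (p : Placement) (ρ lam : Vtx → Vtx) where

    -- The test `w ≡ ρ (lam w)` separates the vertices of the image, where the relabelled row copies
    -- the old one, from the others, where `row-relabel-off` makes it zero. Hence coefficients carry
    -- over unchanged.
    row-relabel : ∀ e → Retracts ρ lam e → ∀ w i → w ≡ ρ (lam w) →
      row p (mapPair ρ e) (w , i) ≡ row (p ∘ ρ) e (lam w , i)
    row-relabel (u , v) (ru , rv) w i w≡ with w ℕ.≟ ρ u | w ℕ.≟ ρ v | lam w ℕ.≟ u | lam w ℕ.≟ v
    ... | yes refl | _        | yes _    | _        = refl
    ... | yes refl | _        | no ≢u    | _        = contradiction ru ≢u
    ... | no w≢ρu  | _        | yes refl | _        = contradiction w≡ w≢ρu
    ... | no w≢ρu  | yes refl | no _     | yes _    = refl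
    ... | no w≢ρu  | yes refl | no _     | no ≢v    = contradiction rv ≢v
    ... | no w≢ρu  | no w≢ρv  | no _     | yes refl = contradiction w≡ w≢ρv
    ... | no w≢ρu  | no w≢ρv  | no _     | no _     = refl

    row-relabel-off : ∀ e → Retracts ρ lam e → ∀ w i → w ≢ ρ (lam w) → row p (mapPair ρ e) (w , i) ≡ 0ℚ
    row-relabel-off (u , v) (ru , rv) w i w≢ = row-off p (ρ u) (ρ v) w i
      (λ { refl → w≢ (sym (cong ρ ru)) }) (λ { refl → w≢ (sym (cong ρ rv)) })

    relabelledRows : (B : List Pair) → Fin (length B) → Coordinate → ℚ
    relabelledRows B j = row p (mapPair ρ (lookup B j))

    comb-relabel : ∀ B → (∀ {e} → e ∈ B → Retracts ρ lam e) → ∀ c w i → w ≡ ρ (lam w) →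
      comb c (relabelledRows B) (w , i) ≡ comb c (rows (p ∘ ρ) B) (lam w , i)
    comb-relabel B retracts c w i w≡ =
      comb-cong {c = c} (λ _ → refl) (λ j → row-relabel (lookup B j) (retracts (∈-lookup {xs = B} j)) w i w≡)

    comb-relabel-off : ∀ B → (∀ {e} → e ∈ B → Retracts ρ lam e) → ∀ c w i → w ≢ ρ (lam w) →
      comb c (relabelledRows B) (w , i) ≡ 0ℚ
    comb-relabel-off B retracts c w i w≢ =
      comb-zeroʳ c (relabelledRows B) (w , i) (λ j → row-relabel-off (lookup B j) (retracts
          (∈-lookup {xs = B} j)) w i w≢)

    InSpan-relabel : ∀ B e → (∀ {f} → f ∈ e ∷ B → Retracts ρ lam f) →
      InSpan (rows (p ∘ ρ) B) (row (p ∘ ρ) e) → InSpan (relabelledRows B) (row p (mapPair ρ e))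
    InSpan-relabel B e retracts (c , eq) = c , span
      where
        span : ∀ x → row p (mapPair ρ e) x ≡ comb c (relabelledRows B) x
        span (w , i) with w ℕ.≟ ρ (lam w)
        ... | yes w≡ = trans (row-relabel e (retracts (here refl)) w i w≡)
          (trans (eq (lam w , i)) (sym (comb-relabel B (retracts ∘ there) c w i w≡)))
        ... | no w≢ = trans (row-relabel-off e (retracts (here refl)) w i w≢)
          (sym (comb-relabel-off B (retracts ∘ there) c w i w≢))

    Ind-relabel : ∀ B → (∀ {f} → f ∈ B → Retracts ρ lam f) → Ind (relabelledRows B) → Ind (rows (p ∘ ρ) B)
    Ind-relabel B retracts ind c rel = ind c vanishes
      where
        vanishes : ∀ x → comb c (relabelledRows B) x ≡ 0ℚ
        vanishes (w , i) with w ℕ.≟ ρ (lam w)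
        ... | yes w≡ = trans (comb-relabel B retracts c w i w≡) (rel (lam w , i))
        ... | no w≢  = comb-relabel-off B retracts c w i w≢

  -- Turns a placement `q` of the old vertices into the placement `q ∘ lam` of the new ones: pulled
  -- back along `ρ`, it agrees with `q` on all endpoints of `B`.
  Ind-retract : ∀ q ρ lam B → (∀ {e} → e ∈ B → Retracts ρ lam e) → Ind (rows q B) → Ind (rows (q ∘ lam ∘ ρ) B)
  Ind-retract q ρ lam B retracts = Ind-injection {A = rows q B} {B = rows (q ∘ lam ∘ ρ) B} (λ j → j)
      (λ eq → eq) same
    where
      same : ∀ j x → rows (q ∘ lam ∘ ρ) B j x ≡ rows q B j x
      same j = row-cong {q ∘ lam ∘ ρ} {q} _ _
        (λ i → cong (λ w → q w i) (proj₁ (retracts (∈-lookup {xs = B} j))))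
        (λ i → cong (λ w → q w i) (proj₂ (retracts (∈-lookup {xs = B} j))))

  -- At `p ∘ ρ` the basis expresses every pair of `L`, and the same coefficients work after
  -- relabelling. Only the images of the basis then have to be found in the span of `W`.
  InSpan-image : ∀ p ρ lam D S {L W} → Ind (rows (p ∘ ρ) (D ++ S)) → Spanning D S L →
    (∀ {e} → e ∈ L → Retracts ρ lam e) → (∀ {e} → e ∈ D ++ S → Retracts ρ lam e) →
    (∀ {e} → e ∈ D ++ S → InSpan (rows p W) (row p (mapPair ρ e))) →
    ∀ {e} → e ∈ L → InSpan (rows p W) (row p (mapPair ρ e))
  InSpan-image p ρ lam D S {L} {W} ind spans retracts retractsB inW {e} e∈ = InSpan-trans
    {A = relabelledRows (D ++ S)} {B = rows p W}
    (InSpan-relabel (D ++ S) e (λ { (here refl) → retracts e∈ ; (there f∈) → retractsB f∈ })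
      (dependent⇒InSpan (p ∘ ρ) e (D ++ S) ind (spans e∈)))
    (λ j → inW (∈-lookup {xs = D ++ S} j))
    where open Relabelling p ρ lam

  -- Stars and 0-extensions

  star : Vtx → Vtx → Vtx → Vtx → List Pair
  star c x y z = (c , x) ∷ (c , y) ∷ (c , z) ∷ []

  leaf : Vtx → Vtx → Vtx → Fin 3 → Vtx
  leaf x y z zero             = x
  leaf x y z (suc zero)       = y
  leaf x y z (suc (suc zero)) = z

  starVectors : Vtx → Vtx → Vtx → Vtx → Placement → Fin 3 → Fin 3 → ℚ
  starVectors c x y z p j i = p c i - p (leaf x y z j) i

  starFamily : Vtx → Vtx → Vtx → Vtx → Family
  starFamily c x y z = record
    { size      = 3
    ; Coord     = Fin 3
    ; vectors   = starVectors c x y z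
    ; coords    = allFin 3
    ; supported = λ p j i i∉ → ⊥-elim (i∉ (∈-allFin i))
    ; affine    = λ p q t j i → solve 5 (λ t a b c d →
        ((con 1ℚ :- t) :* a :+ t :* c) :- ((con 1ℚ :- t) :* b :+ t :* d)
          := (con 1ℚ :- t) :* (a :- b) :+ t :* (c :- d)) refl t (p c i) (p (leaf x y z j) i) (q c i) (q
              (leaf x y z j) i)
    ; vectors-cong = λ eq j i → cong₂ _-_ (eq c i) (eq (leaf x y z j) i)
    }

  module _ (c x y z : Vtx) (x≢c : x ≢ c) (y≢c : y ≢ c) (z≢c : z ≢ c) (x≢y : x ≢ y) (x≢z : x ≢ z) (y≢z : y ≢ z) where

    private
      -- Centre at the origin and leaves at the negative unit vectors, so that the edge vectors are
      -- the standard basis.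
      frame : Placement
      frame v i with v ℕ.≟ x | v ℕ.≟ y | v ℕ.≟ z
      ... | yes _ | _     | _     = - δ zero i
      ... | no _  | yes _ | _     = - δ (suc zero) i
      ... | no _  | no _  | yes _ = - δ (suc (suc zero)) i
      ... | no _  | no _  | no _  = 0ℚ

      frame-leaf : ∀ j i → frame (leaf x y z j) i ≡ - δ j i
      frame-leaf zero i with x ℕ.≟ x
      ... | yes _ = refl
      ... | no ≢  = contradiction refl ≢
      frame-leaf (suc zero) i with y ℕ.≟ x | y ℕ.≟ y
      ... | yes eq | _    = contradiction (sym eq) x≢y
      ... | no _   | yes _ = refl
      ... | no _   | no ≢ = contradiction refl ≢
      frame-leaf (suc (suc zero)) i with z ℕ.≟ x | z ℕ.≟ y | z ℕ.≟ z
      ... | yes eq | _      | _    = contradiction (sym eq) x≢z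
      ... | no _   | yes eq | _    = contradiction (sym eq) y≢z
      ... | no _   | no _   | yes _ = refl
      ... | no _   | no _   | no ≢ = contradiction refl ≢

      frame-centre : ∀ i → frame c i ≡ 0ℚ
      frame-centre i with c ℕ.≟ x | c ℕ.≟ y | c ℕ.≟ z
      ... | yes eq | _      | _      = contradiction (sym eq) x≢c
      ... | no _   | yes eq | _      = contradiction (sym eq) y≢c
      ... | no _   | no _   | yes eq = contradiction (sym eq) z≢c
      ... | no _   | no _   | no _   = refl

    star-good : ∃[ p ] Family.Good (starFamily c x y z) p
    star-good = frame , λ d rel j → trans (sym (comb-δʳ d j)) (trans
      (comb-cong {c = d} (λ _ → refl) (λ k → sym (trans (cong₂ _-_ (frame-centre j) (frame-leaf k j))
        (solve 1 (λ y → con 0ℚ :- (:- y) := y) refl (δ k j))))) (rel j))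

  -- A 0-extension: a new vertex of degree three in general position keeps independence, because at
  -- the coordinates of the new vertex only the three new rows are nonzero.
  star-extension : ∀ p c x y z L → c ≢ x → c ≢ y → c ≢ z → c ∉ endpoints L →
    Ind (starVectors c x y z p) → Ind (rows p L) → Ind (rows p (star c x y z ++ L))
  star-extension p c x y z L c≢x c≢y c≢z c∉ indStar ind d rel = all-zero
    where
      d₃ : Fin 3 → ℚ
      d₃ zero             = d zero
      d₃ (suc zero)       = d (suc zero)
      d₃ (suc (suc zero)) = d (suc (suc zero))
      dL : Fin (length L) → ℚ
      dL j = d (suc (suc (suc j)))
      L-off : ∀ i → comb dL (rows p L) (c , i) ≡ 0ℚ
      L-off i = comb-zeroʳ dL (rows p L) (c , i) (λ j → row-off p _ _ c i
        (λ { refl → c∉ (∈-endpoints₁ {L = L} (∈-lookup {xs = L} j)) }) (λ { refl → c∉ (∈-endpoints₂ {L = L}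
            (∈-lookup {xs = L} j)) }))
      star-zero : ∀ j → d₃ j ≡ 0ℚ
      star-zero = indStar d₃ λ i → begin
        d zero * (p c i - p x i) + (d (suc zero) * (p c i - p y i) + (d (suc (suc zero)) * (p c i - p z i) + 0ℚ))
          ≡⟨ cong₂ _+_ (cong (d zero *_) (sym (row-endpoint₁ p c x i))) (cong₂ _+_ (cong (d (suc zero) *_) (sym
              (row-endpoint₁ p c y i)))
               (cong₂ _+_ (cong (d (suc (suc zero)) *_) (sym (row-endpoint₁ p c z i))) (sym (L-off i)))) ⟩
        comb d (rows p (star c x y z ++ L)) (c , i) ≡⟨ rel (c , i) ⟩
        0ℚ ∎
      L-zero : ∀ j → dL j ≡ 0ℚ
      L-zero = ind dL λ x′ → begin
        comb dL (rows p L) x′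
          ≡⟨ solve 4 (λ s a b c → s := con 0ℚ :* a :+ (con 0ℚ :* b :+ (con 0ℚ :* c :+ s))) refl (comb dL
              (rows p L) x′)
               (row p (c , x) x′) (row p (c , y) x′) (row p (c , z) x′) ⟩
        0ℚ * row p (c , x) x′ + (0ℚ * row p (c , y) x′ + (0ℚ * row p (c , z) x′ + comb dL (rows p L) x′))
          ≡⟨ cong₂ (λ a r → a * row p (c , x) x′ + r) (sym (star-zero zero))
               (cong₂ (λ a r → a * row p (c , y) x′ + r) (sym (star-zero (suc zero)))
                 (cong (λ a → a * row p (c , z) x′ + comb dL (rows p L) x′) (sym (star-zero (suc (suc zero)))))) ⟩
        comb d (rows p (star c x y z ++ L)) x′ ≡⟨ rel x′ ⟩
        0ℚ ∎
      all-zero : ∀ j → d j ≡ 0ℚ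
      all-zero zero                = star-zero zero
      all-zero (suc zero)          = star-zero (suc zero)
      all-zero (suc (suc zero))    = star-zero (suc (suc zero))
      all-zero (suc (suc (suc j))) = L-zero j

open import Data.Nat using (_+_)

-- Covers and counting

norm-same : ∀ e → SamePair (norm e) e
norm-same (u , v) with ℕₚ.≤-total u v
... | inj₁ u≤v = inj₁ (ℕₚ.m≤n⇒m⊓n≡m u≤v , ℕₚ.m≤n⇒m⊔n≡n u≤v)
... | inj₂ v≤u = inj₂ (ℕₚ.m≥n⇒m⊓n≡n v≤u , ℕₚ.m≥n⇒m⊔n≡m v≤u)

norm-cong : ∀ {e f} → SamePair e f → norm e ≡ norm f
norm-cong (inj₁ (refl , refl)) = refl
norm-cong {u , v} (inj₂ (refl , refl)) = cong₂ _,_ (ℕₚ.⊓-comm u v) (ℕₚ.⊔-comm u v)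

norm-idem : ∀ e → norm (norm e) ≡ norm e
norm-idem e = norm-cong (norm-same e)

norm-∈ᵖ : ∀ {e L} → norm e ∈ L → e ∈ᵖ L
norm-∈ᵖ {e} {L} ∈L with norm-same e
... | inj₁ (eq₁ , eq₂) = inj₁ (subst (_∈ L) (cong₂ _,_ eq₁ eq₂) ∈L)
... | inj₂ (eq₁ , eq₂) = inj₂ (subst (_∈ L) (cong₂ _,_ eq₁ eq₂) ∈L)

dedupNorm⁺ : ∀ {e L} → e ∈ L → norm e ∈ dedupNorm L
dedupNorm⁺ e∈ = ∈-deduplicate⁺ _≟ᵖ_ (∈-map⁺ norm e∈)

dedupNorm⁻ : ∀ {e} L → e ∈ dedupNorm L → ∃[ f ] (f ∈ L) × (e ≡ norm f)
dedupNorm⁻ L e∈ = ∈-map⁻ norm (∈-deduplicate⁻ _≟ᵖ_ (map norm L) e∈)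

dedupNorm-normal : ∀ {e} L → e ∈ dedupNorm L → norm e ≡ e
dedupNorm-normal L e∈ with dedupNorm⁻ L e∈
... | f , _ , refl = norm-idem f

normal-UniquePairs : ∀ {L} → (∀ {e} → e ∈ L → norm e ≡ e) → Unique L → UniquePairs L
normal-UniquePairs normal [] = []
normal-UniquePairs normal (h ∷ hs) =
  All.tabulate (λ f∈ same → All.lookup h f∈ (trans (sym (normal (here refl))) (trans (norm-cong same) (normal
      (there f∈)))))
    ∷ normal-UniquePairs (normal ∘ there) hs

dedupNorm-UniquePairs : ∀ L → UniquePairs (dedupNorm L)
dedupNorm-UniquePairs L = normal-UniquePairs (dedupNorm-normal L) (deduplicate-! (map norm L))

Inside : List Vtx → Pair → Set
Inside X (u , v) = (u ∈ X) × (v ∈ X)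

Inside-SamePair : ∀ {X e f} → SamePair e f → Inside X e → Inside X f
Inside-SamePair (inj₁ (refl , refl)) i = i
Inside-SamePair (inj₂ (refl , refl)) i = swap i

inside? : ∀ X → Decidable (λ e → (proj₁ e ∈ X) × (proj₂ e ∈ X))
inside? X e = (proj₁ e ∈? X) ×-dec (proj₂ e ∈? X)

inducedOn⁺ : ∀ {X L e} → e ∈ L → Inside X e → e ∈ inducedOn X L
inducedOn⁺ {X} e∈ i = ∈-filter⁺ (inside? X) e∈ i

inducedOn⁻ : ∀ X L {e} → e ∈ inducedOn X L → (e ∈ L) × Inside X e
inducedOn⁻ X L = ∈-filter⁻ (inside? X) {xs = L}

inducedOn-UniquePairs : ∀ X {L} → UniquePairs L → UniquePairs (inducedOn X L)
inducedOn-UniquePairs X = AllPairsₚ.filter⁺ (inside? X)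

inducedOn-mono : ∀ {X L M} → L ⊆ M → inducedOn X L ⊆ inducedOn X M
inducedOn-mono {X} {L} {M} L⊆M e∈ = inducedOn⁺ {X} {M} (L⊆M (proj₁ (inducedOn⁻ X L e∈))) (proj₂ (inducedOn⁻ X L e∈))

sumOver : ∀ {n} → (Fin n → ℕ) → ℕ
sumOver f = sum (tabulate f)

sumOver-mono : ∀ {n} {f g : Fin n → ℕ} → (∀ i → f i ≤ g i) → sumOver f ≤ sumOver g
sumOver-mono {zero}  h = z≤n
sumOver-mono {suc n} h = ℕₚ.+-mono-≤ (h zero) (sumOver-mono (h ∘ suc))

+-exchange : ∀ a b c d → (a + b) + (c + d) ≡ (a + c) + (b + d)
+-exchange a b c d = trans (ℕₚ.+-assoc a b (c + d)) (trans
  (cong (a +_) (trans (sym (ℕₚ.+-assoc b c d)) (trans (cong (_+ d) (ℕₚ.+-comm b c)) (ℕₚ.+-assoc c b d))))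
  (sym (ℕₚ.+-assoc a c (b + d))))

sumOver-+ : ∀ {n} (f g : Fin n → ℕ) → sumOver (λ i → f i + g i) ≡ sumOver f + sumOver g
sumOver-+ {zero}  f g = refl
sumOver-+ {suc n} f g = trans (cong (λ s → (f zero + g zero) + s) (sumOver-+ (f ∘ suc) (g ∘ suc)))
  (+-exchange (f zero) (g zero) (sumOver (f ∘ suc)) (sumOver (g ∘ suc)))

length-concat-tabulate : ∀ {A : Set} {n} (f : Fin n → List A) → length (concat (tabulate f)) ≡ sumOver (length ∘ f)
length-concat-tabulate {n = zero}  f = refl
length-concat-tabulate {n = suc n} f = trans (Listₚ.length-++ (f zero)) (cong (λ s → length (f zero) + s)
    (length-concat-tabulate (f ∘ suc)))

∈-concat-tabulate : ∀ {A : Set} {n} (f : Fin n → List A) i {x} → x ∈ f i → x ∈ concat (tabulate f)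
∈-concat-tabulate f zero    x∈ = ∈-++⁺ˡ x∈
∈-concat-tabulate f (suc i) x∈ = ∈-++⁺ʳ (f zero) (∈-concat-tabulate (f ∘ suc) i x∈)

length-filter-∷ : ∀ {A : Set} {P : A → Set} (P? : Decidable P) x xs →
  length (filter P? (x ∷ xs)) ≡ length (filter P? (x ∷ [])) + length (filter P? xs)
length-filter-∷ P? x xs with P? x
... | yes _ = refl
... | no _  = refl

length-filter-cover : ∀ (X : List Vtx) e (𝒳 : Cover) →
  dCov (X ∷ 𝒳) e ≡ length (inducedOn X (e ∷ [])) + dCov 𝒳 e
length-filter-cover X e 𝒳 = go (inside? X e)
  where
    contains? : Decidable (λ X → Inside X e)
    contains? X = inside? X e
    go : Dec (Inside X e) → dCov (X ∷ 𝒳) e ≡ length (inducedOn X (e ∷ [])) + dCov 𝒳 e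
    go (yes p) = trans (cong length (Listₚ.filter-accept contains? p))
      (cong (λ L → length L + dCov 𝒳 e) (sym (Listₚ.filter-accept (inside? X) {xs = []} p)))
    go (no ¬p) = trans (cong length (Listₚ.filter-reject contains? ¬p))
      (cong (λ L → length L + dCov 𝒳 e) (sym (Listₚ.filter-reject (inside? X) {xs = []} ¬p)))

-- Incidences of clusters and pairs, counted by cluster and by pair. It replaces the multiplicities
-- `d(𝒳,e)` by numbers of pairs inside each cluster, which can be compared with the ranks cluster by
-- cluster.
double-counting : ∀ (𝒳 : Cover) L →
  sumOver (λ i → length (inducedOn (cl 𝒳 i) L)) ≡ sum (map (dCov 𝒳) L)
double-counting 𝒳 [] = none 𝒳
  where
    none : ∀ 𝒳 → sumOver (λ (i : Fin (length 𝒳)) → 0) ≡ 0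
    none []      = refl
    none (X ∷ 𝒳) = none 𝒳
double-counting 𝒳 (e ∷ L) = trans (split 𝒳) (cong₂ _+_ (single 𝒳) (double-counting 𝒳 L))
  where
    split : ∀ 𝒳 → sumOver (λ i → length (inducedOn (cl 𝒳 i) (e ∷ L)))
                ≡ sumOver (λ i → length (inducedOn (cl 𝒳 i) (e ∷ []))) + sumOver (λ i → length (inducedOn
                    (cl 𝒳 i) L))
    split [] = refl
    split (X ∷ 𝒳) = trans (cong₂ _+_ (length-filter-∷ (inside? X) e L) (split 𝒳))
      (+-exchange (length (inducedOn X (e ∷ []))) (length (inducedOn X L)) _ _)
    single : ∀ 𝒳 → sumOver (λ i → length (inducedOn (cl 𝒳 i) (e ∷ []))) ≡ dCov 𝒳 e
    single []      = refl
    single (X ∷ 𝒳) = trans (cong (λ s → length (inducedOn X (e ∷ [])) + s) (single 𝒳)) (sym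
        (length-filter-cover X e 𝒳))

Pointwise-function : {A : Set} {R : A → ℕ → Set} {xs : List A} {rs : List ℕ} → Pointwise R xs rs →
  ∃[ r ] (∀ i → R (lookup xs i) (r i)) × (sum rs ≡ sumOver r)
Pointwise-function [] = (λ ()) , (λ ()) , refl
Pointwise-function {R = R} {x ∷ xs} {n ∷ _} (h ∷ hs) with Pointwise-function hs
... | r , hr , eq = r′ , hr′ , cong (n +_) eq
  where
    r′ : Fin (suc (length xs)) → ℕ
    r′ zero    = n
    r′ (suc i) = r i
    hr′ : ∀ i → R (lookup (x ∷ xs) i) (r′ i)
    hr′ zero    = h
    hr′ (suc i) = hr i

sumℤ-pred : ∀ {A : Set} (d : A → ℕ) (L : List A) →
  sumℤ (map (λ e → (ℤ.+ d e) ℤ.- (ℤ.+ 1)) L) ℤ.+ (ℤ.+ length L) ≡ ℤ.+ sum (map d L)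
sumℤ-pred d [] = refl
sumℤ-pred d (e ∷ L) = trans (rearrange (ℤ.+ d e) (sumℤ (map (λ e → (ℤ.+ d e) ℤ.- (ℤ.+ 1)) L)) (ℤ.+ length L))
  (cong (λ s → (ℤ.+ d e) ℤ.+ s) (sumℤ-pred d L))
  where
    rearrange : ∀ a s n → ((a ℤ.- (ℤ.+ 1)) ℤ.+ s) ℤ.+ ((ℤ.+ 1) ℤ.+ n) ≡ a ℤ.+ (s ℤ.+ n)
    rearrange = ℤ-Solver.solve-∀

sharedAnd : Cover → List Pair → List Pair
sharedAnd 𝒳 K = dedupNorm (shared 𝒳 ++ K)

abstract
  -- The definition of IE with all subtractions moved across, so that the later counting stays in ℕ:
  -- the terms `d - 1` leave `length SK` on the side of the ranks.
  HasIE-count : ∀ {G 𝒳 K n} → HasIE G 𝒳 K (ℤ.+ n) →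
    ∃[ r ] (∀ i → HasRank (inducedOn (cl 𝒳 i) (E G ++ sharedAnd 𝒳 K)) (r i)) ×
           (n + sumOver (λ i → length (inducedOn (cl 𝒳 i) (sharedAnd 𝒳 K))) ≡ sumOver r + length (sharedAnd 𝒳 K))
  HasIE-count {G} {𝒳} {K} {n} (rs , ranks , eq) with Pointwise-function ranks
  ... | r , hr , sums = r , hr , trans (cong (n +_) (double-counting 𝒳 SK)) (ℤₚ.+-injective count)
    where
      SK : List Pair
      SK = sharedAnd 𝒳 K
      s : ℤ
      s = sumℤ (map (λ e → (ℤ.+ dCov 𝒳 e) ℤ.- (ℤ.+ 1)) SK)
      rearrange : ∀ a s n → (a ℤ.- s) ℤ.+ (s ℤ.+ n) ≡ a ℤ.+ n
      rearrange = ℤ-Solver.solve-∀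
      count : (ℤ.+ n) ℤ.+ (ℤ.+ sum (map (dCov 𝒳) SK)) ≡ (ℤ.+ sumOver r) ℤ.+ (ℤ.+ length SK)
      count = trans (cong₂ ℤ._+_ eq (sym (sumℤ-pred (dCov 𝒳) SK)))
        (trans (rearrange (ℤ.+ sum rs) s (ℤ.+ length SK)) (cong (λ k → (ℤ.+ k) ℤ.+ (ℤ.+ length SK)) sums))

-- Shared pairs of a thin cover

pairsOf⁻ : ∀ {A : Set} (xs : List A) {x y} → (x , y) ∈ pairsOf xs →
  ∃[ i ] ∃[ j ] (i ≢ j) × (x ≡ lookup xs i) × (y ≡ lookup xs j)
pairsOf⁻ (z ∷ xs) xy∈ with ∈-++⁻ (map (z ,_) xs) xy∈
... | inj₁ ∈map with ∈-map⁻ (z ,_) ∈map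
...   | y , y∈ , refl = zero , suc (Any.index y∈) , (λ ()) , refl , Anyₚ.lookup-index y∈
pairsOf⁻ (z ∷ xs) xy∈ | inj₂ ∈rest with pairsOf⁻ xs ∈rest
... | i , j , i≢j , eq₁ , eq₂ = suc i , suc j , i≢j ∘ Finₚ.suc-injective , eq₁ , eq₂

pairsOf⁺ : ∀ {A : Set} (xs : List A) i j → i ≢ j →
  ((lookup xs i , lookup xs j) ∈ pairsOf xs) ⊎ ((lookup xs j , lookup xs i) ∈ pairsOf xs)
pairsOf⁺ (x ∷ xs) zero    zero    i≢j = contradiction refl i≢j
pairsOf⁺ (x ∷ xs) zero    (suc j) i≢j = inj₁ (∈-++⁺ˡ (∈-map⁺ (x ,_) (∈-lookup {xs = xs} j)))
pairsOf⁺ (x ∷ xs) (suc i) zero    i≢j = inj₂ (∈-++⁺ˡ (∈-map⁺ (x ,_) (∈-lookup {xs = xs} i)))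
pairsOf⁺ (x ∷ xs) (suc i) (suc j) i≢j with pairsOf⁺ xs i j (i≢j ∘ cong suc)
... | inj₁ ∈ps = inj₁ (∈-++⁺ʳ (map (x ,_) xs) ∈ps)
... | inj₂ ∈ps = inj₂ (∈-++⁺ʳ (map (x ,_) xs) ∈ps)

inter⁻ : ∀ X Y {w} → w ∈ inter X Y → (w ∈ X) × (w ∈ Y)
inter⁻ X Y = ∈-filter⁻ (_∈? Y) {xs = X}

inter⁺ : ∀ {X Y w} → w ∈ X → w ∈ Y → w ∈ inter X Y
inter⁺ {X} {Y} = ∈-filter⁺ (_∈? Y)

∈-pairOf2⁻ : ∀ {Z e} → Unique Z → e ∈ pairOf2 Z → (proj₁ e ∈ Z) × (proj₂ e ∈ Z) × (proj₁ e ≢ proj₂ e)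
∈-pairOf2⁻ {u ∷ v ∷ []} ((u≢v ∷ []) ∷ _) (here refl) with norm-same (u , v)
... | inj₁ (eq₁ , eq₂) rewrite eq₁ | eq₂ = here refl , there (here refl) , u≢v
... | inj₂ (eq₁ , eq₂) rewrite eq₁ | eq₂ = there (here refl) , here refl , u≢v ∘ sym

∈-pairOf2⁺ : ∀ {Z u v} → length Z ≤ 2 → u ∈ Z → v ∈ Z → u ≢ v → norm (u , v) ∈ pairOf2 Z
∈-pairOf2⁺ {_ ∷ []} _ (here refl) (here refl) u≢v = contradiction refl u≢v
∈-pairOf2⁺ {_ ∷ _ ∷ []} _ (here refl) (here refl) u≢v = contradiction refl u≢v
∈-pairOf2⁺ {_ ∷ _ ∷ []} _ (here refl) (there (here refl)) u≢v = here refl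
∈-pairOf2⁺ {_ ∷ _ ∷ []} _ (there (here refl)) (here refl) u≢v = here (norm-cong (inj₂ (refl , refl)))
∈-pairOf2⁺ {_ ∷ _ ∷ []} _ (there (here refl)) (there (here refl)) u≢v = contradiction refl u≢v
∈-pairOf2⁺ {_ ∷ _ ∷ _ ∷ _} (s≤s (s≤s ()))

length≤2⇒one-of : ∀ {A : Set} {Z : List A} {u v w} → length Z ≤ 2 → u ∈ Z → v ∈ Z → u ≢ v → w ∈ Z → (w ≡ u) ⊎
    (w ≡ v)
length≤2⇒one-of {Z = _ ∷ []} _ (here refl) (here refl) u≢v _ = contradiction refl u≢v
length≤2⇒one-of {Z = _ ∷ _ ∷ []} _ (here refl) (here refl) u≢v _ = contradiction refl u≢v
length≤2⇒one-of {Z = _ ∷ _ ∷ []} _ (there (here refl)) (there (here refl)) u≢v _ = contradiction refl u≢v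
length≤2⇒one-of {Z = _ ∷ _ ∷ []} _ (here refl) (there (here refl)) _ (here refl) = inj₁ refl
length≤2⇒one-of {Z = _ ∷ _ ∷ []} _ (here refl) (there (here refl)) _ (there (here refl)) = inj₂ refl
length≤2⇒one-of {Z = _ ∷ _ ∷ []} _ (there (here refl)) (here refl) _ (here refl) = inj₂ refl
length≤2⇒one-of {Z = _ ∷ _ ∷ []} _ (there (here refl)) (here refl) _ (there (here refl)) = inj₁ refl
length≤2⇒one-of {Z = _ ∷ _ ∷ _ ∷ _} (s≤s (s≤s ()))

two-of-filter : ∀ {A : Set} {P : A → Set} (P? : Decidable P) (xs : List A) → 2 ≤ length (filter P? xs) →
  ∃[ i ] ∃[ j ] (i ≢ j) × P (lookup xs i) × P (lookup xs j)
two-of-filter P? (x ∷ xs) two with P? x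
... | no _ with two-of-filter P? xs two
...   | i , j , i≢j , pi , pj = suc i , suc j , i≢j ∘ Finₚ.suc-injective , pi , pj
two-of-filter {P = P} P? (x ∷ xs) (s≤s one) | yes px = zero , suc (proj₁ second) , (λ ()) , px , proj₂ second
  where
    second : ∃[ j ] P (lookup xs j)
    second with filter P? xs in eq
    second | y ∷ _ with ∈-filter⁻ P? {xs = xs} (subst (y ∈_) (sym eq) (here refl))
    ... | y∈ , py = Any.index y∈ , subst P (Anyₚ.lookup-index y∈) py
    second | [] = contradiction one λ ()

module CoverProperties {G : Graph} {𝒳 : Cover} (cover : TwoThinCover G 𝒳) where
  open TwoThinCover cover

  inter-unique : ∀ i j → Unique (inter (cl 𝒳 i) (cl 𝒳 j))
  inter-unique i j = Uniqueₚ.filter⁺ (_∈? cl 𝒳 j) (All.lookup cl-unique (∈-lookup i))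

  shared⁻ : ∀ {e} → e ∈ shared 𝒳 → (norm e ≡ e) × (proj₁ e ≢ proj₂ e) × ∃[ i ] Inside (cl 𝒳 i) e
  shared⁻ {e} e∈ with dedupNorm⁻ _ e∈
  ... | f , f∈ , refl with find (∈-concatMap⁻ _ {xs = pairsOf 𝒳} f∈)
  ...   | (X , Y) , XY∈ , f∈XY with pairsOf⁻ 𝒳 XY∈
  ...     | i , j , i≢j , refl , refl with ∈-pairOf2⁻ (inter-unique i j) f∈XY
  ...       | u∈ , v∈ , u≢v = norm-idem f , distinct (norm-same f) ,
    i , Inside-SamePair (SamePair-sym (norm-same f)) (proj₁ (inter⁻ (cl 𝒳 i) (cl 𝒳 j) u∈) , proj₁ (inter⁻
        (cl 𝒳 i) (cl 𝒳 j) v∈))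
    where
      distinct : SamePair (norm f) f → proj₁ (norm f) ≢ proj₂ (norm f)
      distinct (inj₁ (eq₁ , eq₂)) eq = u≢v (trans (sym eq₁) (trans eq eq₂))
      distinct (inj₂ (eq₁ , eq₂)) eq = u≢v (trans (sym eq₂) (trans (sym eq) eq₁))

  -- Thinness: two distinct common vertices already make up the whole intersection of the clusters.
  shared⁺ : ∀ i j {u v} → i ≢ j → u ≢ v → Inside (cl 𝒳 i) (u , v) → Inside (cl 𝒳 j) (u , v) → norm
      (u , v) ∈ shared 𝒳
  shared⁺ i j {u} {v} i≢j u≢v (u∈i , v∈i) (u∈j , v∈j) with pairsOf⁺ 𝒳 i j i≢j
  ... | inj₁ ij∈ = subst (_∈ shared 𝒳) (norm-idem (u , v)) (dedupNorm⁺ (∈-concatMap⁺ _ (lose ij∈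
    (∈-pairOf2⁺ (thin i j i≢j) (inter⁺ u∈i u∈j) (inter⁺ v∈i v∈j) u≢v))))
  ... | inj₂ ji∈ = subst (_∈ shared 𝒳) (norm-idem (u , v)) (dedupNorm⁺ (∈-concatMap⁺ _ (lose ji∈
    (∈-pairOf2⁺ (thin j i (i≢j ∘ sym)) (inter⁺ u∈j u∈i) (inter⁺ v∈j v∈i) u≢v))))

  common-vertices : ∀ i j {u v w} → i ≢ j → u ≢ v → Inside (cl 𝒳 i) (u , v) → Inside (cl 𝒳 j) (u , v) →
    w ∈ cl 𝒳 i → w ∈ cl 𝒳 j → (w ≡ u) ⊎ (w ≡ v)
  common-vertices i j i≢j u≢v (u∈i , v∈i) (u∈j , v∈j) w∈i w∈j =
    length≤2⇒one-of (thin i j i≢j) (inter⁺ u∈i u∈j) (inter⁺ v∈i v∈j) u≢v (inter⁺ w∈i w∈j)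

  covers-index : ∀ {e} → e ∈ᵖ E G → ∃[ i ] Inside (cl 𝒳 i) e
  covers-index {u , v} (inj₁ e∈) with covers e∈
  ... | X , X∈ , u∈ , v∈ = Any.index X∈ , subst (u ∈_) (Anyₚ.lookup-index X∈) u∈ , subst (v ∈_)
      (Anyₚ.lookup-index X∈) v∈
  covers-index {u , v} (inj₂ e∈) with covers e∈
  ... | X , X∈ , v∈ , u∈ = Any.index X∈ , subst (u ∈_) (Anyₚ.lookup-index X∈) u∈ , subst (v ∈_)
      (Anyₚ.lookup-index X∈) v∈

  Inside⇒∈V : ∀ i {e} → Inside (cl 𝒳 i) e → (proj₁ e ∈ V G) × (proj₂ e ∈ V G)
  Inside⇒∈V i (u∈ , v∈) = All.lookup cl-sub (∈-lookup i) u∈ , All.lookup cl-sub (∈-lookup i) v∈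

  unshared-once : ∀ {e} → e ∈ E G → norm e ∉ shared 𝒳 → dCov 𝒳 e ≤ 1
  unshared-once {u , v} e∈ unshared with 2 ℕ.≤? dCov 𝒳 (u , v)
  ... | no ≱2 = ℕₚ.≤-pred (ℕₚ.≰⇒> ≱2)
  ... | yes two with two-of-filter (λ X → (u ∈? X) ×-dec (v ∈? X)) 𝒳 two
  ...   | i , j , i≢j , in-i , in-j = contradiction (shared⁺ i j i≢j (E-loopless G e∈) in-i in-j) unshared

  -- Were all pairs of S ∪ K edges, the clusters would meet only in edges, and IE would count every edge once.
  IE-of-edges-≤ : ∀ {K n} → HasIE G 𝒳 K (ℤ.+ n) → (∀ {e} → e ∈ sharedAnd 𝒳 K → e ∈ᵖ E G) → n ≤ length (E G)
  IE-of-edges-≤ {K} {n} ie edges with HasIE-count {G} {𝒳} {K} ie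
  ... | r , ranks , count = ℕₚ.+-cancelʳ-≤ (sumOver sk) n (length (E G)) (begin
      n + sumOver sk                     ≡⟨ count ⟩
      sumOver r + length SK              ≤⟨ ℕₚ.+-monoˡ-≤ (length SK) (sumOver-mono cluster-≤) ⟩
      sumOver (λ i → sk i + b i) + length SK ≡⟨ cong (_+ length SK) (sumOver-+ sk b) ⟩
      sumOver sk + sumOver b + length SK ≤⟨ ℕₚ.+-monoˡ-≤ (length SK) (ℕₚ.+-monoʳ-≤ (sumOver sk) b-≤) ⟩
      sumOver sk + length B + length SK  ≡⟨ ℕₚ.+-assoc (sumOver sk) (length B) (length SK) ⟩
      sumOver sk + (length B + length SK) ≤⟨ ℕₚ.+-monoʳ-≤ (sumOver sk) (ℕₚ.+-monoʳ-≤ (length B)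
                                              (UniquePairs-length-≤ {SK} {A} (dedupNorm-UniquePairs _) SK⊆A)) ⟩
      sumOver sk + (length B + length A) ≡⟨ cong (sumOver sk +_) (trans (ℕₚ.+-comm (length B) (length A)) (sym
          (length-filter-∁ inSK? (E G)))) ⟩
      sumOver sk + length (E G)          ≡⟨ ℕₚ.+-comm (sumOver sk) (length (E G)) ⟩
      length (E G) + sumOver sk          ∎)
    where
      open ℕₚ.≤-Reasoning
      SK A B : List Pair
      SK = sharedAnd 𝒳 K
      inSK? : Decidable (λ e → norm e ∈ SK)
      inSK? e = norm e ∈ᵖ? SK
      -- `A` accounts for the pairs of S ∪ K and `B` for the ranks of the clusters beyond them;
      -- together they are all edges.
      A = filter inSK? (E G)
      B = filter (¬? ∘ inSK?) (E G)
      sk b : Fin (length 𝒳) → ℕ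
      sk i = length (inducedOn (cl 𝒳 i) SK)
      b i = length (inducedOn (cl 𝒳 i) B)
      SK⊆A : ∀ {e} → e ∈ SK → e ∈ᵖ A
      SK⊆A {e} e∈ with edges e∈
      ... | inj₁ e∈E = inj₁ (∈-filter⁺ inSK? e∈E (subst (_∈ SK) (sym (dedupNorm-normal (shared 𝒳 ++ K) e∈)) e∈))
      ... | inj₂ e∈E = inj₂ (∈-filter⁺ inSK? e∈E (subst (_∈ SK)
              (sym (trans (norm-cong (inj₂ (refl , refl))) (dedupNorm-normal (shared 𝒳 ++ K) e∈))) e∈))
      cluster-≤ : ∀ i → r i ≤ sk i + b i
      cluster-≤ i with ranks i
      ... | (M , M⊆ , indep , len) , _ = ℕₚ.≤-trans (ℕₚ.≤-reflexive (sym len)) (ℕₚ.≤-trans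
        (UniquePairs-length-≤ {M} {inducedOn X SK ++ inducedOn X B} (Indep⇒UniquePairs {M} indep) sub)
        (ℕₚ.≤-reflexive (Listₚ.length-++ (inducedOn X SK))))
        where
          X : List Vtx
          X = cl 𝒳 i
          edge : ∀ {e} → e ∈ E G → Inside X e → e ∈ᵖ (inducedOn X SK ++ inducedOn X B)
          edge {e} e∈ inside with inSK? e
          ... | no ∉SK = inj₁ (∈-++⁺ʳ (inducedOn X SK) (inducedOn⁺ {X} {B} (∈-filter⁺ (¬? ∘ inSK?) e∈ ∉SK) inside))
          ... | yes ∈SK = norm-∈ᵖ {e} {inducedOn X SK ++ inducedOn X B}
                (∈-++⁺ˡ (inducedOn⁺ {X} {SK} ∈SK (Inside-SamePair (SamePair-sym (norm-same e)) inside)))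
          sub : ∀ {e} → e ∈ M → e ∈ᵖ (inducedOn X SK ++ inducedOn X B)
          sub e∈ with inducedOn⁻ X (E G ++ SK) (M⊆ e∈)
          ... | e∈ESK , inside with ∈-++⁻ (E G) e∈ESK
          ...   | inj₁ e∈E  = edge e∈E inside
          ...   | inj₂ e∈SK = inj₁ (∈-++⁺ˡ (inducedOn⁺ {X} {SK} e∈SK inside))
      b-≤ : sumOver b ≤ length B
      b-≤ = ℕₚ.≤-trans (ℕₚ.≤-reflexive (double-counting 𝒳 B)) (sum-≤ B once)
        where
          sum-≤ : ∀ L → (∀ {e} → e ∈ L → dCov 𝒳 e ≤ 1) → sum (map (dCov 𝒳) L) ≤ length L
          sum-≤ [] h = z≤n
          sum-≤ (e ∷ L) h = ℕₚ.+-mono-≤ (h (here refl)) (sum-≤ L (h ∘ there))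
          once : ∀ {e} → e ∈ B → dCov 𝒳 e ≤ 1
          once {e} e∈ with ∈-filter⁻ (¬? ∘ inSK?) {xs = E G} e∈
          ... | e∈E , ∉SK = unshared-once e∈E (λ ∈S → ∉SK (subst (_∈ SK) (norm-idem e) (dedupNorm⁺ (∈-++⁺ˡ ∈S))))

-- The split

Adj? : ∀ G u v → Dec (Adj G u v)
Adj? G u v = ((u , v) ∈ᵖ? E G) ⊎-dec ((v , u) ∈ᵖ? E G)

Adj-sym : ∀ G {u v} → Adj G u v → Adj G v u
Adj-sym G (inj₁ e∈) = inj₂ e∈
Adj-sym G (inj₂ e∈) = inj₁ e∈

Adj-SamePair : ∀ G {u v x y} → SamePair (u , v) (x , y) → Adj G u v → Adj G x y
Adj-SamePair G (inj₁ (refl , refl)) adj = adj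
Adj-SamePair G (inj₂ (refl , refl)) adj = Adj-sym G adj

Adj-left : ∀ G {u v} → Adj G u v → u ∈ V G
Adj-left G (inj₁ e∈) = proj₁ (E-vertices G e∈)
Adj-left G (inj₂ e∈) = proj₂ (E-vertices G e∈)

Adj-irrefl : ∀ G {u} → ¬ Adj G u u
Adj-irrefl G (inj₁ e∈) = E-loopless G e∈ refl
Adj-irrefl G (inj₂ e∈) = E-loopless G e∈ refl

module Split (G : Graph) (𝒳 : Cover) (a b : Vtx) (base : SafeBase G 𝒳 a b)
  (a₁ a₂ b₁ b₂ : Vtx) (Gs : Graph) (safe : SafeSplit G 𝒳 a b a₁ a₂ b₁ b₂ Gs) where

  open SafeBase base
  open SafeSplit safe
  open NonedgeSplit split
  open CoverProperties cover

  News : List Vtx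
  News = a₁ ∷ a₂ ∷ b₁ ∷ b₂ ∷ []

  a₁∈ : a₁ ∈ News
  a₁∈ = here refl
  a₂∈ : a₂ ∈ News
  a₂∈ = there (here refl)
  b₁∈ : b₁ ∈ News
  b₁∈ = there (there (here refl))
  b₂∈ : b₂ ∈ News
  b₂∈ = there (there (there (here refl)))

  new∉G : ∀ {w} → w ∈ News → w ∉ V G
  new∉G = All.lookup new-fresh

  a∈G : a ∈ V G
  a∈G = proj₁ ab-nonedge
  b∈G : b ∈ V G
  b∈G = proj₁ (proj₂ ab-nonedge)
  a≢b : a ≢ b
  a≢b = proj₁ (proj₂ (proj₂ ab-nonedge))
  ab-nonadjacent : ¬ Adj G a b
  ab-nonadjacent = proj₂ (proj₂ (proj₂ ab-nonedge))

  a≢new : ∀ {w} → w ∈ News → a ≢ w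
  a≢new w∈ refl = new∉G w∈ a∈G
  b≢new : ∀ {w} → w ∈ News → b ≢ w
  b≢new w∈ refl = new∉G w∈ b∈G

  a₁≢a₂ : a₁ ≢ a₂
  a₁≢a₂ = All.head (AllPairs.head new-unique)
  a₁≢b₁ : a₁ ≢ b₁
  a₁≢b₁ = All.head (All.tail (AllPairs.head new-unique))
  a₁≢b₂ : a₁ ≢ b₂
  a₁≢b₂ = All.head (All.tail (All.tail (AllPairs.head new-unique)))
  a₂≢b₁ : a₂ ≢ b₁
  a₂≢b₁ = All.head (AllPairs.head (AllPairs.tail new-unique))
  a₂≢b₂ : a₂ ≢ b₂
  a₂≢b₂ = All.head (All.tail (AllPairs.head (AllPairs.tail new-unique)))
  b₁≢b₂ : b₁ ≢ b₂
  b₁≢b₂ = All.head (AllPairs.head (AllPairs.tail (AllPairs.tail new-unique)))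

  Old : Vtx → Set
  Old w = (w ∈ V G) × (w ≢ a) × (w ≢ b)

  Old∉News : ∀ {w} → Old w → w ∉ News
  Old∉News (w∈G , _) w∈ = new∉G w∈ w∈G

  -- Undoes the split, and is the common left inverse of the relabellings of all clusters.
  merge : Vtx → Vtx
  merge w with w ℕ.≟ a₁ | w ℕ.≟ a₂ | w ℕ.≟ b₁ | w ℕ.≟ b₂
  ... | yes _ | _     | _     | _     = a
  ... | no _  | yes _ | _     | _     = a
  ... | no _  | no _  | yes _ | _     = b
  ... | no _  | no _  | no _  | yes _ = b
  ... | no _  | no _  | no _  | no _  = w

  merge-a₁ : merge a₁ ≡ a
  merge-a₁ with a₁ ℕ.≟ a₁
  ... | yes _ = refl
  ... | no ≢  = contradiction refl ≢

  merge-a₂ : merge a₂ ≡ a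
  merge-a₂ with a₂ ℕ.≟ a₁ | a₂ ℕ.≟ a₂
  ... | yes _ | _     = refl
  ... | no _  | yes _ = refl
  ... | no _  | no ≢  = contradiction refl ≢

  merge-b₁ : merge b₁ ≡ b
  merge-b₁ with b₁ ℕ.≟ a₁ | b₁ ℕ.≟ a₂ | b₁ ℕ.≟ b₁
  ... | yes eq | _      | _     = contradiction (sym eq) a₁≢b₁
  ... | no _   | yes eq | _     = contradiction (sym eq) a₂≢b₁
  ... | no _   | no _   | yes _ = refl
  ... | no _   | no _   | no ≢  = contradiction refl ≢

  merge-b₂ : merge b₂ ≡ b
  merge-b₂ with b₂ ℕ.≟ a₁ | b₂ ℕ.≟ a₂ | b₂ ℕ.≟ b₁ | b₂ ℕ.≟ b₂
  ... | yes eq | _      | _     | _     = contradiction (sym eq) a₁≢b₂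
  ... | no _   | yes eq | _     | _     = contradiction (sym eq) a₂≢b₂
  ... | no _   | no _   | yes _ | _     = refl
  ... | no _   | no _   | no _  | yes _ = refl
  ... | no _   | no _   | no _  | no ≢  = contradiction refl ≢

  merge-fixed : ∀ {w} → w ∉ News → merge w ≡ w
  merge-fixed {w} w∉ with w ℕ.≟ a₁ | w ℕ.≟ a₂ | w ℕ.≟ b₁ | w ℕ.≟ b₂
  ... | yes refl | _        | _        | _        = contradiction a₁∈ w∉
  ... | no _     | yes refl | _        | _        = contradiction a₂∈ w∉
  ... | no _     | no _     | yes refl | _        = contradiction b₁∈ w∉
  ... | no _     | no _     | no _     | yes refl = contradiction b₂∈ w∉
  ... | no _     | no _     | no _     | no _     = refl

  merge-G : ∀ {w} → w ∈ V G → merge w ≡ w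
  merge-G w∈ = merge-fixed (λ new → new∉G new w∈)

  -- Decidable counterpart of the membership of a new vertex in the split cluster. The vertices `a`
  -- and `b` are excluded because they leave the cluster.
  Touches : List Vtx → Vtx → Set
  Touches X s = Any (λ x → (x ≢ a) × (x ≢ b) × Adj Gs s x) X

  touches? : ∀ X s → Dec (Touches X s)
  touches? X s = any? (λ x → ¬? (x ℕ.≟ a) ×-dec (¬? (x ℕ.≟ b) ×-dec Adj? Gs s x)) X

  -- The default `c` stands for a vertex isolated in the cluster. If both copies touch the cluster,
  -- it is dissolved and handled edge by edge.
  pick : List Vtx → Vtx → Vtx → Vtx → Vtx
  pick X c c₁ c₂ with touches? X c₁ | touches? X c₂
  ... | yes _ | _     = c₁
  ... | no _  | yes _ = c₂
  ... | no _  | no _  = c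

  pick-first : ∀ X c c₁ c₂ → Touches X c₁ → pick X c c₁ c₂ ≡ c₁
  pick-first X c c₁ c₂ t with touches? X c₁
  ... | yes _ = refl
  ... | no ¬t = contradiction t ¬t

  pick-second : ∀ X c c₁ c₂ → Touches X c₂ → ¬ (Touches X c₁ × Touches X c₂) → pick X c c₁ c₂ ≡ c₂
  pick-second X c c₁ c₂ t ¬both with touches? X c₁ | touches? X c₂
  ... | yes t₁ | _     = contradiction (t₁ , t) ¬both
  ... | no _   | yes _ = refl
  ... | no _   | no ¬t = contradiction t ¬t

  pick-view : ∀ X c c₁ c₂ → (pick X c c₁ c₂ ≡ c) ⊎
    ((pick X c c₁ c₂ ≡ c₁) × Touches X c₁) ⊎ ((pick X c c₁ c₂ ≡ c₂) × Touches X c₂)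
  pick-view X c c₁ c₂ with touches? X c₁ | touches? X c₂
  ... | yes t | _     = inj₂ (inj₁ (refl , t))
  ... | no _  | yes t = inj₂ (inj₂ (refl , t))
  ... | no _  | no _  = inj₁ refl

  pick-cong : ∀ X Y c c₁ c₂ → Touches X c₁ ⇔ Touches Y c₁ → Touches X c₂ ⇔ Touches Y c₂ → pick X c c₁ c₂ ≡ pick Y c c₁ c₂
  pick-cong X Y c c₁ c₂ (f₁ , g₁) (f₂ , g₂) with touches? X c₁ | touches? X c₂ | touches? Y c₁ | touches? Y c₂
  ... | yes _ | _     | yes _ | _     = refl
  ... | yes t | _     | no ¬t | _     = contradiction (f₁ t) ¬t
  ... | no ¬t | _     | yes t | _     = contradiction (g₁ t) ¬t
  ... | no _  | yes _ | no _  | yes _ = refl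
  ... | no _  | yes t | no _  | no ¬t = contradiction (f₂ t) ¬t
  ... | no _  | no ¬t | no _  | yes t = contradiction (g₂ t) ¬t
  ... | no _  | no _  | no _  | no _  = refl

  -- The relabelling of a cluster under the split. A vertex a or b isolated in the cluster keeps its name,
  -- so that a and b themselves serve as fresh isolated vertices of the glued graph.
  relabel : List Vtx → Vtx → Vtx
  relabel X w with w ℕ.≟ a | w ℕ.≟ b
  ... | yes _ | _     = pick X a a₁ a₂
  ... | no _  | yes _ = pick X b b₁ b₂
  ... | no _  | no _  = w

  relabel-a : ∀ X → relabel X a ≡ pick X a a₁ a₂
  relabel-a X with a ℕ.≟ a
  ... | yes _ = refl
  ... | no ≢  = contradiction refl ≢

  relabel-b : ∀ X → relabel X b ≡ pick X b b₁ b₂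
  relabel-b X with b ℕ.≟ a | b ℕ.≟ b
  ... | yes eq | _     = contradiction (sym eq) a≢b
  ... | no _   | yes _ = refl
  ... | no _   | no ≢  = contradiction refl ≢

  relabel-other : ∀ X {w} → w ≢ a → w ≢ b → relabel X w ≡ w
  relabel-other X {w} w≢a w≢b with w ℕ.≟ a | w ℕ.≟ b
  ... | yes eq | _      = contradiction eq w≢a
  ... | no _   | yes eq = contradiction eq w≢b
  ... | no _   | no _   = refl

  merge-relabel : ∀ X {w} → w ∈ V G → merge (relabel X w) ≡ w
  merge-relabel X {w} w∈ with w ℕ.≟ a | w ℕ.≟ b
  ... | no _     | no _     = merge-G w∈
  ... | yes refl | _ with pick-view X a a₁ a₂
  ...   | inj₁ eq              = trans (cong merge eq) (merge-G w∈)
  ...   | inj₂ (inj₁ (eq , _)) = trans (cong merge eq) merge-a₁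
  ...   | inj₂ (inj₂ (eq , _)) = trans (cong merge eq) merge-a₂
  merge-relabel X {w} w∈ | no _ | yes refl with pick-view X b b₁ b₂
  ...   | inj₁ eq              = trans (cong merge eq) (merge-G w∈)
  ...   | inj₂ (inj₁ (eq , _)) = trans (cong merge eq) merge-b₁
  ...   | inj₂ (inj₂ (eq , _)) = trans (cong merge eq) merge-b₂

  -- The split tears such a cluster apart; by (S1) all its shared pairs are edges, so it can be
  -- replaced by its edges without changing the count.
  Dissolved : List Vtx → Set
  Dissolved X = (Touches X a₁ × Touches X a₂) ⊎ (Touches X b₁ × Touches X b₂)

  dissolved? : ∀ X → Dec (Dissolved X)
  dissolved? X = (touches? X a₁ ×-dec touches? X a₂) ⊎-dec (touches? X b₁ ×-dec touches? X b₂)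

  Touches⇒X' : ∀ i {s} → s ∈ News → Touches (cl 𝒳 i) s → X' i s
  Touches⇒X' i s∈ t with find t
  ... | x , x∈ , x≢a , x≢b , adj = inj₂ (s∈ , x , x∈ , x≢a , x≢b , adj)

  cl∌new : ∀ i {s} → s ∈ News → s ∉ cl 𝒳 i
  cl∌new i s∈ s∈X = new∉G s∈ (proj₁ (Inside⇒∈V i (s∈X , s∈X)))

  X'⇒Touches : ∀ i {s} → s ∈ News → X' i s → Touches (cl 𝒳 i) s
  X'⇒Touches i s∈ (inj₁ (s∈X , _)) = contradiction s∈X (cl∌new i s∈)
  X'⇒Touches i s∈ (inj₂ (_ , x , x∈ , x≢a , x≢b , adj)) = lose x∈ (x≢a , x≢b , adj)

  Gs-vertex : ∀ {w} → w ∈ V Gs → Old w ⊎ (w ∈ News)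
  Gs-vertex w∈ = proj₁ (vertices _) w∈

  -- As (a,b) is a nonedge, no neighbour of `a` or `b` is itself split; every edge of `Gs` therefore
  -- has at most one new endpoint.
  new-adj : ∀ {w x} → w ∈ News → Adj Gs w x → Adj G (merge w) x × Old x
  new-adj w∈ adj = go w∈ adj
    where
      a-neighbour : ∀ {x} → Adj G a x → Old x
      a-neighbour adj = Adj-left G (Adj-sym G adj) ,
          (λ { refl → Adj-irrefl G adj }) , λ { refl → ab-nonadjacent adj }
      b-neighbour : ∀ {x} → Adj G b x → Old x
      b-neighbour adj = Adj-left G (Adj-sym G adj) , (λ { refl → ab-nonadjacent
          (Adj-sym G adj) }) , λ { refl → Adj-irrefl G adj }
      go : ∀ {w x} → w ∈ News → Adj Gs w x → Adj G (merge w) x × Old x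
      go {x = x} (here refl) adj = subst (λ c → Adj G c x) (sym merge-a₁) (a₁-sub x adj) , a-neighbour
          (a₁-sub x adj)
      go {x = x} (there (here refl)) adj = subst (λ c → Adj G c x) (sym merge-a₂) (a₂-sub x adj) , a-neighbour
          (a₂-sub x adj)
      go {x = x} (there (there (here refl))) adj = subst (λ c → Adj G c x) (sym merge-b₁)
          (b₁-sub x adj) , b-neighbour (b₁-sub x adj)
      go {x = x} (there (there (there (here refl)))) adj = subst (λ c → Adj G c x) (sym merge-b₂)
          (b₂-sub x adj) , b-neighbour (b₂-sub x adj)

  old-adj : ∀ {x y} → Old x → Old y → Adj Gs x y ⇔ Adj G x y
  old-adj {x} {y} ox oy = old-edges x y (proj₂ (vertices x) (inj₁ ox)) (proj₂ (vertices y) (inj₁ oy))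
      (Old∉News ox) (Old∉News oy)

  merge-adj : ∀ {x y} → Adj Gs x y → Adj G (merge x) (merge y)
  merge-adj {x} {y} adj with Gs-vertex (Adj-left Gs adj) | Gs-vertex (Adj-left Gs (Adj-sym Gs adj))
  ... | inj₂ x∈ | _ = subst (Adj G (merge x)) (sym (merge-G (proj₁ (proj₂ (new-adj x∈ adj))))) (proj₁
      (new-adj x∈ adj))
  ... | inj₁ ox | inj₂ y∈ = subst (λ c → Adj G c (merge y)) (sym (merge-G (proj₁ ox)))
          (Adj-sym G (proj₁ (new-adj y∈ (Adj-sym Gs adj))))
  ... | inj₁ ox | inj₁ oy = subst₂ (Adj G) (sym (merge-G (proj₁ ox))) (sym (merge-G (proj₁ oy))) (proj₁
      (old-adj ox oy) adj)

  touching : ∀ {X w y} → w ∈ News → Adj Gs w y → merge y ∈ X → Touches X w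
  touching {X} w∈ adj y∈ with new-adj w∈ adj
  ... | _ , oy@(y∈G , y≢a , y≢b) = lose (subst (_∈ X) (merge-G y∈G) y∈) (y≢a , y≢b , adj)

  -- An edge at a copy makes that copy touch the cluster. In an intact cluster the other copy does
  -- not touch it, so `pick` returns the right one.
  relabel-merge : ∀ {X x y} → ¬ Dissolved X → Adj Gs x y → merge y ∈ X → relabel X (merge x) ≡ x
  relabel-merge {X} ¬dis adj y∈ with Gs-vertex (Adj-left Gs adj)
  ... | inj₁ (x∈G , x≢a , x≢b) = trans (cong (relabel X) (merge-G x∈G)) (relabel-other X x≢a x≢b)
  ... | inj₂ (here refl) = trans (cong (relabel X) merge-a₁) (trans (relabel-a X) (pick-first X a a₁ a₂
      (touching a₁∈ adj y∈)))
  ... | inj₂ (there (here refl)) = trans (cong (relabel X) merge-a₂) (trans (relabel-a X)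
          (pick-second X a a₁ a₂ (touching a₂∈ adj y∈) (¬dis ∘ inj₁)))
  ... | inj₂ (there (there (here refl))) = trans (cong (relabel X) merge-b₁) (trans (relabel-b X)
      (pick-first X b b₁ b₂ (touching b₁∈ adj y∈)))
  ... | inj₂ (there (there (there (here refl)))) = trans (cong (relabel X) merge-b₂) (trans (relabel-b X)
          (pick-second X b b₁ b₂ (touching b₂∈ adj y∈) (¬dis ∘ inj₂)))

  -- Edgewise counterpart of `relabel`: the copy is decided by the other endpoint instead of by a
  -- cluster, so it makes sense in dissolved clusters too. The second copy is the default.
  splitEnd : Vtx → Vtx → Vtx
  splitEnd u v with u ℕ.≟ a | u ℕ.≟ b | Adj? Gs a₁ v | Adj? Gs b₁ v
  ... | yes _ | _     | yes _ | _     = a₁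
  ... | yes _ | _     | no _  | _     = a₂
  ... | no _  | yes _ | _     | yes _ = b₁
  ... | no _  | yes _ | _     | no _  = b₂
  ... | no _  | no _  | _     | _     = u

  splitPair : Pair → Pair
  splitPair (u , v) = splitEnd u v , splitEnd v u

  splitEnd-other : ∀ {u} v → u ≢ a → u ≢ b → splitEnd u v ≡ u
  splitEnd-other {u} v u≢a u≢b with u ℕ.≟ a | u ℕ.≟ b
  ... | yes eq | _      = contradiction eq u≢a
  ... | no _   | yes eq = contradiction eq u≢b
  ... | no _   | no _   = refl

  splitEnd-a₁ : ∀ {v} → Adj Gs a₁ v → splitEnd a v ≡ a₁
  splitEnd-a₁ {v} adj with a ℕ.≟ a | Adj? Gs a₁ v
  ... | yes _ | yes _   = refl
  ... | yes _ | no ¬adj = contradiction adj ¬adj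
  ... | no ≢  | _       = contradiction refl ≢

  splitEnd-a₂ : ∀ {v} → ¬ Adj Gs a₁ v → splitEnd a v ≡ a₂
  splitEnd-a₂ {v} ¬adj with a ℕ.≟ a | Adj? Gs a₁ v
  ... | yes _ | yes adj = contradiction adj ¬adj
  ... | yes _ | no _    = refl
  ... | no ≢  | _       = contradiction refl ≢

  splitEnd-b₁ : ∀ {v} → Adj Gs b₁ v → splitEnd b v ≡ b₁
  splitEnd-b₁ {v} adj with b ℕ.≟ a | b ℕ.≟ b | Adj? Gs b₁ v
  ... | yes eq | _     | _       = contradiction (sym eq) a≢b
  ... | no _   | no ≢  | _       = contradiction refl ≢
  ... | no _   | yes _ | yes _   = refl
  ... | no _   | yes _ | no ¬adj = contradiction adj ¬adj

  splitEnd-b₂ : ∀ {v} → ¬ Adj Gs b₁ v → splitEnd b v ≡ b₂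
  splitEnd-b₂ {v} ¬adj with b ℕ.≟ a | b ℕ.≟ b | Adj? Gs b₁ v
  ... | yes eq | _     | _       = contradiction (sym eq) a≢b
  ... | no _   | no ≢  | _       = contradiction refl ≢
  ... | no _   | yes _ | yes adj = contradiction adj ¬adj
  ... | no _   | yes _ | no _    = refl

  a-exclusive : ∀ {x} → Adj Gs a₂ x → ¬ Adj Gs a₁ x
  a-exclusive {x} adj₂ adj₁ with a-part x (a₁-sub x adj₁)
  ... | inj₁ (_ , ¬adj₂) = ¬adj₂ adj₂
  ... | inj₂ (_ , ¬adj₁) = ¬adj₁ adj₁

  b-exclusive : ∀ {x} → Adj Gs b₂ x → ¬ Adj Gs b₁ x
  b-exclusive {x} adj₂ adj₁ with b-part x (b₁-sub x adj₁)
  ... | inj₁ (_ , ¬adj₂) = ¬adj₂ adj₂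
  ... | inj₂ (_ , ¬adj₁) = ¬adj₁ adj₁

  splitEnd-merge : ∀ {x y} → Adj Gs x y → splitEnd (merge x) (merge y) ≡ x
  splitEnd-merge {x} {y} adj with Gs-vertex (Adj-left Gs adj)
  ... | inj₁ (x∈G , x≢a , x≢b) = trans (cong (λ c → splitEnd c (merge y)) (merge-G x∈G)) (splitEnd-other
      (merge y) x≢a x≢b)
  ... | inj₂ x∈ = trans (cong (splitEnd (merge x)) (merge-G (proj₁ (proj₂ (new-adj x∈ adj))))) (go x∈ adj)
    where
      go : ∀ {x} → x ∈ News → Adj Gs x y → splitEnd (merge x) y ≡ x
      go (here refl) adj = trans (cong (λ c → splitEnd c y) merge-a₁) (splitEnd-a₁ adj)
      go (there (here refl)) adj = trans (cong (λ c → splitEnd c y) merge-a₂) (splitEnd-a₂ (a-exclusive adj))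
      go (there (there (here refl))) adj = trans (cong (λ c → splitEnd c y) merge-b₁) (splitEnd-b₁ adj)
      go (there (there (there (here refl)))) adj = trans (cong (λ c → splitEnd c y) merge-b₂) (splitEnd-b₂
          (b-exclusive adj))

  lift : ∀ {u v} → Adj G u v → ∃[ x ] ∃[ y ] Adj Gs x y × (merge x ≡ u) × (merge y ≡ v)
  lift {u} {v} adj with u ℕ.≟ a | u ℕ.≟ b | v ℕ.≟ a | v ℕ.≟ b
  ... | yes refl | _ | _ | _ = lift-a (a-part v adj)
    where
      lift-a : _ → _
      lift-a (inj₁ (adj₁ , _)) = a₁ , v , adj₁ , merge-a₁ , merge-G (Adj-left G (Adj-sym G adj))
      lift-a (inj₂ (adj₂ , _)) = a₂ , v , adj₂ , merge-a₂ , merge-G (Adj-left G (Adj-sym G adj))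
  ... | no _ | yes refl | _ | _ = lift-b (b-part v adj)
    where
      lift-b : _ → _
      lift-b (inj₁ (adj₁ , _)) = b₁ , v , adj₁ , merge-b₁ , merge-G (Adj-left G (Adj-sym G adj))
      lift-b (inj₂ (adj₂ , _)) = b₂ , v , adj₂ , merge-b₂ , merge-G (Adj-left G (Adj-sym G adj))
  ... | no _ | no _ | yes refl | _ = lift-a (a-part u (Adj-sym G adj))
    where
      lift-a : _ → _
      lift-a (inj₁ (adj₁ , _)) = u , a₁ , Adj-sym Gs adj₁ , merge-G (Adj-left G adj) , merge-a₁
      lift-a (inj₂ (adj₂ , _)) = u , a₂ , Adj-sym Gs adj₂ , merge-G (Adj-left G adj) , merge-a₂
  ... | no _ | no _ | no _ | yes refl = lift-b (b-part u (Adj-sym G adj))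
    where
      lift-b : _ → _
      lift-b (inj₁ (adj₁ , _)) = u , b₁ , Adj-sym Gs adj₁ , merge-G (Adj-left G adj) , merge-b₁
      lift-b (inj₂ (adj₂ , _)) = u , b₂ , Adj-sym Gs adj₂ , merge-G (Adj-left G adj) , merge-b₂
  ... | no u≢a | no u≢b | no v≢a | no v≢b = u , v ,
    proj₂ (old-adj (Adj-left G adj , u≢a , u≢b) (Adj-left G (Adj-sym G adj) , v≢a , v≢b)) adj ,
    merge-G (Adj-left G adj) , merge-G (Adj-left G (Adj-sym G adj))

  splitPair-adj : ∀ {u v} → Adj G u v → Adj Gs (splitEnd u v) (splitEnd v u)
  splitPair-adj adj with lift adj
  ... | x , y , adjs , refl , refl = subst₂ (Adj Gs) (sym (splitEnd-merge adjs)) (sym (splitEnd-merge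
      (Adj-sym Gs adjs))) adjs

  merge-splitEnd : ∀ {u v} → Adj G u v → merge (splitEnd u v) ≡ u
  merge-splitEnd adj with lift adj
  ... | x , y , adjs , refl , refl = cong merge (splitEnd-merge adjs)

  -- Both sides recover the edge of `Gs` lying over `(u , v)`; the image of a shared edge is thus
  -- the same in all intact clusters.
  splitPair-relabel : ∀ X {u v} → ¬ Dissolved X → Adj G u v → Inside X (u , v) → splitPair (u , v) ≡ mapPair
      (relabel X) (u , v)
  splitPair-relabel X ¬dis adj (u∈ , v∈) with lift adj
  ... | x , y , adjs , refl , refl = cong₂ _,_
    (trans (splitEnd-merge adjs) (sym (relabel-merge ¬dis adjs v∈)))
    (trans (splitEnd-merge (Adj-sym Gs adjs)) (sym (relabel-merge ¬dis (Adj-sym Gs adjs) u∈)))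

  splitPair-swap : ∀ {e f} → SamePair e f → SamePair (splitPair e) (splitPair f)
  splitPair-swap (inj₁ (refl , refl)) = inj₁ (refl , refl)
  splitPair-swap (inj₂ (refl , refl)) = inj₂ (refl , refl)

  -- Only `u = a` and `u = b` matter. If `u` is `a`, then by thinness {a,v} is the whole
  -- intersection and `v` is not `b`, so (S2) makes the same copies touch both clusters.
  relabel-consistent : ∀ i j {u v} → u ≢ v → norm (u , v) ≢ norm (a , b) → ¬ Adj G u v →
    Inside (cl 𝒳 i) (u , v) → Inside (cl 𝒳 j) (u , v) → relabel (cl 𝒳 i) u ≡ relabel (cl 𝒳 j) u
  relabel-consistent i j {u} {v} u≢v ≢ab ¬adj in-i in-j with i Finₚ.≟ j
  ... | yes refl = refl
  ... | no i≢j with u ℕ.≟ a | u ℕ.≟ b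
  ...   | no _     | no _     = refl
  ...   | yes refl | _ = pick-cong (cl 𝒳 i) (cl 𝒳 j) a a₁ a₂ (transfer a₁∈ (proj₁ same)) (transfer a₂∈ (proj₂ same))
    where
      transfer : ∀ {s} → s ∈ News → X' i s ⇔ X' j s → Touches (cl 𝒳 i) s ⇔ Touches (cl 𝒳 j) s
      transfer s∈ (f , g) = (X'⇒Touches j s∈ ∘ f ∘ Touches⇒X' i s∈) , (X'⇒Touches i s∈ ∘ g ∘ Touches⇒X' j s∈)
      same : (X' i a₁ ⇔ X' j a₁) × (X' i a₂ ⇔ X' j a₂)
      same = S2a i j v i≢j (u≢v ∘ sym) (λ { refl → ≢ab refl }) ¬adj
        (λ w → (λ { (w∈i , w∈j) → common-vertices i j i≢j u≢v in-i in-j w∈i w∈j }) ,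
               λ { (inj₁ refl) → proj₁ in-i , proj₁ in-j ; (inj₂ refl) → proj₂ in-i , proj₂ in-j })
  ...   | no _ | yes refl = pick-cong (cl 𝒳 i) (cl 𝒳 j) b b₁ b₂ (transfer b₁∈ (proj₁ same)) (transfer b₂∈
      (proj₂ same))
    where
      transfer : ∀ {s} → s ∈ News → X' i s ⇔ X' j s → Touches (cl 𝒳 i) s ⇔ Touches (cl 𝒳 j) s
      transfer s∈ (f , g) = (X'⇒Touches j s∈ ∘ f ∘ Touches⇒X' i s∈) , (X'⇒Touches i s∈ ∘ g ∘ Touches⇒X' j s∈)
      same : (X' i b₁ ⇔ X' j b₁) × (X' i b₂ ⇔ X' j b₂)
      same = S2b i j v i≢j (u≢v ∘ sym) (λ { refl → ≢ab (norm-cong (inj₂ (refl , refl))) }) ¬adj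
        (λ w → (λ { (w∈i , w∈j) → common-vertices i j i≢j u≢v in-i in-j w∈i w∈j }) ,
               λ { (inj₁ refl) → proj₁ in-i , proj₁ in-j ; (inj₂ refl) → proj₂ in-i , proj₂ in-j })

  -- Key pairs and cluster bases

  Key : Vtx → Vtx → Set₁
  Key = KeyPairGs Gs 𝒳 a b a₁ a₂ b₁ b₂

  -- A neighbour of `s` in the cluster is a third vertex besides `s` and `t`, so the split cluster
  -- is large enough to be kept.
  intact-kept : ∀ i {s t} → ¬ Dissolved (cl 𝒳 i) → s ∈ News → t ∈ News → s ≢ t →
    Touches (cl 𝒳 i) s → Touches (cl 𝒳 i) t → Key s t
  intact-kept i {s} {t} ¬dis s∈ t∈ s≢t ts tt = s∈ , t∈ , s≢t , X' i ,
    inj₁ (i , (third (find ts) , ¬both-a , ¬both-b) , λ w → (λ z → z) , (λ z → z)) ,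
    Touches⇒X' i s∈ ts , Touches⇒X' i t∈ tt
    where
      ¬both-a : ¬ (X' i a₁ × X' i a₂)
      ¬both-a (p , q) = ¬dis (inj₁ (X'⇒Touches i a₁∈ p , X'⇒Touches i a₂∈ q))
      ¬both-b : ¬ (X' i b₁ × X' i b₂)
      ¬both-b (p , q) = ¬dis (inj₂ (X'⇒Touches i b₁∈ p , X'⇒Touches i b₂∈ q))
      third : (∃[ x ] (x ∈ cl 𝒳 i) × (x ≢ a) × (x ≢ b) × Adj Gs s x) →
        ∃[ x ] ∃[ y ] ∃[ z ] X' i x × X' i y × X' i z × x ≢ y × x ≢ z × y ≢ z
      third (x , x∈ , x≢a , x≢b , _) = s , t , x , Touches⇒X' i s∈ ts , Touches⇒X' i t∈ tt , inj₁ (x∈ , x≢a , x≢b) ,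
        s≢t , (λ { refl → cl∌new i s∈ x∈ }) , λ { refl → cl∌new i t∈ x∈ }

  S : List Pair
  S = sharedAnd 𝒳 []

  S⇒shared : ∀ {e} → e ∈ S → e ∈ shared 𝒳
  S⇒shared e∈ with dedupNorm⁻ _ e∈
  ... | f , f∈ , refl with ∈-++⁻ (shared 𝒳) f∈
  ...   | inj₁ f∈S = subst (_∈ shared 𝒳) (sym (proj₁ (shared⁻ f∈S))) f∈S

  shared⇒S : ∀ {e} → e ∈ shared 𝒳 → e ∈ S
  shared⇒S e∈ = subst (_∈ S) (proj₁ (shared⁻ e∈)) (dedupNorm⁺ (∈-++⁺ˡ e∈))

  Sᵢ : Fin (length 𝒳) → List Pair
  Sᵢ i = inducedOn (cl 𝒳 i) S

  Lᵢ : Fin (length 𝒳) → List Pair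
  Lᵢ i = inducedOn (cl 𝒳 i) (E G ++ S)

  Sᵢ-indep : ∀ i → Indep (Sᵢ i)
  Sᵢ-indep i = Indep-⊆ᵖ {Sᵢ i} {shared 𝒳} (inducedOn-UniquePairs (cl 𝒳 i) {S} (dedupNorm-UniquePairs _))
    (λ e∈ → inj₁ (S⇒shared (proj₁ (inducedOn⁻ (cl 𝒳 i) S e∈)))) indepCov

  dissolved-edges : ∀ i → Dissolved (cl 𝒳 i) → ∀ {e} → e ∈ Sᵢ i → Adj G (proj₁ e) (proj₂ e)
  dissolved-edges i dis {u , v} e∈ with Adj? G u v
  ... | yes adj = adj
  ... | no ¬adj = ⊥-elim (excluded dis)
    where
      witness : ∃[ u ] ∃[ v ] ((u , v) ∈ shared 𝒳) × (u ∈ cl 𝒳 i) × (v ∈ cl 𝒳 i) × ¬ Adj G u v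
      witness = u , v , S⇒shared (proj₁ (inducedOn⁻ (cl 𝒳 i) S e∈)) ,
        proj₁ (proj₂ (inducedOn⁻ (cl 𝒳 i) S e∈)) , proj₂ (proj₂ (inducedOn⁻ (cl 𝒳 i) S e∈)) , ¬adj
      excluded : ¬ Dissolved (cl 𝒳 i)
      excluded (inj₁ (t₁ , t₂)) = proj₁ (S1 i witness) (Touches⇒X' i a₁∈ t₁ , Touches⇒X' i a₂∈ t₂)
      excluded (inj₂ (t₁ , t₂)) = proj₂ (S1 i witness) (Touches⇒X' i b₁∈ t₁ , Touches⇒X' i b₂∈ t₂)

  inS? : Decidable (λ e → norm e ∈ S)
  inS? e = norm e ∈ᵖ? S

  privateEdges : Fin (length 𝒳) → List Pair
  privateEdges i = filter (¬? ∘ inS?) (inducedOn (cl 𝒳 i) (E G))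

  -- Two certificates of the same count: besides the shared pairs, at most `r - |Sᵢ|` further pairs
  -- are spent on the cluster. For a dissolved cluster these are its unshared edges.
  data Basis (i : Fin (length 𝒳)) (r : ℕ) : Set where
    intact : ¬ Dissolved (cl 𝒳 i) → (D : List Pair) → D ⊆ Lᵢ i → Indep (D ++ Sᵢ i) → Spanning D (Sᵢ i) (Lᵢ i) →
      length D + length (Sᵢ i) ≤ r → Basis i r
    dissolved : Dissolved (cl 𝒳 i) → length (privateEdges i) + length (Sᵢ i) ≤ r → Basis i r

  basis : ∀ i {r} → HasRank (Lᵢ i) r → Basis i r
  basis i {r} rank with dissolved? (cl 𝒳 i)
  ... | no ¬dis = build (HasRank-extension {Lᵢ i} (Sᵢ i) rank (inducedOn-mono {cl 𝒳 i} {S} {E G ++ S} (∈-++⁺ʳ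
      (E G))) (Sᵢ-indep i))
    where
      build : _ → Basis i r
      build (D , D⊆ , indep , spans , len) = intact ¬dis D D⊆ indep spans len
  -- By (S1) all shared pairs here are edges, so together with the private edges they are counted
  -- inside `EX`, which is independent as a part of `G`.
  ... | yes dis = dissolved dis (begin
      length (privateEdges i) + length (Sᵢ i)  ≤⟨ ℕₚ.+-monoʳ-≤ (length (privateEdges i))
                                                   (UniquePairs-length-≤ {Sᵢ i} {filter inS? EX}
                                                       (inducedOn-UniquePairs X {S}
                                                       (dedupNorm-UniquePairs _)) sub) ⟩
      length (privateEdges i) + length (filter inS? EX) ≡⟨ ℕₚ.+-comm (length (privateEdges i)) _ ⟩
      length (filter inS? EX) + length (privateEdges i) ≡⟨ sym (length-filter-∁ inS? EX) ⟩
      length EX ≤⟨ proj₂ rank EX (inducedOn-mono {X} {E G} {E G ++ S} ∈-++⁺ˡ)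
                     (Indep-⊆ᵖ {EX} {E G} (inducedOn-UniquePairs X {E G} (E-simple G))
                         (inj₁ ∘ proj₁ ∘ inducedOn⁻ X (E G)) indepG) ⟩
      r ∎)
    where
      open ℕₚ.≤-Reasoning
      X EX : List _
      X = cl 𝒳 i
      EX = inducedOn X (E G)
      sub : ∀ {e} → e ∈ Sᵢ i → e ∈ᵖ filter inS? EX
      sub {e} e∈ with inducedOn⁻ X S e∈ | dissolved-edges i dis e∈
      ... | e∈S , inside | inj₁ e∈E = inj₁ (∈-filter⁺ inS? (inducedOn⁺ {X} {E G} e∈E inside)
              (subst (_∈ S) (sym (dedupNorm-normal (shared 𝒳 ++ []) e∈S)) e∈S))
      ... | e∈S , inside | inj₂ e∈E = inj₂ (∈-filter⁺ inS? (inducedOn⁺ {X} {E G} e∈E (swap inside))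
              (subst (_∈ S) (sym (trans (norm-cong (inj₂ (refl , refl))) (dedupNorm-normal
                  (shared 𝒳 ++ []) e∈S))) e∈S))

  images : ∀ {i r} → Basis i r → List Pair
  images {i} (intact _ D _ _ _ _) = map (mapPair (relabel (cl 𝒳 i))) D
  images {i} (dissolved _ _)      = map splitPair (privateEdges i)

  images-length : ∀ {i r} (B : Basis i r) → length (images B) + length (Sᵢ i) ≤ r
  images-length {i} (intact _ D _ _ _ len) = subst (λ k → k + length (Sᵢ i) ≤ _) (sym (Listₚ.length-map _ D)) len
  images-length {i} (dissolved _ len) = subst (λ k → k + length (Sᵢ i) ≤ _) (sym (Listₚ.length-map _
      (privateEdges i))) len

  family : ∀ {i r} → Basis i r → Family
  family {i} (intact _ D _ _ _ _) = rowsFamily (relabel (cl 𝒳 i)) (D ++ Sᵢ i)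
  -- A dissolved cluster asks for no genericity, since the images of its edges belong to `W`
  -- themselves.
  family     (dissolved _ _)      = rowsFamily (λ v → v) []

  Lᵢ-retracts : ∀ i {e} → e ∈ Lᵢ i → Retracts (relabel (cl 𝒳 i)) merge e
  Lᵢ-retracts i e∈ with Inside⇒∈V i (proj₂ (inducedOn⁻ (cl 𝒳 i) (E G ++ S) e∈))
  ... | u∈ , v∈ = merge-relabel (cl 𝒳 i) u∈ , merge-relabel (cl 𝒳 i) v∈

  basis-⊆ : ∀ i {D} → D ⊆ Lᵢ i → D ++ Sᵢ i ⊆ Lᵢ i
  basis-⊆ i {D} D⊆ e∈ with ∈-++⁻ D e∈
  ... | inj₁ e∈D = D⊆ e∈D
  ... | inj₂ e∈S = inducedOn-mono {cl 𝒳 i} {S} {E G ++ S} (∈-++⁺ʳ (E G)) e∈S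

  family-good : ∀ {i r} (B : Basis i r) → ∃[ p ] Family.Good (family B) p
  family-good {i} (intact _ D D⊆ (q , ind) _ _) = q ∘ merge ,
    Ind-retract q (relabel (cl 𝒳 i)) merge (D ++ Sᵢ i) (Lᵢ-retracts i ∘ basis-⊆ i D⊆) (RowsIndependent⇒Ind q
        (D ++ Sᵢ i) ind)
  family-good (dissolved _ _) = (λ _ _ → 0ℚ) , λ c rel ()

  -- By (S2), the image of a shared pair other than {a,b} does not depend on the cluster containing it.
  sharedImage : Pair → Pair
  sharedImage e with Adj? G (proj₁ e) (proj₂ e) | Finₚ.any? (λ i → inside? (cl 𝒳 i) e)
  ... | yes _ | _           = splitPair e
  ... | no _  | yes (i , _) = mapPair (relabel (cl 𝒳 i)) e
  ... | no _  | no _        = e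

  sharedImage-edge : ∀ {u v} → Adj G u v → sharedImage (u , v) ≡ splitPair (u , v)
  sharedImage-edge {u} {v} adj with Adj? G u v
  ... | yes _   = refl
  ... | no ¬adj = contradiction adj ¬adj

  sharedImage-relabel : ∀ i {e} → ¬ Dissolved (cl 𝒳 i) → e ∈ Sᵢ i → e ≢ norm (a , b) →
    sharedImage e ≡ mapPair (relabel (cl 𝒳 i)) e
  sharedImage-relabel i {e@(u , v)} ¬dis e∈ e≢ab with Adj? G u v | Finₚ.any? (λ i → inside? (cl 𝒳 i) (u , v))
  ... | yes adj | _ = splitPair-relabel (cl 𝒳 i) ¬dis adj (proj₂ (inducedOn⁻ (cl 𝒳 i) S e∈))
  ... | no ¬adj | no none = contradiction (i , proj₂ (inducedOn⁻ (cl 𝒳 i) S e∈)) none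
  ... | no ¬adj | yes (j , in-j) = cong₂ _,_
    (relabel-consistent j i u≢v ≢ab ¬adj in-j in-i)
    (relabel-consistent j i (u≢v ∘ sym) (≢ab ∘ trans (norm-cong (inj₂ (refl , refl)))) (¬adj ∘ Adj-sym G)
        (swap in-j) (swap in-i))
    where
      e∈S : e ∈ S
      e∈S = proj₁ (inducedOn⁻ (cl 𝒳 i) S e∈)
      in-i : Inside (cl 𝒳 i) e
      in-i = proj₂ (inducedOn⁻ (cl 𝒳 i) S e∈)
      u≢v : u ≢ v
      u≢v = proj₁ (proj₂ (shared⁻ (S⇒shared e∈S)))
      ≢ab : norm (u , v) ≢ norm (a , b)
      ≢ab eq = e≢ab (trans (sym (proj₁ (shared⁻ (S⇒shared e∈S)))) eq)

  notab? : Decidable (λ e → e ≢ norm (a , b))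
  notab? e = ¬? (e ≟ᵖ norm (a , b))

  sharedImages : List Pair
  sharedImages = map sharedImage (filter notab? S)

  -- The dropped pair is {a,b}, a member of `S`. This is the unit that offsets the `suc` in (E3).
  sharedImages-length : suc (length sharedImages) ≤ length S
  sharedImages-length = subst (λ k → suc k ≤ length S) (sym (Listₚ.length-map sharedImage (filter notab? S)))
    (Listₚ.filter-notAll notab? S (lose (shared⇒S ab-shared) (λ ≢ → ≢ refl)))

  sharedImage∈ : ∀ {e} → e ∈ S → e ≢ norm (a , b) → sharedImage e ∈ sharedImages
  sharedImage∈ e∈ e≢ = ∈-map⁺ sharedImage (∈-filter⁺ notab? e∈ e≢)

  -- If `a` or `b` is isolated in a cluster, {a,b} goes to one of (a,b), (a,b₁), (a,b₂), (a₁,b),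
  -- (a₂,b). The two stars contain these five pairs; (a,a₁) completes the star at `a` to degree
  -- three.
  fresh : List Pair
  fresh = star b a a₁ a₂ ++ star a a₁ b₁ b₂

  -- The span of the split graph

  module Spans (p : Placement) (W : List Pair) (fresh⊆ : fresh ⊆ W) (shared⊆ : sharedImages ⊆ W)
    (key∈ : ∀ {s t} → Key s t → InSpan (rows p W) (row p (s , t))) where

    -- If both ends go to copies, these touch the same intact cluster and form a key pair; in the
    -- five other cases the image is a fresh edge.
    ab-image : ∀ i → ¬ Dissolved (cl 𝒳 i) → InSpan (rows p W) (row p (relabel (cl 𝒳 i) a , relabel (cl 𝒳 i) b))
    ab-image i ¬dis = subst₂ (λ s t → InSpan (rows p W) (row p (s , t))) (sym (relabel-a X)) (sym (relabel-b X))
      (cases (pick-view X a a₁ a₂) (pick-view X b b₁ b₂))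
      where
        X : List Vtx
        X = cl 𝒳 i
        inSpan : ∀ {e} → e ∈ᵖ W → InSpan (rows p W) (row p e)
        inSpan {e} = ∈ᵖ⇒InSpan p {e} {W}
        Goal : Vtx → Vtx → Set
        Goal s t = InSpan (rows p W) (row p (s , t))
        View : Vtx → Vtx → Vtx → Vtx → Set
        View s c c₁ c₂ = (s ≡ c) ⊎ ((s ≡ c₁) × Touches X c₁) ⊎ ((s ≡ c₂) × Touches X c₂)
        cases : ∀ {s t} → View s a a₁ a₂ → View t b b₁ b₂ → Goal s t
        cases (inj₁ refl) (inj₁ refl) = inSpan (inj₂ (fresh⊆ (here refl)))
        cases (inj₁ refl) (inj₂ (inj₁ (refl , _))) = inSpan (inj₁ (fresh⊆ (there (there (there (there
            (here refl)))))))
        cases (inj₁ refl) (inj₂ (inj₂ (refl , _))) = inSpan (inj₁ (fresh⊆ (there (there (there (there (there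
            (here refl))))))))
        cases (inj₂ (inj₁ (refl , _))) (inj₁ refl) = inSpan (inj₂ (fresh⊆ (there (here refl))))
        cases (inj₂ (inj₂ (refl , _))) (inj₁ refl) = inSpan (inj₂ (fresh⊆ (there (there (here refl)))))
        cases (inj₂ (inj₁ (refl , t))) (inj₂ (inj₁ (refl , t′))) = key∈ (intact-kept i ¬dis a₁∈ b₁∈ a₁≢b₁ t t′)
        cases (inj₂ (inj₁ (refl , t))) (inj₂ (inj₂ (refl , t′))) = key∈ (intact-kept i ¬dis a₁∈ b₂∈ a₁≢b₂ t t′)
        cases (inj₂ (inj₂ (refl , t))) (inj₂ (inj₁ (refl , t′))) = key∈ (intact-kept i ¬dis a₂∈ b₁∈ a₂≢b₁ t t′)
        cases (inj₂ (inj₂ (refl , t))) (inj₂ (inj₂ (refl , t′))) = key∈ (intact-kept i ¬dis a₂∈ b₂∈ a₂≢b₂ t t′)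

    InSpan-SamePair : ∀ {e f} → SamePair e f → InSpan (rows p W) (row p e) → InSpan (rows p W) (row p f)
    InSpan-SamePair same (c , eq) = c , λ x → trans (row-SamePair p (SamePair-sym same) x) (eq x)

    shared-image : ∀ i → ¬ Dissolved (cl 𝒳 i) → ∀ {e} → e ∈ Sᵢ i → InSpan (rows p W) (row p (mapPair (relabel
        (cl 𝒳 i)) e))
    shared-image i ¬dis {e} e∈ with e ≟ᵖ norm (a , b)
    ... | yes refl = InSpan-SamePair (mapPair-SamePair (relabel (cl 𝒳 i)) (SamePair-sym (norm-same (a , b))))
        (ab-image i ¬dis)
    ... | no e≢ab = ∈ᵖ⇒InSpan p {mapPair (relabel (cl 𝒳 i)) e} {W} (inj₁ (subst (_∈ W)
        (sharedImage-relabel i ¬dis e∈ e≢ab)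
            (shared⊆ (sharedImage∈ (proj₁ (inducedOn⁻ (cl 𝒳 i) S e∈)) e≢ab))))

    -- In an intact cluster the edge is the relabelling of an edge of `G` and inherits its
    -- expression in the basis. In a dissolved one it occurs in `W` up to order, as a private or a
    -- shared image.
    cluster-edge : ∀ i {r} (B : Basis i r) → Family.Good (family B) p → images B ⊆ W →
      ∀ {x y} → Adj Gs x y → Inside (cl 𝒳 i) (merge x , merge y) → InSpan (rows p W) (row p (x , y))
    cluster-edge i (intact ¬dis D D⊆ indep spans _) good images⊆ {x} {y} adj inside = located (merge-adj adj)
      where
        X : List Vtx
        X = cl 𝒳 i
        inW : ∀ {e} → e ∈ D ++ Sᵢ i → InSpan (rows p W) (row p (mapPair (relabel X) e))
        inW {e} e∈ with ∈-++⁻ D e∈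
        ... | inj₁ e∈D = ∈ᵖ⇒InSpan p {mapPair (relabel X) e} {W} (inj₁ (images⊆ (∈-map⁺ (mapPair (relabel X)) e∈D)))
        ... | inj₂ e∈S = shared-image i ¬dis e∈S
        image : ∀ {e} → e ∈ Lᵢ i → InSpan (rows p W) (row p (mapPair (relabel X) e))
        image = InSpan-image p (relabel X) merge D (Sᵢ i) {Lᵢ i} {W} good spans (Lᵢ-retracts i)
          (Lᵢ-retracts i ∘ basis-⊆ i D⊆) inW
        back : mapPair (relabel X) (merge x , merge y) ≡ (x , y)
        back = cong₂ _,_ (relabel-merge ¬dis adj (proj₂ inside)) (relabel-merge ¬dis (Adj-sym Gs adj)
            (proj₁ inside))
        located : Adj G (merge x) (merge y) → InSpan (rows p W) (row p (x , y))
        located (inj₁ e∈) = subst (λ e → InSpan (rows p W) (row p e)) back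
          (image (inducedOn⁺ {X} {E G ++ S} (∈-++⁺ˡ e∈) inside))
        located (inj₂ e∈) = subst (λ e → InSpan (rows p W) (row p e)) back (InSpan-SamePair (inj₂ (refl , refl))
          (image (inducedOn⁺ {X} {E G ++ S} (∈-++⁺ˡ e∈) (swap inside))))
    cluster-edge i (dissolved _ _) good images⊆ {x} {y} adj inside = located (merge-adj adj)
      where
        X : List Vtx
        X = cl 𝒳 i
        back : splitPair (merge x , merge y) ≡ (x , y)
        back = cong₂ _,_ (splitEnd-merge adj) (splitEnd-merge (Adj-sym Gs adj))
        edge-image : ∀ {e} → e ∈ E G → Inside X e → InSpan (rows p W) (row p (splitPair e))
        edge-image {e} e∈ inside with inS? e
        ... | no ∉S = ∈ᵖ⇒InSpan p {splitPair e} {W} (inj₁ (images⊆ (∈-map⁺ splitPair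
                (∈-filter⁺ (¬? ∘ inS?) (inducedOn⁺ {X} {E G} e∈ inside) ∉S))))
        ... | yes ∈S = InSpan-SamePair (splitPair-swap (norm-same e)) (∈ᵖ⇒InSpan p {splitPair (norm e)} {W}
                (inj₁ (subst (_∈ W) (sharedImage-edge norm-adj) (shared⊆ (sharedImage∈ ∈S norm≢ab)))))
          where
            norm-adj : Adj G (proj₁ (norm e)) (proj₂ (norm e))
            norm-adj = Adj-SamePair G (SamePair-sym (norm-same e)) (inj₁ e∈)
            -- Being an edge, the pair is not {a,b}, so its image was not dropped from
            -- `sharedImages`.
            norm≢ab : norm e ≢ norm (a , b)
            norm≢ab eq = ab-nonadjacent (Adj-SamePair G (norm-same (a , b)) (subst (λ f → Adj G (proj₁ f)
                (proj₂ f)) eq norm-adj))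
        located : Adj G (merge x) (merge y) → InSpan (rows p W) (row p (x , y))
        located (inj₁ e∈) = subst (λ e → InSpan (rows p W) (row p e)) back (edge-image e∈ inside)
        located (inj₂ e∈) = subst (λ e → InSpan (rows p W) (row p e)) back (InSpan-SamePair (inj₂
            (refl , refl)) (edge-image e∈ (swap inside)))

-- The glued graph

assoc : List Pair → Vtx → Vtx
assoc []            x = x
assoc ((k , v) ∷ l) x with x ℕ.≟ k
... | yes _ = v
... | no _  = assoc l x

assoc-∈ : ∀ {l k v} → Unique (map proj₁ l) → (k , v) ∈ l → assoc l k ≡ v
assoc-∈ {(k , v) ∷ l} _ (here refl) with k ℕ.≟ k
... | yes _ = refl
... | no ≢  = contradiction refl ≢
assoc-∈ {(k′ , _) ∷ l} {k} (h ∷ u) (there k∈) with k ℕ.≟ k′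
... | yes refl = contradiction refl (All.lookup h (∈-map⁺ proj₁ k∈))
... | no _     = assoc-∈ u k∈

assoc-∉ : ∀ {l k} → k ∉ map proj₁ l → assoc l k ≡ k
assoc-∉ {[]} _ = refl
assoc-∉ {(k′ , _) ∷ l} {k} k∉ with k ℕ.≟ k′
... | yes refl = contradiction (here refl) k∉
... | no _     = assoc-∉ (k∉ ∘ there)

keys-swap : ∀ (l : List Pair) → map proj₁ (map swap l) ≡ map proj₂ l
keys-swap []      = refl
keys-swap (e ∷ l) = cong (proj₂ e ∷_) (keys-swap l)

UniquePairs-map : ∀ {L} (f : Pair → Pair) (ρ : Vtx → Vtx) → (∀ {e} → e ∈ L → mapPair ρ (f e) ≡ e) →
  UniquePairs L → UniquePairs (map f L)
UniquePairs-map f ρ inv [] = []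
UniquePairs-map {e ∷ L} f ρ inv (h ∷ hs) = Allₚ.map⁺ (All.tabulate distinct) ∷ UniquePairs-map f ρ (inv ∘ there) hs
  where
    distinct : ∀ {g} → g ∈ L → ¬ SamePair (f e) (f g)
    distinct g∈ same = All.lookup h g∈ (subst₂ SamePair (inv (here refl)) (inv (there g∈))
        (mapPair-SamePair ρ same))

∈-endpoints⁻ : ∀ L {w} → w ∈ endpoints L → ∃[ e ] (e ∈ L) × ((w ≡ proj₁ e) ⊎ (w ≡ proj₂ e))
∈-endpoints⁻ L w∈ with find (∈-concatMap⁻ _ {xs = L} w∈)
... | e , e∈ , here eq         = e , e∈ , inj₁ eq
... | e , e∈ , there (here eq) = e , e∈ , inj₂ eq

-- Here `x` counts images, `s` shared pairs cluster by cluster, `R` is the sum of ranks, `k` counts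
-- shared pairs once and `n` is IE. The multiplicities in `s` cancel.
extra-≤ : ∀ {x s R n k} → x + s ≤ R → n + s ≡ R + k → x + k ≤ n
extra-≤ {x} {s} {R} {n} {k} le eq = ℕₚ.+-cancelʳ-≤ s (x + k) n (begin
  x + k + s   ≡⟨ swap-last x k s ⟩
  x + s + k   ≤⟨ ℕₚ.+-monoˡ-≤ k le ⟩
  R + k       ≡⟨ sym eq ⟩
  n + s       ∎)
  where
    open ℕₚ.≤-Reasoning
    swap-last : ∀ x k s → x + k + s ≡ x + s + k
    swap-last = ℕ-Solver.solve-∀

sumOver-extra-≤ : ∀ {n} {x s r : Fin n → ℕ} → (∀ i → x i + s i ≤ r i) → sumOver x + sumOver s ≤ sumOver r
sumOver-extra-≤ {x = x} {s} h = ℕₚ.≤-trans (ℕₚ.≤-reflexive (sym (sumOver-+ x s))) (sumOver-mono h)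

HasRank-≤ : ∀ {L r} → HasRank L r → r ≤ length L
HasRank-≤ {L} ((M , M⊆ , indep , len) , _) = subst (_≤ length L) len
  (UniquePairs-length-≤ {M} {L} (Indep⇒UniquePairs {M} indep) (inj₁ ∘ M⊆))

++-parts : {A : Set} (as bs cs ds es : List A) →
  let all = as ++ (bs ++ (cs ++ (ds ++ es))) in (as ⊆ all) × (bs ⊆ all) × (cs ⊆ all) × (ds ⊆ all) × (es ⊆ all)
++-parts as bs cs ds es = ∈-++⁺ˡ , (∈-++⁺ʳ as ∘ ∈-++⁺ˡ) , (∈-++⁺ʳ as ∘ ∈-++⁺ʳ bs ∘ ∈-++⁺ˡ) ,
  (∈-++⁺ʳ as ∘ ∈-++⁺ʳ bs ∘ ∈-++⁺ʳ cs ∘ ∈-++⁺ˡ) , (∈-++⁺ʳ as ∘ ∈-++⁺ʳ bs ∘ ∈-++⁺ʳ cs ∘ ∈-++⁺ʳ ds)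

module Glue (G : Graph) (𝒳 : Cover) (a b : Vtx) (base : SafeBase G 𝒳 a b)
  (a₁ a₂ b₁ b₂ : Vtx) (Gs : Graph) (safe : SafeSplit G 𝒳 a b a₁ a₂ b₁ b₂ Gs)
  (H : Graph) (𝒳H : Cover) (glue : List Pair) (ear : SafeEar H 𝒳H (map proj₂ glue))
  (disjoint : ∀ w → w ∈ V H → (w ∉ V G) × (w ∉ V Gs))
  (glue-unique : Unique (map proj₁ glue))
  (glue-new : All (_∈ (a₁ ∷ a₂ ∷ b₁ ∷ b₂ ∷ [])) (map proj₁ glue))
  (keys-glued : ∀ w₁ w₂ → KeyPairGs Gs 𝒳 a b a₁ a₂ b₁ b₂ w₁ w₂ → (w₁ ∈ map proj₁ glue) × (w₂ ∈ map proj₁ glue))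
  (keys-match : ∀ s₁ h₁ s₂ h₂ → (s₁ , h₁) ∈ glue → (s₂ , h₂) ∈ glue →
    KeyPairGs Gs 𝒳 a b a₁ a₂ b₁ b₂ s₁ s₂ → KeyPairH 𝒳H (map proj₂ glue) h₁ h₂)
  (J : Graph) (glued : Glued Gs H glue J) (indepJ : Indep (E J)) where

  open Split G 𝒳 a b base a₁ a₂ b₁ b₂ Gs safe
  open SafeEar ear
  open Glued glued
  private
    module Base = SafeBase base
    module S = NonedgeSplit (SafeSplit.split safe)
    module CG = CoverProperties Base.cover
    module CH = CoverProperties cover

  gl : List Vtx
  gl = map proj₂ glue

  -- Identified vertices keep their name from `Gs`, so only the ear is renamed; `unren` inverts
  -- `ren` on `V H`.
  ren unren : Vtx → Vtx
  ren   = assoc (map swap glue)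
  unren = assoc glue

  ren-glued : ∀ {s h} → (s , h) ∈ glue → ren h ≡ s
  ren-glued {s} {h} sh∈ = assoc-∈ (subst Unique (sym (keys-swap glue)) gl-unique) (∈-map⁺ swap sh∈)

  ren-unglued : ∀ {h} → h ∉ gl → ren h ≡ h
  ren-unglued {h} h∉ = assoc-∉ (h∉ ∘ subst (h ∈_) (keys-swap glue))

  ren-view : ∀ h → ((ren h , h) ∈ glue) ⊎ ((h ∉ gl) × (ren h ≡ h))
  ren-view h with h ∈? gl
  ... | no h∉ = inj₂ (h∉ , ren-unglued h∉)
  ... | yes h∈ with ∈-map⁻ proj₂ h∈
  ...   | (s , _) , sh∈ , refl = inj₁ (subst (λ s → (s , h) ∈ glue) (sym (ren-glued sh∈)) sh∈)

  Ren⇒ren : ∀ {h u} → Ren glue h u → u ≡ ren h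
  Ren⇒ren (inj₁ uh∈) = sym (ren-glued uh∈)
  Ren⇒ren (inj₂ (h∉ , eq)) = trans eq (sym (ren-unglued h∉))

  key-new : ∀ {s} → s ∈ map proj₁ glue → s ∈ News
  key-new = All.lookup glue-new

  new∈Gs : ∀ {s} → s ∈ News → s ∈ V Gs
  new∈Gs s∈ = proj₂ (S.vertices _) (inj₂ s∈)

  unren-ren : ∀ {h} → h ∈ V H → unren (ren h) ≡ h
  unren-ren {h} h∈ with ren-view h
  ... | inj₁ sh∈ = assoc-∈ glue-unique sh∈
  ... | inj₂ (_ , eq) = trans (cong unren eq) (assoc-∉ (λ key → proj₂ (disjoint h h∈) (new∈Gs (key-new key))))

  ren-image : ∀ {h} → h ∈ V H → (ren h ∈ News) ⊎ (ren h ∈ V H)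
  ren-image {h} h∈ with ren-view h
  ... | inj₁ sh∈      = inj₁ (key-new (∈-map⁺ proj₁ sh∈))
  ... | inj₂ (_ , eq) = inj₂ (subst (_∈ V H) (sym eq) h∈)

  ren∈J : ∀ {h} → h ∈ V H → ren h ∈ V J
  ren∈J {h} h∈ with ren-view h
  ... | inj₁ sh∈       = proj₂ (vertices _) (inj₁ (new∈Gs (key-new (∈-map⁺ proj₁ sh∈))))
  ... | inj₂ (h∉ , eq) = proj₂ (vertices _) (inj₂ (subst (_∈ V H) (sym eq) h∈ , subst (_∉ gl) (sym eq) h∉))

  ren-adj : ∀ {h₁ h₂} → Adj H h₁ h₂ → Adj J (ren h₁) (ren h₂)
  ren-adj {h₁} {h₂} adj = proj₂ (edges _ _) (inj₂ (h₁ , h₂ , adj , ren-view h₁ , ren-view h₂))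

  old≢ren : ∀ {w h} → Old w → h ∈ V H → w ≢ ren h
  old≢ren old h∈ eq with ren-image h∈
  ... | inj₁ new = Old∉News old (subst (_∈ News) (sym eq) new)
  ... | inj₂ inH = proj₁ (disjoint _ inH) (subst (_∈ V G) eq (proj₁ old))

  Gs-edge-old : ∀ {x y} → Adj Gs x y → Old x ⊎ Old y
  Gs-edge-old adj with Gs-vertex (Adj-left Gs adj)
  ... | inj₁ old = inj₁ old
  ... | inj₂ new = inj₂ (proj₂ (new-adj new adj))

  -- An edge of `Gs` has an old endpoint, and no vertex of the ear is identified with one. Hence the
  -- two edge sets stay disjoint, and gluing cannot fill a nonedge of the ear.
  Gs-adj≢ren : ∀ {x y h₁ h₂} → Adj Gs x y → h₁ ∈ V H → h₂ ∈ V H → ¬ SamePair (x , y) (ren h₁ , ren h₂)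
  Gs-adj≢ren adj h₁∈ h₂∈ same with Gs-edge-old adj | same
  ... | inj₁ old | inj₁ (eq , _) = old≢ren old h₁∈ eq
  ... | inj₁ old | inj₂ (eq , _) = old≢ren old h₂∈ eq
  ... | inj₂ old | inj₁ (_ , eq) = old≢ren old h₂∈ eq
  ... | inj₂ old | inj₂ (_ , eq) = old≢ren old h₁∈ eq

  a∉J : a ∉ V J
  a∉J a∈ with proj₁ (vertices a) a∈
  ... | inj₂ (a∈H , _) = proj₁ (disjoint a a∈H) a∈G
  ... | inj₁ a∈Gs with Gs-vertex a∈Gs
  ...   | inj₁ (_ , a≢a , _) = a≢a refl
  ...   | inj₂ new           = a≢new new refl

  b∉J : b ∉ V J
  b∉J b∈ with proj₁ (vertices b) b∈
  ... | inj₂ (b∈H , _) = proj₁ (disjoint b b∈H) b∈G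
  ... | inj₁ b∈Gs with Gs-vertex b∈Gs
  ...   | inj₁ (_ , _ , b≢b) = b≢b refl
  ...   | inj₂ new           = b≢new new refl

  edge-vertices : ∀ {e} → e ∈ E H → (proj₁ e ∈ V H) × (proj₂ e ∈ V H)
  edge-vertices = E-vertices H

  unren-mapPair : ∀ {e} → (proj₁ e ∈ V H) × (proj₂ e ∈ V H) → mapPair unren (mapPair ren e) ≡ e
  unren-mapPair (u∈ , v∈) = cong₂ _,_ (unren-ren u∈) (unren-ren v∈)

  E-count : length (E G) + length (E H) ≤ length (E J)
  E-count = subst (_≤ length (E J)) (trans (Listₚ.length-++ EG) (cong₂ _+_ (Listₚ.length-map splitPair (E G))
      (Listₚ.length-map (mapPair ren) (E H))))
    (UniquePairs-length-≤ {EG ++ EH} {E J} (AllPairsₚ.++⁺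
      (UniquePairs-map splitPair merge (λ e∈ → cong₂ _,_ (merge-splitEnd (inj₁ e∈)) (merge-splitEnd (inj₂ e∈)))
          (E-simple G))
      (UniquePairs-map (mapPair ren) unren (unren-mapPair ∘ edge-vertices) (E-simple H))
      (Allₚ.map⁺ (All.tabulate (λ e∈ → Allₚ.map⁺ (All.tabulate (λ f∈ →
        Gs-adj≢ren (splitPair-adj (inj₁ e∈)) (proj₁ (edge-vertices f∈)) (proj₂ (edge-vertices f∈))))))))
      included)
    where
      EG EH : List Pair
      EG = map splitPair (E G)
      EH = map (mapPair ren) (E H)
      included : ∀ {e} → e ∈ EG ++ EH → e ∈ᵖ E J
      included e∈ with ∈-++⁻ EG e∈
      ... | inj₁ e∈EG with ∈-map⁻ splitPair e∈EG
      ...   | _ , f∈ , refl = proj₂ (edges _ _) (inj₁ (splitPair-adj (inj₁ f∈)))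
      included e∈ | inj₂ e∈EH with ∈-map⁻ (mapPair ren) e∈EH
      ...   | _ , f∈ , refl = ren-adj (inj₁ f∈)

  E-retracts : ∀ {e} → e ∈ E H → Retracts ren unren e
  E-retracts e∈ = unren-ren (proj₁ (edge-vertices e∈)) , unren-ren (proj₂ (edge-vertices e∈))

  -- Inherited from `J` by pulling its placement back along `ren`; it makes rank(H) equal to
  -- `|E H|`, against which (E3) is played in `unfilled`.
  indepH : Indep (E H)
  indepH = p ∘ ren , Ind⇒RowsIndependent (p ∘ ren) (E H) (Ind-relabel (E H) E-retracts
      (Ind-injection {A = rows p (E J)} {B = relabelledRows (E H)} φ φ-injective (λ j → row-SamePair p (φ-same j))
        (RowsIndependent⇒Ind p (E J) (proj₂ indepJ))))
    where
      p : Placement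
      p = proj₁ indepJ
      open Relabelling p ren unren
      found : ∀ j → ∃[ k ] SamePair (mapPair ren (lookup (E H) j)) (lookup (E J) k)
      found j = ∈ᵖ-lookup {L = E J} (ren-adj (inj₁ (∈-lookup {xs = E H} j)))
      φ : Fin (length (E H)) → Fin (length (E J))
      φ j = proj₁ (found j)
      φ-same : ∀ j → SamePair (mapPair ren (lookup (E H) j)) (lookup (E J) (φ j))
      φ-same j = proj₂ (found j)
      φ-injective : Injective _≡_ _≡_ φ
      φ-injective {i} {j} eq = AllPairs-lookup SamePair-sym (E-simple H) i j
        (subst₂ SamePair (inv i) (inv j) (mapPair-SamePair unren
          (SamePair-trans (φ-same i) (subst (λ k → SamePair (lookup (E J) k) (mapPair ren (lookup (E H) j)))
              (sym eq) (SamePair-sym (φ-same j))))))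
        where
          inv : ∀ k → mapPair unren (mapPair ren (lookup (E H) k)) ≡ lookup (E H) k
          inv k = unren-mapPair (edge-vertices (∈-lookup {xs = E H} k))

  -- Shared and key pairs of the ear

  K : List Pair
  K = keyPairsH 𝒳H gl

  SK : List Pair
  SK = sharedAnd 𝒳H K

  common? : Decidable (λ (e : Pair) → Any (λ X → (proj₁ e ∈ X) × (proj₂ e ∈ X)) 𝒳H)
  common? e = any? (λ X → (proj₁ e ∈? X) ×-dec (proj₂ e ∈? X)) 𝒳H

  E2-pairs : List Pair
  E2-pairs = dedupNorm (shared 𝒳H ++ pairsOf gl)

  -- What the two kinds of pairs have in common; the last component is what (E2) turns into
  -- independence.
  SharedOrKey : Pair → Set
  SharedOrKey e = (proj₁ e ≢ proj₂ e) × (∃[ i ] Inside (cl 𝒳H i) e) × (e ∈ E2-pairs)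

  shared⇒SharedOrKey : ∀ {e} → e ∈ shared 𝒳H → SharedOrKey e
  shared⇒SharedOrKey {e} e∈ = proj₁ (proj₂ facts) , proj₂ (proj₂ facts) ,
      subst (_∈ E2-pairs) (proj₁ facts) (dedupNorm⁺ {e} {shared 𝒳H ++ pairsOf gl} (∈-++⁺ˡ e∈))
    where
      facts : (norm e ≡ e) × (proj₁ e ≢ proj₂ e) × ∃[ i ] Inside (cl 𝒳H i) e
      facts = CH.shared⁻ e∈

  key⇒SharedOrKey : ∀ {e} → e ∈ K → SharedOrKey e
  key⇒SharedOrKey {e} e∈ = from (dedupNorm⁻ (filter common? (pairsOf gl)) e∈)
    where
      distinct : ∀ {e g : Pair} → SamePair e g → proj₁ g ≢ proj₂ g → proj₁ e ≢ proj₂ e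
      distinct (inj₁ (refl , refl)) g₁≢g₂ eq = g₁≢g₂ eq
      distinct (inj₂ (refl , refl)) g₁≢g₂ eq = g₁≢g₂ (sym eq)
      endpoints≢ : ∀ {g} → g ∈ pairsOf gl → proj₁ g ≢ proj₂ g
      endpoints≢ g∈ eq = i≢j (Unique-lookup gl-unique (trans (sym g₁≡) (trans eq g₂≡)))
        where
          located = pairsOf⁻ gl g∈
          i≢j = proj₁ (proj₂ (proj₂ located))
          g₁≡ = proj₁ (proj₂ (proj₂ (proj₂ located)))
          g₂≡ = proj₂ (proj₂ (proj₂ (proj₂ located)))
      from : ∃[ g ] (g ∈ filter common? (pairsOf gl)) × (e ≡ norm g) → SharedOrKey e
      from (g , g∈ , e≡) = subst SharedOrKey (sym e≡)
          ( distinct (norm-same g) (endpoints≢ (proj₁ split∈))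
          , (Any.index (proj₂ split∈) , Inside-SamePair (SamePair-sym (norm-same g)) (Anyₚ.lookup-index
              (proj₂ split∈)))
          , dedupNorm⁺ {g} {shared 𝒳H ++ pairsOf gl} (∈-++⁺ʳ (shared 𝒳H) (proj₁ split∈)))
        where
          split∈ : (g ∈ pairsOf gl) × Any (λ X → (proj₁ g ∈ X) × (proj₂ g ∈ X)) 𝒳H
          split∈ = ∈-filter⁻ common? {xs = pairsOf gl} g∈

  key-normal : ∀ {e} → e ∈ K → norm e ≡ e
  key-normal = dedupNorm-normal (filter common? (pairsOf gl))

  SK⁻ : ∀ {e} → e ∈ SK → SharedOrKey e
  SK⁻ {e} e∈ = from (dedupNorm⁻ (shared 𝒳H ++ K) e∈)
    where
      from : ∃[ g ] (g ∈ shared 𝒳H ++ K) × (e ≡ norm g) → SharedOrKey e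
      from (g , g∈ , e≡) = case (∈-++⁻ (shared 𝒳H) g∈)
        where
          case : (g ∈ shared 𝒳H) ⊎ (g ∈ K) → SharedOrKey e
          case (inj₁ g∈S) = subst SharedOrKey (sym (trans e≡ (proj₁ (CH.shared⁻ g∈S)))) (shared⇒SharedOrKey g∈S)
          case (inj₂ g∈K) = subst SharedOrKey (sym (trans e≡ (key-normal g∈K))) (key⇒SharedOrKey g∈K)

  key∈SK : ∀ {h₁ h₂} → KeyPairH 𝒳H gl h₁ h₂ → norm (h₁ , h₂) ∈ SK
  key∈SK {h₁} {h₂} (h₁∈ , h₂∈ , h₁≢h₂ , X , X∈ , in₁ , in₂) = located (pairsOf⁺ gl i j index≢)
    where
      i j : Fin (length gl)
      i = Any.index h₁∈
      j = Any.index h₂∈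
      h₁≡ : lookup gl i ≡ h₁
      h₁≡ = sym (Anyₚ.lookup-index h₁∈)
      h₂≡ : lookup gl j ≡ h₂
      h₂≡ = sym (Anyₚ.lookup-index h₂∈)
      index≢ : i ≢ j
      index≢ eq = h₁≢h₂ (trans (sym h₁≡) (trans (cong (lookup gl) eq) h₂≡))
      via : ∀ g → g ∈ pairsOf gl → Inside X g → norm g ∈ SK
      via g g∈ inside = subst (_∈ SK) (norm-idem g) (dedupNorm⁺ {norm g} {shared 𝒳H ++ K}
        (∈-++⁺ʳ (shared 𝒳H) (dedupNorm⁺ {g} {filter common? (pairsOf gl)} (∈-filter⁺ common? g∈ (lose X∈ inside)))))
      located : ((lookup gl i , lookup gl j) ∈ pairsOf gl) ⊎ ((lookup gl j , lookup gl i) ∈ pairsOf gl) → norm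
          (h₁ , h₂) ∈ SK
      located (inj₁ g∈) = via (h₁ , h₂) (subst₂ (λ u v → (u , v) ∈ pairsOf gl) h₁≡ h₂≡ g∈) (in₁ , in₂)
      located (inj₂ g∈) = subst (_∈ SK) (norm-cong {h₂ , h₁} {h₁ , h₂} (inj₂ (refl , refl)))
        (via (h₂ , h₁) (subst₂ (λ u v → (u , v) ∈ pairsOf gl) h₂≡ h₁≡ g∈) (in₂ , in₁))

  SKᵢ LHᵢ : Fin (length 𝒳H) → List Pair
  SKᵢ i = inducedOn (cl 𝒳H i) SK
  LHᵢ i = inducedOn (cl 𝒳H i) (E H ++ SK)

  SKᵢ-indep : ∀ i → Indep (SKᵢ i)
  SKᵢ-indep i = Indep-⊆ᵖ {SKᵢ i} {dedupNorm (shared 𝒳H ++ pairsOf gl)} (inducedOn-UniquePairs (cl 𝒳H i) {SK}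
      (dedupNorm-UniquePairs _))
    (λ e∈ → inj₁ (proj₂ (proj₂ (SK⁻ (proj₁ (inducedOn⁻ (cl 𝒳H i) SK e∈)))))) E2

  SKᵢ⊆LHᵢ : ∀ i → SKᵢ i ⊆ LHᵢ i
  SKᵢ⊆LHᵢ i = inducedOn-mono {cl 𝒳H i} {SK} {E H ++ SK} (∈-++⁺ʳ (E H))

  -- One renaming serves all clusters of the ear, so none is torn apart and the alternative of
  -- `Basis` does not arise.
  EarBasis : Fin (length 𝒳H) → ℕ → Set
  EarBasis i r = ∃[ D ] (D ⊆ LHᵢ i) × Indep (D ++ SKᵢ i) × Spanning D (SKᵢ i) (LHᵢ i) × (length D + length
      (SKᵢ i) ≤ r)

  earBasis : ∀ i {r} → HasRank (LHᵢ i) r → EarBasis i r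
  earBasis i rank = HasRank-extension {LHᵢ i} (SKᵢ i) rank (SKᵢ⊆LHᵢ i) (SKᵢ-indep i)

  earFamily : ∀ {i r} → EarBasis i r → Family
  earFamily {i} (D , _) = rowsFamily ren (D ++ SKᵢ i)

  earImages : ∀ {i r} → EarBasis i r → List Pair
  earImages (D , _) = map (mapPair ren) D

  earImages-length : ∀ {i r} (B : EarBasis i r) → length (earImages B) + length (SKᵢ i) ≤ r
  earImages-length {i} (D , _ , _ , _ , len) = subst (λ k → k + length (SKᵢ i) ≤ _) (sym (Listₚ.length-map
      (mapPair ren) D)) len

  Inside-retracts : ∀ i {e} → Inside (cl 𝒳H i) e → Retracts ren unren e
  Inside-retracts i inside = unren-ren (proj₁ (CH.Inside⇒∈V i inside)) , unren-ren (proj₂ (CH.Inside⇒∈V i inside))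

  LHᵢ-retracts : ∀ i {e} → e ∈ LHᵢ i → Retracts ren unren e
  LHᵢ-retracts i e∈ = Inside-retracts i (proj₂ (inducedOn⁻ (cl 𝒳H i) (E H ++ SK) e∈))

  earBasis-⊆ : ∀ i {D} → D ⊆ LHᵢ i → D ++ SKᵢ i ⊆ LHᵢ i
  earBasis-⊆ i {D} D⊆ e∈ with ∈-++⁻ D e∈
  ... | inj₁ e∈D = D⊆ e∈D
  ... | inj₂ e∈S = SKᵢ⊆LHᵢ i e∈S

  earFamily-good : ∀ {i r} (B : EarBasis i r) → ∃[ p ] Family.Good (earFamily B) p
  earFamily-good {i} (D , D⊆ , (q , ind) , _) = q ∘ unren ,
    Ind-retract q ren unren (D ++ SKᵢ i) (LHᵢ-retracts i ∘ earBasis-⊆ i D⊆) (RowsIndependent⇒Ind q (D ++ SKᵢ i) ind)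

  renSK : List Pair
  renSK = map (mapPair ren) SK

  module _ (p : Placement) (W : List Pair) (SK⊆ : renSK ⊆ W) where

    ear-edge : ∀ i {r} (B : EarBasis i r) → Family.Good (earFamily B) p → earImages B ⊆ W →
      ∀ {e} → e ∈ E H → Inside (cl 𝒳H i) e → InSpan (rows p W) (row p (mapPair ren e))
    ear-edge i (D , D⊆ , _ , spans , _) good images⊆ {e} e∈ inside =
      InSpan-image p ren unren D (SKᵢ i) {LHᵢ i} {W} good spans (LHᵢ-retracts i)
          (LHᵢ-retracts i ∘ earBasis-⊆ i D⊆) inW
        (inducedOn⁺ {cl 𝒳H i} {E H ++ SK} (∈-++⁺ˡ e∈) inside)
      where
        inW : ∀ {e} → e ∈ D ++ SKᵢ i → InSpan (rows p W) (row p (mapPair ren e))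
        inW {e} e∈ with ∈-++⁻ D e∈
        ... | inj₁ e∈D = ∈ᵖ⇒InSpan p {mapPair ren e} {W} (inj₁ (images⊆ (∈-map⁺ (mapPair ren) e∈D)))
        ... | inj₂ e∈S = ∈ᵖ⇒InSpan p {mapPair ren e} {W} (inj₁ (SK⊆ (∈-map⁺ (mapPair ren) (proj₁ (inducedOn⁻
            (cl 𝒳H i) SK e∈S)))))

    -- The point of the gluing: a key pair of `Gs` is identified with a key pair of `H`, whose image
    -- already belongs to `renSK`.
    key-image : ∀ {s t} → Key s t → InSpan (rows p W) (row p (s , t))
    key-image {s} {t} key = located (keys-glued s t key)
      where
        located : (s ∈ map proj₁ glue) × (t ∈ map proj₁ glue) → InSpan (rows p W) (row p (s , t))
        located (s∈ , t∈) with ∈-map⁻ proj₁ s∈ | ∈-map⁻ proj₁ t∈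
        ... | (_ , h₁) , sh₁∈ , refl | (_ , h₂) , th₂∈ , refl =
          subst₂ (λ u v → InSpan (rows p W) (row p (u , v))) (ren-glued sh₁∈) (ren-glued th₂∈)
            (proj₁ inW , λ x → trans (row-SamePair p (mapPair-SamePair ren (SamePair-sym (norm-same
                (h₁ , h₂)))) x) (proj₂ inW x))
          where
            inW : InSpan (rows p W) (row p (mapPair ren (norm (h₁ , h₂))))
            inW = ∈ᵖ⇒InSpan p {mapPair ren (norm (h₁ , h₂))} {W}
              (inj₁ (SK⊆ (∈-map⁺ (mapPair ren) (key∈SK (keys-match _ _ _ _ sh₁∈ th₂∈ key)))))

  -- Length of the spanning list

  private
    rG : ℕ
    rG = proj₁ Base.rankIE
    rankG : HasRank (E G) rG
    rankG = proj₁ (proj₂ Base.rankIE)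
    ieG = HasIE-count {G} {𝒳} {[]} (proj₂ (proj₂ Base.rankIE))
    rH : ℕ
    rH = proj₁ E3
    rankH : HasRank (E H) rH
    rankH = proj₁ (proj₂ E3)
    ieH = HasIE-count {H} {𝒳H} {K} (proj₂ (proj₂ E3))

  basisG : ∀ i → Basis i (proj₁ ieG i)
  basisG i = basis i (proj₁ (proj₂ ieG) i)

  basisH : ∀ i → EarBasis i (proj₁ ieH i)
  basisH i = earBasis i (proj₁ (proj₂ ieH) i)

  imagesG imagesH : List Pair
  imagesG = concat (tabulate (λ i → images (basisG i)))
  imagesH = concat (tabulate (λ i → earImages (basisH i)))

  -- Only its length and its span matter; no independence is claimed and repetitions are harmless.
  W : List Pair
  W = fresh ++ (sharedImages ++ (renSK ++ (imagesG ++ imagesH)))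

  imagesG-≤ : length imagesG + length S ≤ rG
  imagesG-≤ = extra-≤ {s = sumOver (λ i → length (Sᵢ i))} {R = sumOver (proj₁ ieG)}
    (subst (λ k → k + sumOver (λ i → length (Sᵢ i)) ≤ sumOver (proj₁ ieG)) (sym (length-concat-tabulate
        (λ i → images (basisG i))))
      (sumOver-extra-≤ (λ i → images-length (basisG i))))
    (proj₂ (proj₂ ieG))

  imagesH-≤ : length imagesH + length SK ≤ suc rH
  imagesH-≤ = extra-≤ {s = sumOver (λ i → length (SKᵢ i))} {R = sumOver (proj₁ ieH)}
    (subst (λ k → k + sumOver (λ i → length (SKᵢ i)) ≤ sumOver (proj₁ ieH)) (sym (length-concat-tabulate
        (λ i → earImages (basisH i))))
      (sumOver-extra-≤ (λ i → earImages-length (basisH i))))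
    (proj₂ (proj₂ ieH))

  W-≤ : length W ≤ 6 + length (E J)
  W-≤ = begin
    6 + length (sharedImages ++ (renSK ++ (imagesG ++ imagesH)))
      ≡⟨ cong (6 +_) (trans (Listₚ.length-++ sharedImages) (cong (length sharedImages +_)
           (trans (Listₚ.length-++ renSK) (cong₂ _+_ (Listₚ.length-map (mapPair ren) SK)
               (Listₚ.length-++ imagesG))))) ⟩
    6 + (length sharedImages + (length SK + (length imagesG + length imagesH)))
      -- A unit is added on both sides: on the left it completes `sharedImages` towards `S`, where
      -- {a,b} was dropped, and on the right it is the one from (E3).
      ≤⟨ ℕₚ.+-monoʳ-≤ 6 (ℕₚ.≤-pred (begin
           suc (length sharedImages + (length SK + (length imagesG + length imagesH)))
             ≡⟨ regroup (length sharedImages) (length SK) (length imagesG) (length imagesH) ⟩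
           (length imagesG + suc (length sharedImages)) + (length imagesH + length SK)
             ≤⟨ ℕₚ.+-mono-≤ (ℕₚ.+-monoʳ-≤ (length imagesG) sharedImages-length) imagesH-≤ ⟩
           (length imagesG + length S) + suc rH
             ≤⟨ ℕₚ.+-mono-≤ imagesG-≤ ℕₚ.≤-refl ⟩
           rG + suc rH ≡⟨ ℕₚ.+-suc rG rH ⟩
           suc (rG + rH) ≤⟨ s≤s (ℕₚ.≤-trans (ℕₚ.+-mono-≤ (HasRank-≤ rankG) (HasRank-≤ rankH)) E-count) ⟩
           suc (length (E J)) ∎)) ⟩
    6 + length (E J) ∎
    where
      open ℕₚ.≤-Reasoning
      regroup : ∀ s k g h → suc (s + (k + (g + h))) ≡ (g + suc s) + (h + k)
      regroup = ℕ-Solver.solve-∀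

  -- If all pairs of S ∪ K were edges, `IE-of-edges-≤` would bound `suc rH` by `|E H|`, while
  -- independence of `H` bounds `|E H|` by `rH`.
  unfilled : ∃[ f ] (f ∈ SK) × ¬ Adj H (proj₁ f) (proj₂ f)
  unfilled with All.all? (λ f → Adj? H (proj₁ f) (proj₂ f)) SK
  ... | no ¬all = find (Allₚ.¬All⇒Any¬ (λ f → Adj? H (proj₁ f) (proj₂ f)) SK ¬all)
  ... | yes all = contradiction (CH.IE-of-edges-≤ {K} (proj₂ (proj₂ E3)) (All.lookup all))
                    (ℕₚ.<⇒≱ (s≤s (proj₂ rankH (E H) (λ e∈ → e∈) indepH)))

  -- The implied nonedge

  module _ (f : Pair) (f∈SK : f ∈ SK) (¬adj : ¬ Adj H (proj₁ f) (proj₂ f)) where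

    u v : Vtx
    u = ren (proj₁ f)
    v = ren (proj₂ f)

    f∈H : (proj₁ f ∈ V H) × (proj₂ f ∈ V H)
    f∈H = CH.Inside⇒∈V _ (proj₂ (proj₁ (proj₂ (SK⁻ f∈SK))))

    nonedge : Nonedge J u v
    nonedge = ren∈J (proj₁ f∈H) , ren∈J (proj₂ f∈H) ,
      (λ eq → proj₁ (SK⁻ f∈SK) (trans (sym (unren-ren (proj₁ f∈H))) (trans (cong unren eq) (unren-ren
          (proj₂ f∈H))))) ,
      λ adj → absurd (proj₁ (edges u v) adj)
      where
        absurd : _ → ⊥
        absurd (inj₁ adjGs) = Gs-adj≢ren adjGs (proj₁ f∈H) (proj₂ f∈H) (inj₁ (refl , refl))
        absurd (inj₂ (h₁ , h₂ , adjH , ren₁ , ren₂)) = ¬adj (subst₂ (Adj H)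
          (same (Adj-left H adjH) (proj₁ f∈H) ren₁) (same (Adj-left H (Adj-sym H adjH)) (proj₂ f∈H) ren₂) adjH)
          where
            same : ∀ {h k} → h ∈ V H → k ∈ V H → Ren glue h (ren k) → h ≡ k
            same h∈ k∈ r = trans (sym (unren-ren h∈)) (trans (cong unren (sym (Ren⇒ren r))) (unren-ren k∈))

    Jf : List Pair
    Jf = (u , v) ∷ E J

    Jf-endpoints : ∀ {w} → w ∈ endpoints Jf → w ∈ V J
    Jf-endpoints w∈ with ∈-endpoints⁻ Jf w∈
    ... | _ , here refl , inj₁ refl = proj₁ nonedge
    ... | _ , here refl , inj₂ refl = proj₁ (proj₂ nonedge)
    ... | _ , there e∈ , inj₁ refl = proj₁ (E-vertices J e∈)
    ... | _ , there e∈ , inj₂ refl = proj₂ (E-vertices J e∈)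

    -- `a` is attached to `Jf` first and `b` afterwards, since `a` is a leaf of the star at `b`.
    extended : List Pair
    extended = star b a a₁ a₂ ++ (star a a₁ b₁ b₂ ++ Jf)

    module _ (p : Placement) (goodG : ∀ i → Family.Good (family (basisG i)) p) (goodH : ∀ i → Family.Good
        (earFamily (basisH i)) p) where

      in-W : (fresh ⊆ W) × (sharedImages ⊆ W) × (renSK ⊆ W) × (imagesG ⊆ W) × (imagesH ⊆ W)
      in-W = ++-parts fresh sharedImages renSK imagesG imagesH
      in-fresh : fresh ⊆ W
      in-fresh = proj₁ in-W
      in-shared : sharedImages ⊆ W
      in-shared = proj₁ (proj₂ in-W)
      in-SK : renSK ⊆ W
      in-SK = proj₁ (proj₂ (proj₂ in-W))
      in-imagesG : ∀ i → images (basisG i) ⊆ W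
      in-imagesG i e∈ = proj₁ (proj₂ (proj₂ (proj₂ in-W))) (∈-concat-tabulate (λ i → images (basisG i)) i e∈)
      in-imagesH : ∀ i → earImages (basisH i) ⊆ W
      in-imagesH i e∈ = proj₂ (proj₂ (proj₂ (proj₂ in-W))) (∈-concat-tabulate (λ i → earImages (basisH i)) i e∈)

      open Spans p W in-fresh in-shared (key-image p W in-SK)

      J-edge : ∀ {x y} → Adj J x y → InSpan (rows p W) (row p (x , y))
      J-edge {x} {y} adj = located (proj₁ (edges x y) adj)
        where
          earEdge : ∀ {h₁ h₂} → Adj H h₁ h₂ → InSpan (rows p W) (row p (ren h₁ , ren h₂))
          earEdge {h₁} {h₂} (inj₁ e∈) = ear-edge p W in-SK i (basisH i) (goodH i) (in-imagesH i) {h₁ , h₂} e∈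
              (proj₂ (CH.covers-index {h₁ , h₂} (inj₁ e∈)))
            where
              i : Fin (length 𝒳H)
              i = proj₁ (CH.covers-index {h₁ , h₂} (inj₁ e∈))
          earEdge {h₁} {h₂} (inj₂ e∈) = InSpan-SamePair {ren h₂ , ren h₁} (inj₂ (refl , refl))
            (ear-edge p W in-SK i (basisH i) (goodH i) (in-imagesH i) {h₂ , h₁} e∈ (proj₂
                (CH.covers-index {h₂ , h₁} (inj₁ e∈))))
            where
              i : Fin (length 𝒳H)
              i = proj₁ (CH.covers-index {h₂ , h₁} (inj₁ e∈))
          located : _ → InSpan (rows p W) (row p (x , y))
          located (inj₁ adjGs) = cluster-edge i (basisG i) (goodG i) (in-imagesG i) adjGs (proj₂
              (CG.covers-index {merge x , merge y} (merge-adj adjGs)))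
            where
              i : Fin (length 𝒳)
              i = proj₁ (CG.covers-index {merge x , merge y} (merge-adj adjGs))
          located (inj₂ (h₁ , h₂ , adjH , ren₁ , ren₂)) = subst₂ (λ x y → InSpan (rows p W) (row p (x , y)))
            (sym (Ren⇒ren ren₁)) (sym (Ren⇒ren ren₂)) (earEdge adjH)

      extended-spanned : ∀ {e} → e ∈ extended → InSpan (rows p W) (row p e)
      extended-spanned {e} e∈ = located (∈-++⁻ fresh {Jf} e∈)
        where
          located : (e ∈ fresh) ⊎ (e ∈ Jf) → InSpan (rows p W) (row p e)
          located (inj₁ e∈fresh)     = ∈ᵖ⇒InSpan p {e} {W} (inj₁ (in-fresh e∈fresh))
          located (inj₂ (here refl)) = ∈ᵖ⇒InSpan p {u , v} {W} (inj₁ (in-SK (∈-map⁺ (mapPair ren) f∈SK)))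
          located (inj₂ (there e∈J)) = J-edge (inj₁ e∈J)

      -- Seven rows beyond `E J`, namely `f` and the two stars, against the six that `W-≤` allows.
      extended-dependent : ¬ Ind (rows p extended)
      extended-dependent ind = ℕₚ.<⇒≱ (s≤s W-≤) (Ind-InSpan⇒≤ {A = rows p extended} {B = rows p W} ind
        (λ j → extended-spanned (∈-lookup {xs = extended} j)))

    extended-independent : ∀ p → Ind (starVectors b a a₁ a₂ p) → Ind (starVectors a a₁ b₁ b₂ p) → Ind
        (rows p Jf) → Ind (rows p extended)
    extended-independent p star-b star-a indJ =
      star-extension p b a a₁ a₂ (star a a₁ b₁ b₂ ++ Jf) (a≢b ∘ sym) (b≢new a₁∈) (b≢new a₂∈) b∉ star-b
        (star-extension p a a₁ b₁ b₂ Jf (a≢new a₁∈) (a≢new b₁∈) (a≢new b₂∈) (a∉J ∘ Jf-endpoints) star-a indJ)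
      where
        b∉ : b ∉ endpoints (star a a₁ b₁ b₂ ++ Jf)
        b∉ (here eq) = a≢b (sym eq)
        b∉ (there (here eq)) = b≢new a₁∈ eq
        b∉ (there (there (here eq))) = a≢b (sym eq)
        b∉ (there (there (there (here eq)))) = b≢new b₁∈ eq
        b∉ (there (there (there (there (here eq))))) = a≢b (sym eq)
        b∉ (there (there (there (there (there (here eq)))))) = b≢new b₂∈ eq
        b∉ (there (there (there (there (there (there b∈)))))) = b∉J (Jf-endpoints b∈)

    -- The placement `q` at which `Jf` would be independent says nothing about the cluster bases. It
    -- is exchanged for one at which `Jf`, the stars and all bases are independent together.
    Jf-dependent : ¬ Indep Jf
    Jf-dependent (q , indq) = contradict (common-good-placement families satisfiable)
      where
        families : List Family
        families = starFamily b a a₁ a₂ ∷ starFamily a a₁ b₁ b₂ ∷ rowsFamily (λ w → w) Jf ∷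
          (tabulate (λ i → family (basisG i)) ++ tabulate (λ i → earFamily (basisH i)))
        satisfiable : All (λ F → ∃[ p ] Family.Good F p) families
        satisfiable =
          star-good b a a₁ a₂ a≢b (b≢new a₁∈ ∘ sym) (b≢new a₂∈ ∘ sym) (a≢new a₁∈) (a≢new a₂∈) a₁≢a₂ ∷
          star-good a a₁ b₁ b₂ (a≢new a₁∈ ∘ sym) (a≢new b₁∈ ∘ sym) (a≢new b₂∈ ∘ sym) a₁≢b₁ a₁≢b₂ b₁≢b₂ ∷
          (q , RowsIndependent⇒Ind q Jf indq) ∷
          Allₚ.++⁺ (Allₚ.tabulate⁺ (λ i → family-good (basisG i))) (Allₚ.tabulate⁺ (λ i → earFamily-good
              (basisH i)))
        contradict : ¬ (∃[ p ] All (λ F → Family.Good F p) families)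
        contradict (p , star-b ∷ star-a ∷ indJ ∷ rest) = extended-dependent p
          (Allₚ.tabulate⁻ (Allₚ.++⁻ˡ (tabulate (λ i → family (basisG i))) rest))
          (Allₚ.tabulate⁻ (Allₚ.++⁻ʳ (tabulate (λ i → family (basisG i))) rest))
          (extended-independent p star-b star-a indJ)

  implied : ∃[ u ] ∃[ v ] ImpliedNonedge J u v
  implied with unfilled
  ... | f , f∈SK , ¬adj = u f f∈SK ¬adj , v f f∈SK ¬adj ,
    dependent⇒implied J indepJ (nonedge f f∈SK ¬adj) (Jf-dependent f f∈SK ¬adj)

theorem6 : (G : Graph) (𝒳 : Cover) (a b : Vtx) → SafeBase G 𝒳 a b →
    (a₁ a₂ b₁ b₂ : Vtx) (Gs : Graph) → SafeSplit G 𝒳 a b a₁ a₂ b₁ b₂ Gs →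
    (H : Graph) (𝒳H : Cover) (glue : List Pair) →
    SafeEar H 𝒳H (map proj₂ glue) →
    (∀ w → w ∈ V H → (w ∉ V G) × (w ∉ V Gs)) →
    Unique (map proj₁ glue) →
    All (_∈ (a₁ ∷ a₂ ∷ b₁ ∷ b₂ ∷ [])) (map proj₁ glue) →
    (∀ w₁ w₂ → KeyPairGs Gs 𝒳 a b a₁ a₂ b₁ b₂ w₁ w₂ →
    (w₁ ∈ map proj₁ glue) × (w₂ ∈ map proj₁ glue)) →
    (∀ s₁ h₁ s₂ h₂ → (s₁ , h₁) ∈ glue → (s₂ , h₂) ∈ glue →
    (KeyPairGs Gs 𝒳 a b a₁ a₂ b₁ b₂ s₁ s₂ → KeyPairH 𝒳H (map proj₂ glue) h₁ h₂) ×
    (KeyPairH 𝒳H (map proj₂ glue) h₁ h₂ → KeyPairGs Gs 𝒳 a b a₁ a₂ b₁ b₂ s₁ s₂)) →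
    (J : Graph) → Glued Gs H glue J →
    Indep (E J) →
    ∃[ u ] ∃[ v ] ImpliedNonedge J u v
theorem6 G 𝒳 a b base a₁ a₂ b₁ b₂ Gs safe H 𝒳H glue ear disjoint unique new keys-glued keys-match J glued indepJ =
  Glue.implied G 𝒳 a b base a₁ a₂ b₁ b₂ Gs safe H 𝒳H glue ear disjoint unique new keys-glued
    (λ s₁ h₁ s₂ h₂ s∈ t∈ → proj₁ (keys-match s₁ h₁ s₂ h₂ s∈ t∈)) J glued indepJ
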